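{- Let $Q_n(x,y,z,t)$ be defined by $Q_1=1$, $Q_{n+1}=[x+nz+(y+t)(n+y\partial_y)]Q_n$, and define $Q_{n,k}(x,t)$ by $Q_n(x,y,1,t)=\sum_{k=0}^{n-1}Q_{n,k}(x,t)y^k$. Then for $n\geq 1$, $$Q_{n,k}(x,t)=\sum_{F\in \mathcal H_{n,k}}x^{{\rm tree}(F)-1}t^{{\rm bdeg}(F)},$$ equivalently $$Q_n(x,y,1,t)=\sum_{F\in\mathcal H_n}x^{{\rm tree}(F)-1}y^{{\rm imp}(F)}t^{{\rm bdeg}(F)}.$$
   Context: A half-mobile tree is a rooted tree with two kinds of vertices, labeled (white) and unlabeled (black), such that each black vertex has at least two children, all of them white; there is a fixed cyclic order on the children of each black vertex; the children of each white vertex are unordered. A forest of half-mobile trees on $[n]$ is a graph whose connected components are half-mobile trees and whose white vertices are labeled bijectively by $[n]=\{1,\dots,n\}$ (forests are considered up to isomorphism preserving labels, roots and cyclic orders). For any vertex $v$, $\beta(v)$ is the smallest white descendant of $v$ (including $v$ if white), where descendants of $v$ are vertices whose path from the root passes through $v$. The cyclic order on the children of a black vertex is represented linearly by declaring its rightmost child to be the child $x$ with the smallest $\beta(x)$. An edge $(u,v)$ ($v$ a child of $u$) is improper if either $u,v$ are both white and $u>\beta(v)$, or $u$ is black, $v$ is its rightmost child, and the (white) father of $u$ exists and is greater than $\beta(v)$. For a forest $F$: ${\rm imp}(F)$ is its number of improper edges, ${\rm tree}(F)$ its number of half-mobile trees, and ${\rm bdeg}(F)=\sum_{v\ \text{black}}({\rm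 deg}_F(v)-1)$ where ${\rm deg}_F(v)$ is the number of children of $v$. $\mathcal H_n$ is the set of forests of half-mobile trees on $[n]$ and $\mathcal H_{n,k}$ the subset of those with exactly $k$ improper edges. -}

module Defs where

open import Data.Nat using (ℕ; zero; suc; _+_; _∸_; _≡ᵇ_; _≤ᵇ_; _<ᵇ_; _⊓_)
open import Data.Bool using (Bool; true; false; _∧_; _∨_; not; if_then_else_)
open import Data.Fin using (Fin; toℕ)
open import Data.Maybe using (Maybe; just; nothing)
open import Data.List using (List; []; _∷_; _++_; map; concatMap; replicate; concat; length; filterᵇ; foldr; upTo)
open import Data.Nat.ListAction using (sum)
open import Data.Bool.ListAction using (any; all)
open import Data.List.Base using (allFin)
open import Data.Vec using (Vec; lookup)
open import Data.Product using (_×_; _,_)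

-- Polynomials in x, y, z, t with natural-number coefficients,
-- represented as a finite multiset (list) of monomials; a monomial
-- x^a y^b z^c t^d is the tuple (a , b , c , d).  The coefficient of a
-- monomial is its multiplicity in the list.

Mono : Set
Mono = ℕ × ℕ × ℕ × ℕ

Poly : Set
Poly = List Mono

mulX mulY mulZ mulT : Poly → Poly
mulX = map (λ { (a , b , c , d) → (suc a , b , c , d) })
mulY = map (λ { (a , b , c , d) → (a , suc b , c , d) })
mulZ = map (λ { (a , b , c , d) → (a , b , suc c , d) })
mulT = map (λ { (a , b , c , d) → (a , b , c , suc d) })

scale : ℕ → Poly → Poly
scale n P = concat (replicate n P)

yDy : Poly → Poly
yDy = concatMap (λ { (a , b , c , d) → replicate b (a , b , c , d) })

op : ℕ → Poly → Poly
op n P = mulX P ++ scale n (mulZ P) ++ (mulY R ++ mulT R)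
  where R = scale n P ++ yDy P

-- Q_1 = 1 , Q_{n+1} = [x + n z + (y+t)(n + y ∂_y)] Q_n   (Q 0 unused)
Q : ℕ → Poly
Q zero = []
Q (suc zero) = (0 , 0 , 0 , 0) ∷ []
Q (suc (suc n)) = op (suc n) (Q (suc n))

coeffZ1 : Poly → ℕ → ℕ → ℕ → ℕ
coeffZ1 P i k j =
  length (filterᵇ (λ { (a , b , c , d) → (a ≡ᵇ i) ∧ (b ≡ᵇ k) ∧ (d ≡ᵇ j) }) P)

-- Forests of half-mobile trees on [n].
-- White vertex with label ℓ ∈ [n] is encoded by (ℓ-1) : Fin n (order
-- preserving).  A black vertex is identified by the smallest label among
-- its (white) children, its "key".

data Par (n : ℕ) : Set where
  root : Par n
  wpar : Fin n → Par n
  bpar : Fin n → Par n    -- parent is the black vertex with key given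

record HF (n : ℕ) : Set where
  constructor hf
  field
    par : Vec (Par n) n
    bq  : Vec (Maybe (Fin n)) n    -- for a key m: father of black vertex m
                                    --   (nothing = black root); else nothing
    cyc : Vec (Fin n) n            -- cyclic successor among the children of
                                    -- a black vertex; identity elsewhere
open HF public

module _ {n : ℕ} where

  _==_ : Fin n → Fin n → Bool
  a == b = toℕ a ≡ᵇ toℕ b

  _==M_ : Maybe (Fin n) → Maybe (Fin n) → Bool
  just a ==M just b = a == b
  nothing ==M nothing = true
  _ ==M _ = false

  isNothing : Maybe (Fin n) → Bool
  isNothing nothing = true
  isNothing (just _) = false

  fins : List (Fin n)
  fins = allFin n

  allF anyF : (Fin n → Bool) → Bool
  allF p = all p fins
  anyF p = any p fins

  countF : (Fin n → Bool) → ℕ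
  countF p = length (filterᵇ p fins)

  module _ (F : HF n) where

    childOf : Fin n → Fin n → Bool
    childOf w m with lookup (par F) w
    ... | bpar m' = m' == m
    ... | _ = false

    underBlack : Fin n → Bool
    underBlack w with lookup (par F) w
    ... | bpar _ = true
    ... | _ = false

    isRoot : Fin n → Bool
    isRoot w with lookup (par F) w
    ... | root = true
    ... | _ = false

    whiteEdge : Fin n → Fin n → Bool
    whiteEdge u v with lookup (par F) v
    ... | wpar u' = u' == u
    ... | _ = false

    isKey : Fin n → Bool
    isKey m = childOf m m

    up : Fin n → Maybe (Fin n)
    up w with lookup (par F) w
    ... | root = nothing
    ... | wpar u = just u
    ... | bpar m = lookup (bq F) m

    iterUp : ℕ → Maybe (Fin n) → Maybe (Fin n)
    iterUp zero x = x
    iterUp (suc k) nothing = nothing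
    iterUp (suc k) (just w) = iterUp k (up w)

    iterCyc : ℕ → Fin n → Fin n
    iterCyc zero w = w
    iterCyc (suc k) w = iterCyc k (lookup (cyc F) w)

    anc : Fin n → Fin n → Bool
    anc a u = any (λ k → iterUp k (just u) ==M just a) (upTo (suc n))

    wf : Bool
    wf = allF (λ w → allF (λ m → not (childOf w m) ∨ (isKey m ∧ (toℕ m ≤ᵇ toℕ w))))
       ∧ allF (λ m → isKey m ∨ isNothing (lookup (bq F) m))
       ∧ allF (λ w → underBlack w ∨ (lookup (cyc F) w == w))
       ∧ allF (λ w → allF (λ m → not (childOf w m) ∨ childOf (lookup (cyc F) w) m))
       ∧ allF (λ u → allF (λ v → not (lookup (cyc F) u == lookup (cyc F) v) ∨ (u == v)))
       ∧ allF (λ m → not (isKey m) ∨ not (lookup (cyc F) m == m))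
       ∧ allF (λ w → allF (λ m → not (childOf w m)
                                 ∨ any (λ k → iterCyc k m == w) (upTo (suc n))))
       ∧ allF (λ w → isNothing (iterUp n (just w)))

    βW : Fin n → ℕ
    βW w = foldr (λ u acc → if anc w u then toℕ u ⊓ acc else acc) (toℕ w) fins

    rightmost : Fin n → Fin n → Bool
    rightmost m v = childOf v m ∧ allF (λ x → not (childOf x m) ∨ (βW v ≤ᵇ βW x))

    blackFatherGreater : Fin n → ℕ → Bool
    blackFatherGreater m b with lookup (bq F) m
    ... | just f = b <ᵇ toℕ f
    ... | nothing = false

    imp : ℕ
    imp = sum (map (λ u → countF (λ v → whiteEdge u v ∧ (βW v <ᵇ toℕ u))) fins)
        + sum (map (λ m → countF (λ v → isKey m ∧ rightmost m v
                                          ∧ blackFatherGreater m (βW v))) fins)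

    tree : ℕ
    tree = countF isRoot + countF (λ m → isKey m ∧ isNothing (lookup (bq F) m))

    bdeg : ℕ
    bdeg = sum (map (λ m → if isKey m then countF (λ w → childOf w m) ∸ 1 else 0) fins)

{-# OPTIONS --safe #-}
module Submission where

-- A forest is recoded as a permutation σ of the white vertices together with a father map that is
-- constant on the cycles of σ; the nontrivial cycles are the black vertices.  Every cycle has a
-- representative, its vertex of least β, so that trees, improper edges and bdeg count the
-- representatives without father, the representatives smaller (in β) than their father, and the
-- vertices that are not representatives.
--
-- The recurrence is the insertion of a new largest label ∗:
--   x             ∗ is a root;
--   n             ∗ is a leaf below a white vertex;
--   t n           ∗ is a leaf put before a white vertex v in the cycle of v;
--   y n           ∗ takes the place of a white vertex u, which becomes the only child of ∗;
--   y (y d/dy)    for an improper cycle C below u: ∗ takes the place of u, u becomes a child of ∗, and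
--                 the cycles P below u with β(P) ≤ β(C), all of them improper, become children of ∗;
--   t (y d/dy)    the same, and then u is moved into the cycle C, right after its representative.
-- Conversely, let M be the representative of greatest β among the children of ∗.  If there is none we
-- are in one of the first three cases.  If M is a fixed point of σ then u = M, otherwise u = σ(M) in
-- the last case.  A vertex u exceeds the β of its improper children, so its new β after losing them
-- still exceeds β(C); this makes u, or C in the last case, the child of ∗ of greatest β.

open import Defs
open import Data.Nat using (ℕ; _≤_; _∸_)
open import Data.Fin using (Fin)
open import Data.Bool using (T)
open import Data.Product using (Σ; _×_)
open import Function.Bundles using (_↔_)
open import Relation.Binary.PropositionalEquality using (_≡_)

open import Axiom.UniquenessOfIdentityProofs.WithK using (uip)
open import Algebra.Properties.CommutativeSemigroup using (interchange)
open import Data.Bool using (Bool; true; false; if_then_else_; _∧_; _∨_; not)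
open import Data.Bool.ListAction using (any)
open import Data.Bool.Properties using (T-irrelevant)
open import Data.Empty using (⊥-elim)
open import Data.Fin using (zero; suc; toℕ; opposite)
open import Data.Fin.Permutation using (↔⇒≡)
open import Data.Fin.Permutation.Components using (transpose)
open import Data.Fin.Properties
  using (_≟_; suc-injective; toℕ-injective; toℕ<n; injective⇒≤; pigeonhole; +↔⊎; opposite-involutive; opposite-prop)
open import Data.List as List using (List; []; _∷_; _++_; allFin; upTo; foldr; replicate; filterᵇ; length)
open import Data.List.Membership.Propositional using (_∈_; lose; find)
open import Data.List.Membership.Propositional.Properties using (∈-allFin; ∈-upTo⁺; ∈-upTo⁻)
import Data.List.Relation.Unary.All as All
open import Data.List.Relation.Unary.All.Properties using (all⁺; all⁻)
open import Data.List.Relation.Unary.Any using (Any; here; there)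
open import Data.List.Relation.Unary.Any.Properties using (any⁺; any⁻; map↔; ++↔; concat↔; ⊎↔)
open import Data.Maybe as Maybe using (Maybe; just; nothing; _>>=_)
open import Data.Maybe.Properties as Maybe using (just-injective; map-injective; map-cong; map-id; map-∘)
open import Data.Nat using (zero; suc; _+_; _<_; z≤n; s≤s; _≤?_; _⊓_; _<ᵇ_; _≡ᵇ_; _≤ᵇ_)
open import Data.Nat.GeneralisedArithmetic using (iterate)
open import Data.Nat.Induction using (<-wellFounded)
open import Data.Nat.ListAction using (sum)
import Data.Nat.Properties as ℕ
open import Data.Product using (∃; _,_; proj₁; proj₂)
open import Data.Product.Function.Dependent.Propositional using () renaming (cong to Σ-cong)
open import Data.Product.Function.NonDependent.Propositional using (_×-↔_)
open import Data.Sum as Sum using (_⊎_; inj₁; inj₂)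
open import Data.Sum.Function.Propositional using (_⊎-↔_)
open import Data.Unit using (⊤; tt)
open import Data.Vec using (Vec; lookup; tabulate)
open import Data.Vec.Properties using (lookup∘tabulate; tabulate∘lookup; tabulate-cong)
open import Function using (_∘_; id)
open import Function.Bundles using (mk↔ₛ′)
open import Function.Properties.Inverse using (↔-refl; ↔-sym; ↔-trans)
open import Induction.WellFounded using (Acc; acc)
open import Relation.Binary.PropositionalEquality
  using (_≢_; refl; sym; trans; cong; cong₂; subst; subst₂; module ≡-Reasoning)
open import Relation.Nullary using (¬_; Dec; yes; no; does)
open import Relation.Nullary.Decidable using (_×-dec_; dec-true; dec-false; T?)

-- Why the cut at β(C): a cycle below u is improper when its β is less than u, so the improper
-- cycles form an initial segment of the cycles below u ordered by β, and the nonempty initial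
-- segments of this one are indexed by their last cycle C; `above` is the empty segment. Hence y (n
-- + y d/dy) counts the pairs of a vertex u and such a segment. Moving the segment to ∗ changes no
-- kind, because every cycle below ∗ is improper, and u is the only additional improper vertex. The
-- place of u keeps its father and its β, as the label of ∗ is too large to lower a minimum. A
-- forest consists of functions and proofs, so insertion is a bijection only up to the relation `≈`.
-- Insertion histories (`Code`) have a usable equality: they are matched with the terms of Q n on
-- one side and with the vectors of `HF`, where `≈` becomes equality, on the other.

private variable
  n : ℕ

-- Labels decrease along Fin n, so that the new largest label is zero and old labels are kept by suc.
rk : Fin n → ℕ
rk {suc n} zero = n
rk (suc i) = rk i

-- Orbits and father maps

data Reach {A : Set} (f : A → A) (t : A) : A → Set where
  here : Reach f t t
  step : ∀ {x} → Reach f t (f x) → Reach f t x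

Reach-invariant : {A B : Set} {f : A → A} {t x : A} (g : A → B) → (∀ y → g (f y) ≡ g y) →
                  Reach f t x → g x ≡ g t
Reach-invariant g inv here = refl
Reach-invariant g inv (step r) = trans (sym (inv _)) (Reach-invariant g inv r)

data Rooted {A : Set} (parent : A → Maybe A) : A → Set where
  top : ∀ {x} → parent x ≡ nothing → Rooted parent x
  below : ∀ {x w} → parent x ≡ just w → Rooted parent w → Rooted parent x

-- A white vertex x carries the label lab x.  A nontrivial cycle of σ is the set of children of a black
-- vertex, in their cyclic order, and parent is the father of that black vertex; on fixed points of σ,
-- parent is the white father.  β and o are determined by the other data: β x is the least label of a
-- descendant of x and o x the vertex of least β on the cycle of x.
record Forest (n : ℕ) (lab : Fin n → ℕ) : Set where
  field
    σ : Fin n → Fin n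
    parent : Fin n → Maybe (Fin n)
    β : Fin n → ℕ
    o : Fin n → Fin n
    σ-injective : ∀ {x y} → σ x ≡ σ y → x ≡ y
    up-σ : ∀ x → parent (σ x) ≡ parent x
    o-σ : ∀ x → o (σ x) ≡ o x
    o-min : ∀ x → β (o x) ≤ β x
    reach : ∀ x → Reach σ (o x) x
    β≤lab : ∀ x → β x ≤ lab x
    β≤kid : ∀ {x w} → parent x ≡ just w → β w ≤ β x
    β-attained : ∀ w → β w ≡ lab w ⊎ ∃ λ x → parent x ≡ just w × β w ≡ β x
    rooted : ∀ x → Rooted parent x

  up-o : ∀ x → parent (o x) ≡ parent x
  up-o x = sym (Reach-invariant parent up-σ (reach x))

  o-o : ∀ x → o (o x) ≡ o x
  o-o x = sym (Reach-invariant o o-σ (reach x))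

rooted-irreflexive : {A : Set} {parent : A → Maybe A} {x : A} → Rooted parent x → parent x ≢ just x
rooted-irreflexive (top e) e' with () ← trans (sym e) e'
rooted-irreflexive (below e r) e' with refl ← just-injective (trans (sym e) e') =
  rooted-irreflexive r e

fixed-unreachable : {A : Set} {f : A → A} {t x : A} → (∀ {y z} → f y ≡ f z → y ≡ z) →
                    f t ≡ t → Reach f t x → x ≡ t
fixed-unreachable inj fix here = refl
fixed-unreachable inj fix (step r) = inj (trans (fixed-unreachable inj fix r) (sym fix))

fixed-stays : {A : Set} {f : A → A} {t x : A} → f x ≡ x → Reach f t x → t ≡ x
fixed-stays {f = f} {t} {x} fix r = go r refl
  where
  go : ∀ {y} → Reach f t y → y ≡ x → t ≡ x
  go here e = e
  go (step r) refl = go r fix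

-- Transpositions

transpose-fst : (a b : Fin n) → transpose a b a ≡ b
transpose-fst a b with a ≟ a
... | yes _ = refl
... | no a≢a = ⊥-elim (a≢a refl)

transpose-snd : (a b : Fin n) → transpose a b b ≡ a
transpose-snd a b with b ≟ a
... | yes b≡a = b≡a
... | no _ with b ≟ b
...   | yes _ = refl
...   | no b≢b = ⊥-elim (b≢b refl)

transpose-other : {a b x : Fin n} → x ≢ a → x ≢ b → transpose a b x ≡ x
transpose-other {a = a} {b} {x} x≢a x≢b with x ≟ a
... | yes x≡a = ⊥-elim (x≢a x≡a)
... | no _ with x ≟ b
...   | yes x≡b = ⊥-elim (x≢b x≡b)
...   | no _ = refl

transpose-involutive : (a b x : Fin n) → transpose a b (transpose a b x) ≡ x
transpose-involutive a b x with x ≟ a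
... | yes refl = transpose-snd a b
... | no x≢a with x ≟ b
...   | yes refl = transpose-fst a b
...   | no x≢b = transpose-other x≢a x≢b

transpose-injective : (a b : Fin n) {x y : Fin n} → transpose a b x ≡ transpose a b y → x ≡ y
transpose-injective a b {x} {y} e =
  trans (sym (transpose-involutive a b x)) (trans (cong (transpose a b) e) (transpose-involutive a b y))

transpose-invariant : {B : Set} {a b : Fin n} (g : Fin n → B) → g a ≡ g b →
                      ∀ x → g (transpose a b x) ≡ g x
transpose-invariant {a = a} {b} g e x with x ≟ a
... | yes refl = sym e
... | no _ with x ≟ b
...   | yes refl = e
...   | no _ = refl

map-just⁻ : {A B : Set} {f : A → B} (p : Maybe A) {y : B} → Maybe.map f p ≡ just y →
            ∃ λ x → p ≡ just x × f x ≡ y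
map-just⁻ (just x) refl = x , refl , refl

-- Relabelling, splicing of cycles, insertion and deletion of a vertex

module _ {n : ℕ} {lab : Fin n → ℕ} (F : Forest n lab) where
  open Forest F

  module _ (π : Fin n → Fin n) (π² : ∀ x → π (π x) ≡ x)
           (lab' : Fin n → ℕ) (lab'≡ : ∀ x → lab' x ≡ lab (π x)) where
    private
      σ' : Fin n → Fin n
      σ' = π ∘ σ ∘ π

      up' : Fin n → Maybe (Fin n)
      up' = Maybe.map π ∘ parent ∘ π

      π-injective : ∀ {x y} → π x ≡ π y → x ≡ y
      π-injective {x} {y} e = trans (sym (π² x)) (trans (cong π e) (π² y))

      up-π : ∀ x → up' (π x) ≡ Maybe.map π (parent x)
      up-π x = cong (Maybe.map π ∘ parent) (π² x)

      reach-π : ∀ {t x} → Reach σ t x → Reach σ' (π t) (π x)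
      reach-π here = here
      reach-π {x = x} (step r) =
        step (subst (Reach σ' _) (cong (π ∘ σ) (sym (π² x))) (reach-π r))

      rooted-π : ∀ {x} → Rooted parent x → Rooted up' (π x)
      rooted-π (top e) = top (trans (up-π _) (cong (Maybe.map π) e))
      rooted-π (below e r) = below (trans (up-π _) (cong (Maybe.map π) e)) (rooted-π r)

      up'⁻ : ∀ {x w} → up' x ≡ just w → parent (π x) ≡ just (π w)
      up'⁻ {x} e with f , p , q ← map-just⁻ (parent (π x)) e =
        trans p (cong just (trans (sym (π² f)) (cong π q)))

    -- An involution is its own inverse, which settles the round trips. The renamings that occur are
    -- the transposition of ∗ with u and the reversal of the order of labels.
    relabel : Forest n lab'
    relabel = record
      { σ = σ' ; parent = up' ; β = β ∘ π ; o = π ∘ o ∘ π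
      ; σ-injective = π-injective ∘ σ-injective ∘ π-injective
      ; up-σ = λ x → trans (up-π _) (cong (Maybe.map π) (up-σ (π x)))
      ; o-σ = λ x → cong π (trans (cong o (π² _)) (o-σ (π x)))
      ; o-min = λ x → subst (_≤ β (π x)) (cong β (sym (π² _))) (o-min (π x))
      ; reach = λ x → subst (Reach σ' _) (π² x) (reach-π (reach (π x)))
      ; β≤lab = λ x → subst (β (π x) ≤_) (sym (lab'≡ x)) (β≤lab (π x))
      ; β≤kid = λ e → β≤kid (up'⁻ e)
      ; β-attained = attained
      ; rooted = λ x → subst (Rooted up') (π² x) (rooted-π (rooted (π x)))
      }
      where
      attained : ∀ w → β (π w) ≡ lab' w ⊎ ∃ λ x → up' x ≡ just w × β (π w) ≡ β (π x)
      attained w with β-attained (π w)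
      ... | inj₁ e = inj₁ (trans e (sym (lab'≡ w)))
      ... | inj₂ (x , e , e') = inj₂ (π x , trans (up-π x) (trans (cong (Maybe.map π) e) (cong just (π² w)))
                                     , trans e' (cong β (sym (π² x))))

  -- The fixed point s is inserted before y into the cycle of y.
  module _ (s y : Fin n) (fix : σ s ≡ s) (s≢y : s ≢ y) (up≡ : parent s ≡ parent y) (β≤ : β (o y) ≤ β s) where
    private
      σ' : Fin n → Fin n
      σ' x = transpose s y (σ x)

      -- Only the representative of s changes: by `β≤`, `o y` still has the least β on the enlarged
      -- cycle.
      o' : Fin n → Fin n
      o' x = if does (x ≟ s) then o y else o x

      o'-s : o' s ≡ o y
      o'-s with s ≟ s
      ... | yes _ = refl
      ... | no s≢s = ⊥-elim (s≢s refl)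

      o'-other : ∀ {x} → x ≢ s → o' x ≡ o x
      o'-other {x} x≢s with x ≟ s
      ... | yes x≡s = ⊥-elim (x≢s x≡s)
      ... | no _ = refl

      σ-other : ∀ {x} → x ≢ s → σ x ≢ s
      σ-other x≢s e = x≢s (σ-injective (trans e (sym fix)))

      o'-σ : ∀ x → o' (σ x) ≡ o' x
      o'-σ x with x ≟ s
      ... | yes refl = trans (cong o' fix) o'-s
      ... | no x≢s = trans (o'-other (σ-other x≢s)) (o-σ x)

      reach-other : ∀ {t x} → x ≢ s → Reach σ t x → Reach σ' t x
      reach-other x≢s here = here
      reach-other {t} {x} x≢s (step r) with reach-other (σ-other x≢s) r
      ... | r' with σ x ≟ y
      -- A path that went from x to y now makes the detour x, s, y.
      ...   | yes e = step (subst (Reach σ' t) (sym (trans (cong (transpose s y) e) (transpose-snd s y)))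
                        (step (subst (Reach σ' t)
                           (sym (trans (cong (transpose s y) fix) (trans (transpose-fst s y) (sym e)))) r')))
      ...   | no e = step (subst (Reach σ' t) (sym (transpose-other (σ-other x≢s) e)) r')

    merge : Forest n lab
    merge = record
      { σ = σ' ; parent = parent ; β = β ; o = o'
      ; σ-injective = σ-injective ∘ transpose-injective s y
      ; up-σ = λ x → trans (transpose-invariant parent up≡ (σ x)) (up-σ x)
      ; o-σ = λ x → trans (transpose-invariant o' (trans o'-s (sym (o'-other (s≢y ∘ sym)))) (σ x)) (o'-σ x)
      ; o-min = omin
      ; reach = reach'
      ; β≤lab = β≤lab ; β≤kid = β≤kid ; β-attained = β-attained ; rooted = rooted
      }
      where
      omin : ∀ x → β (o' x) ≤ β x
      omin x with x ≟ s
      ... | yes refl = β≤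
      ... | no _ = o-min x

      reach' : ∀ x → Reach σ' (o' x) x
      reach' x with x ≟ s
      ... | yes refl = step (subst (Reach σ' (o y)) (sym (trans (cong (transpose s y) fix) (transpose-fst s y)))
                         (reach-other (s≢y ∘ sym) (reach y)))
      ... | no x≢s = reach-other x≢s (reach x)

    merge-o-s : Forest.o merge s ≡ o y
    merge-o-s = o'-s

    merge-o-other : ∀ {x} → x ≢ s → Forest.o merge x ≡ o x
    merge-o-other = o'-other

  -- Inverse of merge: s is removed from its cycle and becomes a fixed point.
  module _ (s : Fin n) (nonrep : o s ≢ s) where
    private
      σ' : Fin n → Fin n
      σ' x = transpose s (σ s) (σ x)

      o' : Fin n → Fin n
      o' x = if does (x ≟ s) then s else o x

      o'-s : o' s ≡ s
      o'-s with s ≟ s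
      ... | yes _ = refl
      ... | no s≢s = ⊥-elim (s≢s refl)

      o'-other : ∀ {x} → x ≢ s → o' x ≡ o x
      o'-other {x} x≢s with x ≟ s
      ... | yes x≡s = ⊥-elim (x≢s x≡s)
      ... | no _ = refl

      σs≢s : σ s ≢ s
      σs≢s e = nonrep (fixed-stays e (reach s))

      o≢s : ∀ x → o x ≢ s
      o≢s x e = nonrep (trans (cong o (sym e)) (trans (o-o x) e))

      σ'-s : σ' s ≡ s
      σ'-s = transpose-snd s (σ s)

      σ'-to-s : ∀ {x} → σ x ≡ s → σ' x ≡ σ s
      σ'-to-s e = trans (cong (transpose s (σ s)) e) (transpose-fst s (σ s))

      o-σ' : ∀ x → o' (σ' x) ≡ o' x
      o-σ' x = go (x ≟ s) (σ x ≟ s)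
        where
        go : Dec (x ≡ s) → Dec (σ x ≡ s) → o' (σ' x) ≡ o' x
        go (yes refl) _ = cong o' σ'-s
        go (no x≢s) (yes e) = trans (cong o' (σ'-to-s e)) (trans (o'-other σs≢s) (trans (o-σ s)
          (trans (cong o (sym e)) (trans (o-σ x) (sym (o'-other x≢s))))))
        go (no x≢s) (no ne) = trans (cong o' (transpose-other ne (x≢s ∘ σ-injective)))
          (trans (o'-other ne) (trans (o-σ x) (sym (o'-other x≢s))))

      -- A path through s loses that vertex, since the predecessor of s now goes straight to `σ s`.
      -- The second function treats a path that has just arrived at s.
      reach-other : ∀ {t x} → t ≢ s → x ≢ s → Reach σ t x → Reach σ' t x
      reach-s : ∀ {t x} → t ≢ s → x ≡ s → Reach σ t x → Reach σ' t (σ s)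

      reach-other t≢s x≢s here = here
      reach-other {t} {x} t≢s x≢s (step r) = go (σ x ≟ s)
        where
        go : Dec (σ x ≡ s) → Reach σ' t x
        go (yes e) = step (subst (Reach σ' t) (sym (σ'-to-s e)) (reach-s t≢s e r))
        go (no ne) = step (subst (Reach σ' t) (sym (transpose-other ne (x≢s ∘ σ-injective)))
                       (reach-other t≢s ne r))

      reach-s t≢s e here = ⊥-elim (t≢s e)
      reach-s t≢s refl (step r) = reach-other t≢s σs≢s r

    unmerge : Forest n lab
    unmerge = record
      { σ = σ' ; parent = parent ; β = β ; o = o'
      ; σ-injective = σ-injective ∘ transpose-injective s (σ s)
      ; up-σ = λ x → trans (transpose-invariant parent (sym (up-σ s)) (σ x)) (up-σ x)
      ; o-σ = o-σ'
      ; o-min = omin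
      ; reach = reach'
      ; β≤lab = β≤lab ; β≤kid = β≤kid ; β-attained = β-attained ; rooted = rooted
      }
      where
      omin : ∀ x → β (o' x) ≤ β x
      omin x with x ≟ s
      ... | yes refl = ℕ.≤-refl
      ... | no _ = o-min x

      reach' : ∀ x → Reach σ' (o' x) x
      reach' x with x ≟ s
      ... | yes refl = here
      ... | no x≢s = reach-other (o≢s x) x≢s (reach x)

    unmerge-σ-s : Forest.σ unmerge s ≡ s
    unmerge-σ-s = σ'-s

    unmerge-o-s : Forest.o unmerge s ≡ s
    unmerge-o-s = o'-s

    unmerge-o-other : ∀ {x} → x ≢ s → Forest.o unmerge x ≡ o x
    unmerge-o-other = o'-other

  -- A new vertex zero is inserted below q and adopts the children of q selected by K.  The labels are
  -- free, because cap lets the new vertex exchange labels with q; b is the value of β at zero.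
  module _ (q : Maybe (Fin n)) (K : Fin n → Bool) (lab' : Fin (suc n) → ℕ) (b : ℕ)
           (K-up : ∀ {x} → K x ≡ true → parent x ≡ q)
           (K-σ : ∀ x → K (σ x) ≡ K x)
           (β≤lab' : ∀ x → β x ≤ lab' (suc x))
           (b≤lab : b ≤ lab' zero)
           (b≤K : ∀ {x} → K x ≡ true → b ≤ β x)
           (b-attained : b ≡ lab' zero ⊎ ∃ λ x → K x ≡ true × b ≡ β x)
           (q≤b : ∀ {w} → q ≡ just w → β w ≤ b)
           (attained : ∀ w → β w ≡ lab' (suc w) ⊎ ((∃ λ x → parent x ≡ just w × K x ≡ false × β w ≡ β x)
                                                   ⊎ (q ≡ just w × β w ≡ b)))
    where
    private
      σ' o' : Fin (suc n) → Fin (suc n)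
      σ' zero = zero
      σ' (suc x) = suc (σ x)
      o' zero = zero
      o' (suc x) = suc (o x)

      up' : Fin (suc n) → Maybe (Fin (suc n))
      up' zero = Maybe.map suc q
      up' (suc x) = if K x then just zero else Maybe.map suc (parent x)

      β' : Fin (suc n) → ℕ
      β' zero = b
      β' (suc x) = β x

      reach' : ∀ {t x} → Reach σ t x → Reach σ' (suc t) (suc x)
      reach' here = here
      reach' (step r) = step (reach' r)

      up'-K : ∀ {x} → K x ≡ true → up' (suc x) ≡ just zero
      up'-K e rewrite e = refl

      up'-¬K : ∀ {x} → K x ≡ false → up' (suc x) ≡ Maybe.map suc (parent x)
      up'-¬K e rewrite e = refl

      rooted' : ∀ {x} → Rooted parent x → Rooted up' (suc x)
      rooted' {x} (top e) with K x in k
      -- The new vertex slips in between x and its former father.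
      ... | true = below (up'-K k) (top (cong (Maybe.map suc) (trans (sym (K-up k)) e)))
      ... | false = top (trans (up'-¬K k) (cong (Maybe.map suc) e))
      rooted' {x} (below e r) with K x in k
      ... | true = below (up'-K k) (below (cong (Maybe.map suc) (trans (sym (K-up k)) e)) (rooted' r))
      ... | false = below (trans (up'-¬K k) (cong (Maybe.map suc) e)) (rooted' r)

      rooted₀ : ∀ p → q ≡ p → Rooted up' zero
      rooted₀ nothing e = top (cong (Maybe.map suc) e)
      rooted₀ (just w) e = below (cong (Maybe.map suc) e) (rooted' (rooted w))

      kid : ∀ {x w} → up' x ≡ just w → β' w ≤ β' x
      kid {zero} e with w , e' , refl ← map-just⁻ q e = q≤b e'
      kid {suc x} e with K x in k
      kid {suc x} refl | true = b≤K k
      ... | false with w , e' , refl ← map-just⁻ (parent x) e = β≤kid e'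

      att : ∀ w → β' w ≡ lab' w ⊎ ∃ λ x → up' x ≡ just w × β' w ≡ β' x
      att zero = Sum.map₂ (λ { (x , k , e) → suc x , up'-K k , e }) b-attained
      att (suc w) with attained w
      ... | inj₁ e = inj₁ e
      ... | inj₂ (inj₁ (x , e , k , e')) = inj₂ (suc x , trans (up'-¬K k) (cong (Maybe.map suc) e) , e')
      ... | inj₂ (inj₂ (e , e')) = inj₂ (zero , cong (Maybe.map suc) e , e')

    grow : Forest (suc n) lab'
    grow = record
      { σ = σ' ; parent = up' ; β = β' ; o = o'
      ; σ-injective = λ { {zero} {zero} _ → refl ; {suc _} {suc _} e → cong suc (σ-injective (suc-injective e)) }
      ; up-σ = λ { zero → refl ; (suc x) → cong₂ (λ k p → if k then just zero else Maybe.map suc p) (K-σ x) (up-σ x) }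
      ; o-σ = λ { zero → refl ; (suc x) → cong suc (o-σ x) }
      ; o-min = λ { zero → ℕ.≤-refl ; (suc x) → o-min x }
      ; reach = λ { zero → here ; (suc x) → reach' (reach x) }
      ; β≤lab = λ { zero → b≤lab ; (suc x) → β≤lab' x }
      ; β≤kid = λ {x} → kid {x}
      ; β-attained = att
      ; rooted = λ { zero → rooted₀ q refl ; (suc x) → rooted' (rooted x) }
      }

predFin : Fin (suc n) → Maybe (Fin n)
predFin zero = nothing
predFin (suc x) = just x

-- The default d only makes the function total: wherever it is applied, the argument is shown to
-- differ from `zero`.
predFrom : Fin n → Fin (suc n) → Fin n
predFrom d zero = d
predFrom d (suc x) = x

suc-predFrom : (d : Fin n) (x : Fin (suc n)) → x ≢ zero → x ≡ suc (predFrom d x)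
suc-predFrom d zero ne = ⊥-elim (ne refl)
suc-predFrom d (suc x) ne = refl

module _ {n : ℕ} {lab' : Fin (suc n) → ℕ} (G : Forest (suc n) lab') where
  open Forest G

  grandfather : Maybe (Fin n)
  grandfather = parent zero >>= predFin

  -- The father map after deletion of zero, whose children pass to the father of zero.
  contract : Maybe (Fin (suc n)) → Maybe (Fin n)
  contract nothing = nothing
  contract (just zero) = grandfather
  contract (just (suc w)) = just w

  module _ (lab : Fin n → ℕ) (fix : σ zero ≡ zero)
           (β≤ : ∀ x → β (suc x) ≤ lab x)
           (attained : ∀ w → β (suc w) ≡ lab w
                           ⊎ ∃ λ x → contract (parent (suc x)) ≡ just w × β (suc w) ≡ β (suc x))
    where
    private
      σ' o' : Fin n → Fin n
      σ' x = predFrom x (σ (suc x))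
      o' x = predFrom x (o (suc x))

      up' : Fin n → Maybe (Fin n)
      up' x = contract (parent (suc x))

      σ≢0 : ∀ x → σ (suc x) ≢ zero
      σ≢0 x e with () ← σ-injective (trans e (sym fix))

      σ-suc : ∀ x → σ (suc x) ≡ suc (σ' x)
      σ-suc x = suc-predFrom x _ (σ≢0 x)

      o≢0 : ∀ x → o (suc x) ≢ zero
      o≢0 x e with () ← fixed-unreachable σ-injective fix (subst (λ t → Reach σ t (suc x)) e (reach (suc x)))

      o-suc : ∀ x → o (suc x) ≡ suc (o' x)
      o-suc x = suc-predFrom x _ (o≢0 x)

      reach' : ∀ {t x t' x'} → Reach σ t x → t ≡ suc t' → x ≡ suc x' → Reach σ' t' x'
      reach' here refl refl = here
      reach' {x' = x'} (step r) refl refl = step (reach' r refl (σ-suc x'))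

      grandfather-up : ∀ {w} → grandfather ≡ just w → parent zero ≡ just (suc w)
      grandfather-up e with parent zero
      grandfather-up refl | just (suc w) = refl

      -- A chain of ancestors may pass through the deleted vertex. There the induction has to speak
      -- of its father, to which the children are reattached.
      RootedAt : Fin (suc n) → Set
      RootedAt zero = ∀ w → grandfather ≡ just w → Rooted up' w
      RootedAt (suc x) = Rooted up' x

      rooted' : ∀ {x} → Rooted parent x → RootedAt x
      rooted' {zero} (top e) w e' with () ← trans (sym e) (grandfather-up e')
      rooted' {zero} (below e r) w e' with refl ← trans (sym e) (grandfather-up e') = rooted' r
      rooted' {suc x} (top e) = top (cong contract e)
      rooted' {suc x} (below {w = zero} e r) with grandfather in g | rooted' r
      ... | nothing | _ = top (trans (cong contract e) g)
      ... | just w | r' = below (trans (cong contract e) g) (r' w refl)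
      rooted' {suc x} (below {w = suc w} e r) = below (cong contract e) (rooted' r)

      kid : ∀ {x w} → up' x ≡ just w → β (suc w) ≤ β (suc x)
      kid {x} e with parent (suc x) in u
      kid {x} e | just zero = ℕ.≤-trans (β≤kid (grandfather-up e)) (β≤kid u)
      kid {x} refl | just (suc w) = β≤kid u

    -- Deleting `zero` can remove the vertex at which some β is attained, and `lab` may differ from
    -- the old labels. Each caller knows what attains the value instead, whence the hypotheses `β≤`
    -- and `attained`.
    shrink : Forest n lab
    shrink = record
      { σ = σ' ; parent = up' ; β = β ∘ suc ; o = o'
      ; σ-injective = λ {x} {y} e → suc-injective (σ-injective (trans (σ-suc x) (trans (cong suc e) (sym (σ-suc y)))))
      ; up-σ = λ x → cong contract (trans (cong parent (sym (σ-suc x))) (up-σ (suc x)))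
      ; o-σ = λ x → suc-injective (trans (sym (o-suc (σ' x))) (trans (cong o (sym (σ-suc x))) (trans (o-σ (suc x)) (o-suc x))))
      ; o-min = λ x → subst (λ y → β y ≤ β (suc x)) (o-suc x) (o-min (suc x))
      ; reach = λ x → reach' (reach (suc x)) (o-suc x) refl
      ; β≤lab = β≤ ; β≤kid = kid ; β-attained = attained
      ; rooted = λ x → rooted' (rooted (suc x))
      }

    shrink-σ : ∀ x → σ (suc x) ≡ suc (σ' x)
    shrink-σ = σ-suc

    shrink-o : ∀ x → o (suc x) ≡ suc (o' x)
    shrink-o = o-suc

-- Extrema, depth, and uniqueness of β among siblings

rk<n : (x : Fin n) → rk x < n
rk<n zero = ℕ.≤-refl
rk<n (suc x) = ℕ.m≤n⇒m≤1+n (rk<n x)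

rk-injective : {x y : Fin n} → rk x ≡ rk y → x ≡ y
rk-injective {x = zero} {zero} e = refl
rk-injective {x = zero} {suc y} e = ⊥-elim (ℕ.<-irrefl (sym e) (rk<n y))
rk-injective {x = suc x} {zero} e = ⊥-elim (ℕ.<-irrefl e (rk<n x))
rk-injective {x = suc x} {suc y} e = cong suc (rk-injective e)

does⁻ : {P : Set} (d : Dec P) → does d ≡ true → P
does⁻ (yes p) _ = p

_≟ᴹ_ : (p q : Maybe (Fin n)) → Dec (p ≡ q)
_≟ᴹ_ = Maybe.≡-dec _≟_

maximum : {P : Fin n → Set} (P? : ∀ x → Dec (P x)) (f : Fin n → ℕ) →
          (∀ x → ¬ P x) ⊎ ∃ λ x → P x × ∀ y → P y → f y ≤ f x
maximum {zero} P? f = inj₁ λ ()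
maximum {suc n} P? f with P? zero | maximum (P? ∘ suc) (f ∘ suc)
... | no ¬p | inj₁ none = inj₁ λ { zero → ¬p ; (suc x) → none x }
... | yes p | inj₁ none = inj₂ (zero , p , λ { zero _ → ℕ.≤-refl ; (suc y) q → ⊥-elim (none y q) })
... | no ¬p | inj₂ (x , p , max) = inj₂ (suc x , p , λ { zero q → ⊥-elim (¬p q) ; (suc y) q → max y q })
... | yes p | inj₂ (x , p' , max) with ℕ.≤-total (f zero) (f (suc x))
...   | inj₁ le = inj₂ (suc x , p' , λ { zero _ → le ; (suc y) q → max y q })
...   | inj₂ ge = inj₂ (zero , p , λ { zero _ → ℕ.≤-refl ; (suc y) q → ℕ.≤-trans (max y q) ge })

-- The value d takes part in the minimum. It is the vertex's own label when a β is computed, and the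
-- value at a preferred vertex when a least element is sought; an empty set is thereby covered.
minimum : {P : Fin n → Set} (P? : ∀ x → Dec (P x)) (f : Fin n → ℕ) (d : ℕ) →
          ∃ λ b → b ≤ d × (∀ x → P x → b ≤ f x) × (b ≡ d ⊎ ∃ λ x → P x × b ≡ f x)
minimum {zero} P? f d = d , ℕ.≤-refl , (λ ()) , inj₁ refl
minimum {suc n} P? f d with P? zero | minimum (P? ∘ suc) (f ∘ suc) d
... | no ¬p | b , b≤d , b≤ , att =
  b , b≤d , (λ { zero q → ⊥-elim (¬p q) ; (suc x) q → b≤ x q }) , Sum.map₂ (λ { (x , q) → suc x , q }) att
... | yes p | b , b≤d , b≤ , att with ℕ.≤-total (f zero) b
...   | inj₁ le = f zero , ℕ.≤-trans le b≤d ,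
                  (λ { zero _ → ℕ.≤-refl ; (suc x) q → ℕ.≤-trans le (b≤ x q) }) , inj₂ (zero , p , refl)
...   | inj₂ ge = b , b≤d , (λ { zero _ → ge ; (suc x) q → b≤ x q }) , Sum.map₂ (λ { (x , q) → suc x , q }) att

module _ {A : Set} {parent : A → Maybe A} where
  height : ∀ {x} → Rooted parent x → ℕ
  height (top _) = 0
  height (below _ r) = suc (height r)

  height-irrelevant : ∀ {x} (r r' : Rooted parent x) → height r ≡ height r'
  height-irrelevant (top _) (top _) = refl
  height-irrelevant (top e) (below e' _) with () ← trans (sym e) e'
  height-irrelevant (below e _) (top e') with () ← trans (sym e) e'
  height-irrelevant (below e r) (below e' r') with refl ← just-injective (trans (sym e) e') =
    cong suc (height-irrelevant r r')

-- The number of steps is an index because an ancestor is determined by its distance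
-- (`Below-unique`).
data Below {A : Set} (parent : A → Maybe A) (a : A) : ℕ → A → Set where
  same : Below parent a 0 a
  down : ∀ {k v w} → parent v ≡ just w → Below parent a k w → Below parent a (suc k) v

Below-unique : {A : Set} {parent : A → Maybe A} {a b v : A} {k : ℕ} → Below parent a k v → Below parent b k v → a ≡ b
Below-unique same same = refl
Below-unique (down e d) (down e' d') with refl ← just-injective (trans (sym e) e') = Below-unique d d'

Below-extend : {A : Set} {parent : A → Maybe A} {a x v : A} {k : ℕ} → parent x ≡ just a → Below parent x k v →
               Below parent a (suc k) v
Below-extend e same = down e same
Below-extend e (down e' d) = down e' (Below-extend e d)

module _ {n : ℕ} {lab : Fin n → ℕ} (F : Forest n lab) where
  open Forest F

  depth : Fin n → ℕ
  depth x = height (rooted x)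

  depth-kid : ∀ {x w} → parent x ≡ just w → depth x ≡ suc (depth w)
  depth-kid {x} {w} e = height-irrelevant (rooted x) (below e (rooted w))

  depth-root : ∀ {x} → parent x ≡ nothing → depth x ≡ 0
  depth-root {x} e = height-irrelevant (rooted x) (top e)

  depth-Below : ∀ {a k v} → Below parent a k v → depth v ≡ k + depth a
  depth-Below same = refl
  depth-Below (down e d) = trans (depth-kid e) (cong suc (depth-Below d))

  -- The ancestors of x, itself included, take every depth from 0 to that of x, so choosing one for
  -- each depth is an injection into `Fin n`.
  depth<n : ∀ x → depth x < n
  depth<n x = injective⇒≤ {f = proj₁ ∘ at} λ {i} {j} e →
      toℕ-injective (trans (sym (proj₂ (at i))) (trans (cong depth e) (proj₂ (at j))))
    where
    ancestor : ∀ {x} → Rooted parent x → ∀ k → k ≤ depth x → ∃ λ y → depth y ≡ k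
    ancestor {x} r k k≤ with ℕ.m≤n⇒m<n∨m≡n k≤
    ancestor {x} r k k≤ | inj₂ e = x , sym e
    ancestor {x} (top e) k k≤ | inj₁ k< with () ← subst (k <_) (depth-root e) k<
    ancestor {x} (below e r) k k≤ | inj₁ k< with s≤s k≤' ← subst (k <_) (depth-kid e) k< = ancestor r k k≤'
    at : (i : Fin (suc (depth x))) → ∃ λ y → depth y ≡ toℕ i
    at i = ancestor (rooted x) (toℕ i) (ℕ.≤-pred (Data.Fin.Properties.toℕ<n i))
      where import Data.Fin.Properties

  -- Following `β-attained` leads away from the root, so `Rooted` gives no recursion. Each step
  -- raises the depth, which stays below n, and fuel plus depth never falls below n.
  β-source : ∀ a → ∃ λ k → ∃ λ v → Below parent a k v × β a ≡ lab v
  β-source a = go n a (ℕ.m≤m+n n (depth a))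
    where
    go : ∀ fuel a → n ≤ fuel + depth a → ∃ λ k → ∃ λ v → Below parent a k v × β a ≡ lab v
    go zero a n≤ = ⊥-elim (ℕ.<⇒≱ (depth<n a) n≤)
    go (suc fuel) a n≤ with β-attained a
    ... | inj₁ e = 0 , a , same , e
    ... | inj₂ (x , e , e') with go fuel x (ℕ.≤-trans n≤ (ℕ.≤-reflexive
                                  (trans (sym (ℕ.+-suc fuel (depth a))) (cong (fuel +_) (sym (depth-kid e))))))
    ...   | k , v , d , e'' = suc k , v , Below-extend e d , trans e' e''

  depth-sibling : ∀ {x y} → parent x ≡ parent y → depth x ≡ depth y
  depth-sibling {x} {y} e with parent x in ex
  ... | nothing = trans (depth-root ex) (sym (depth-root (sym e)))
  ... | just w = trans (depth-kid ex) (sym (depth-kid (sym e)))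

  -- Equal values of β come from one and the same vertex, as labels are injective. Siblings have
  -- equal depth, and that vertex has only one ancestor of this depth.
  siblings-distinct : (∀ {x y} → lab x ≡ lab y → x ≡ y) →
                      ∀ {x y} → parent x ≡ parent y → β x ≡ β y → x ≡ y
  siblings-distinct lab-inj {x} {y} e βe with β-source x | β-source y
  ... | k , v , d , p | k' , v' , d' , p' with refl ← lab-inj (trans (sym p) (trans βe p'))
    with refl ← ℕ.+-cancelʳ-≡ (depth y) k k' (trans (cong (k +_) (sym (depth-sibling e)))
                   (trans (sym (depth-Below d)) (depth-Below d'))) = Below-unique d d'

  β-below : ∀ {a k v} → Below parent a k v → β a ≤ β v
  β-below same = ℕ.≤-refl
  β-below (down e d) = ℕ.≤-trans (β-below d) (β≤kid e)

-- Equality of forests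

Reach-≈ : {A : Set} {f g : A → A} → (∀ x → f x ≡ g x) → ∀ {t x} → Reach f t x → Reach g t x
Reach-≈ e here = here
Reach-≈ e (step r) = step (subst (Reach _ _) (e _) (Reach-≈ e r))

infix 4 _≈_
-- Pointwise, in place of extensionality. That β and o then agree as well is shown in `β≈` and, for
-- injective labels, `o≈`.
record _≈_ {n : ℕ} {lab : Fin n → ℕ} (F F' : Forest n lab) : Set where
  field
    σ≈ : ∀ x → Forest.σ F x ≡ Forest.σ F' x
    up≈ : ∀ x → Forest.parent F x ≡ Forest.parent F' x
open _≈_ public

module _ {n : ℕ} {lab : Fin n → ℕ} where
  ≈-sym : {F G : Forest n lab} → F ≈ G → G ≈ F
  ≈-sym e = record { σ≈ = λ x → sym (σ≈ e x) ; up≈ = λ x → sym (up≈ e x) }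

  ≈-trans : {F G H : Forest n lab} → F ≈ G → G ≈ H → F ≈ H
  ≈-trans e e' = record { σ≈ = λ x → trans (σ≈ e x) (σ≈ e' x) ; up≈ = λ x → trans (up≈ e x) (up≈ e' x) }

  Below-≈ : {F G : Forest n lab} → F ≈ G → ∀ {a k v} → Below (Forest.parent F) a k v → Below (Forest.parent G) a k v
  Below-≈ e same = same
  Below-≈ e (down p d) = down (trans (sym (up≈ e _)) p) (Below-≈ e d)

  -- The descendant whose label realizes β in F is a descendant in G too, because `Below` depends on
  -- the fathers only.
  β≈≤ : {F G : Forest n lab} → F ≈ G → ∀ x → Forest.β G x ≤ Forest.β F x
  β≈≤ {F} {G} e x with β-source F x
  ... | k , v , d , p = subst (Forest.β G x ≤_) (sym p)
          (ℕ.≤-trans (β-below G (Below-≈ e d)) (Forest.β≤lab G v))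

  β≈ : {F G : Forest n lab} → F ≈ G → ∀ x → Forest.β F x ≡ Forest.β G x
  β≈ e x = ℕ.≤-antisym (β≈≤ (≈-sym e) x) (β≈≤ e x)

  module _ (lab-inj : ∀ {x y} → lab x ≡ lab y → x ≡ y) where
    -- Both representatives lie on the same cycle, so the one chosen by G competes in the minimum
    -- taken by F.
    o≈≤ : {F G : Forest n lab} → F ≈ G → ∀ x → Forest.β F (Forest.o F x) ≤ Forest.β F (Forest.o G x)
    o≈≤ {F} {G} e x = subst (λ y → F.β y ≤ F.β (G.o x)) (sym (Reach-invariant F.o F.o-σ
      (Reach-≈ (λ y → sym (σ≈ e y)) (G.reach x)))) (F.o-min (G.o x))
      where
      module F = Forest F
      module G = Forest G

    o≈ : {F G : Forest n lab} → F ≈ G → ∀ x → Forest.o F x ≡ Forest.o G x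
    o≈ {F} {G} e x = siblings-distinct F lab-inj
      (trans (F.up-o x) (trans (up≈ e x) (trans (sym (G.up-o x)) (sym (up≈ e (G.o x))))))
      (ℕ.≤-antisym (o≈≤ {F} {G} e x)
        (subst (_≤ F.β (F.o x)) (sym (β≈ e (G.o x)))
          (subst (G.β (G.o x) ≤_) (sym (β≈ e (F.o x))) (o≈≤ {G} {F} (≈-sym e) x))))
      where
      module F = Forest F
      module G = Forest G

-- Insertion of a new largest label

module _ {n : ℕ} (F : Forest n rk) where
  open Forest F

  addLeaf : Maybe (Fin n) → Forest (suc n) rk
  addLeaf p = grow F p (λ _ → false) rk n (λ ()) (λ _ → refl) β≤lab ℕ.≤-refl (λ ()) (inj₁ refl)
    (λ {w} _ → ℕ.≤-trans (β≤lab w) (ℕ.<⇒≤ (rk<n w)))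
    (λ w → Sum.map₂ (λ { (x , e , e') → inj₁ (x , e , refl , e') }) (β-attained w))

  -- The cycles below u with β < θ go to the new top vertex and the other ones stay with u.
  adopted? : (u : Fin n) (θ : ℕ) (x : Fin n) → Dec (parent x ≡ just u × θ ≤ β (o x))
  adopted? u θ x = (parent x ≟ᴹ just u) ×-dec (θ ≤? β (o x))

  module _ (u : Fin n) (θ : ℕ) where
    π-cap : Fin (suc n) → Fin (suc n)
    π-cap = transpose zero (suc u)

    -- The future β of the old vertex u, which loses the cycles below θ: the least among its own
    -- label and the values of the cycles it keeps.
    lowest : ∃ λ b → b ≤ rk u × (∀ x → parent x ≡ just u × θ ≤ β (o x) → b ≤ β x)
                   × (b ≡ rk u ⊎ ∃ λ x → (parent x ≡ just u × θ ≤ β (o x)) × b ≡ β x)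
    lowest = minimum (adopted? u θ) β (rk u)

    private
      b = proj₁ lowest
      b≤rk = proj₁ (proj₂ lowest)
      b≤kid = proj₁ (proj₂ (proj₂ lowest))

      K : Fin n → Bool
      K x = does (adopted? u θ x)

      β≤lab' : ∀ x → β x ≤ rk (π-cap (suc x))
      β≤lab' x with x ≟ u
      ... | yes refl = ℕ.≤-trans (β≤lab x) (ℕ.<⇒≤ (rk<n x))
      ... | no _ = β≤lab x

      u≤b : β u ≤ b
      u≤b with proj₂ (proj₂ (proj₂ lowest))
      ... | inj₁ e = subst (β u ≤_) (sym e) (β≤lab u)
      ... | inj₂ (x , (e , _) , e') = subst (β u ≤_) (sym e') (β≤kid e)

      attained : ∀ w → β w ≡ rk (π-cap (suc w)) ⊎ ((∃ λ x → parent x ≡ just w × K x ≡ false × β w ≡ β x)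
                                                   ⊎ (just u ≡ just w × β w ≡ b))
      attained w with β-attained w | w ≟ u
      -- The place of u now bears the largest label, so its β comes from the old vertex u below it.
      ... | inj₁ e | yes refl = inj₂ (inj₂ (refl , ℕ.≤-antisym u≤b (subst (b ≤_) (sym e) b≤rk)))
      ... | inj₁ e | no w≢u = inj₁ e
      ... | inj₂ (x , e , e') | d with adopted? u θ x in a
      ...   | no _ = inj₂ (inj₁ (x , e , cong does a , e'))
      -- The child that attained β has moved one level down and contributes through the old vertex
      -- u.
      ...   | yes k with refl ← just-injective (trans (sym e) (proj₁ k)) =
        inj₂ (inj₂ (refl , ℕ.≤-antisym u≤b (subst (b ≤_) (sym e') (b≤kid x k))))

    -- Here zero is the old vertex u, now placed below suc u, while suc u stands for the new top vertex in
    -- the place of u; cap gives the two their proper names.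
    sprout : Forest (suc n) (rk ∘ π-cap)
    sprout = grow F (just u) K (rk ∘ π-cap) b
      (λ {x} k → proj₁ (does⁻ (adopted? u θ x) k))
      (λ x → cong₂ (λ p v → does ((p ≟ᴹ just u) ×-dec (θ ≤? β v))) (up-σ x) (o-σ x))
      β≤lab'
      b≤rk
      (λ {x} k → b≤kid x (does⁻ (adopted? u θ x) k))
      (Sum.map₂ (λ { (x , k , e) → x , dec-true (adopted? u θ x) k , e }) (proj₂ (proj₂ (proj₂ lowest))))
      (λ e → subst (λ w → β w ≤ b) (just-injective e) u≤b)
      attained

    opaque
      cap : Forest (suc n) rk
      cap = relabel sprout π-cap (transpose-involutive zero (suc u)) rk
              (λ x → cong rk (sym (transpose-involutive zero (suc u) x)))

  -- An improper cycle is named by its representative, so that it is counted once.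
  record Improper (a : Fin n) : Set where
    constructor improper
    field
      father : Fin n
      up≡ : parent a ≡ just father
      rep : o a ≡ a
      β< : β a < rk father
  open Improper public

  -- In the order of the header: solo nothing, solo (just v), beside, above, lift, join.
  data Choice : Set where
    solo : Maybe (Fin n) → Choice
    beside : Fin n → Choice
    above : Fin n → Choice
    lift : ∀ a → Improper a → Choice
    join : ∀ a → Improper a → Choice

module _ {n : ℕ} (F : Forest n rk) where
  open Forest F

  kid≢father : ∀ {a u} → parent a ≡ just u → a ≢ u
  kid≢father e refl = rooted-irreflexive (rooted _) e

  module _ (u : Fin n) (θ : ℕ) where
    private
      π = π-cap F u θ
      module G = Forest (cap F u θ)
      module S = Forest (sprout F u θ)

      π-u : π (suc u) ≡ zero
      π-u = transpose-snd zero (suc u)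

      π-other : ∀ {x} → x ≢ u → π (suc x) ≡ suc x
      π-other x≢u = transpose-other {a = zero} (λ ()) (x≢u ∘ suc-injective)

    sprout-up-adopted : ∀ {a} → parent a ≡ just u × θ ≤ β (o a) → S.parent (suc a) ≡ just zero
    sprout-up-adopted {a} k rewrite dec-true (adopted? F u θ a) k = refl

    sprout-up-other : ∀ {a} → ¬ (parent a ≡ just u × θ ≤ β (o a)) → S.parent (suc a) ≡ Maybe.map suc (parent a)
    sprout-up-other {a} ¬k rewrite dec-false (adopted? F u θ a) ¬k = refl

    opaque
      unfolding cap

      cap-σ-u : G.σ (suc u) ≡ suc u
      cap-σ-u rewrite π-u = refl

      cap-o-u : G.o (suc u) ≡ suc u
      cap-o-u rewrite π-u = refl

      cap-up-u : G.parent (suc u) ≡ just zero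
      cap-up-u rewrite π-u = cong just π-u

      -- The new β of u is attained by its label, which is at least θ by hypothesis, or by a kept
      -- cycle, which was kept for that reason.
      cap-θ : θ ≤ rk u → θ ≤ G.β (suc u)
      cap-θ θ≤ rewrite π-u with proj₂ (proj₂ (proj₂ (lowest F u θ)))
      ... | inj₁ e = subst (θ ≤_) (sym e) θ≤
      ... | inj₂ (x , (_ , θ≤x) , e) = subst (θ ≤_) (sym e) (ℕ.≤-trans θ≤x (o-min x))

      cap-β : ∀ {a} → a ≢ u → G.β (suc a) ≡ β a
      cap-β a≢u rewrite π-other a≢u = refl

      cap-o : ∀ {a} → a ≢ u → G.o (suc a) ≡ π (suc (o a))
      cap-o a≢u rewrite π-other a≢u = refl

      cap-o-kid : ∀ {a} → parent a ≡ just u → G.o (suc a) ≡ suc (o a)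
      cap-o-kid {a} e = trans (cap-o (kid≢father e)) (π-other (kid≢father (trans (up-o a) e)))

      cap-βo-kid : ∀ {a} → parent a ≡ just u → G.β (G.o (suc a)) ≡ β (o a)
      cap-βo-kid {a} e = trans (cong G.β (cap-o-kid e)) (cap-β (kid≢father (trans (up-o a) e)))

      cap-up-low : ∀ {a} → parent a ≡ just u → β (o a) < θ → G.parent (suc a) ≡ just zero
      cap-up-low {a} e lt rewrite π-other (kid≢father e)
        | dec-false (adopted? F u θ a) (λ k → ℕ.<⇒≱ lt (proj₂ k)) | e = cong just π-u

      cap-kids : ∀ {x} → G.parent x ≡ just zero → x ≡ suc u ⊎ ∃ λ a → x ≡ suc a × parent a ≡ just u × β (o a) < θ
      cap-kids {zero} e = ⊥-elim (rooted-irreflexive (G.rooted zero) e)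
      cap-kids {suc a} e = go (a ≟ u)
        where
        go : Dec (a ≡ u) → suc a ≡ suc u ⊎ ∃ λ a' → suc a ≡ suc a' × parent a' ≡ just u × β (o a') < θ
        go (yes refl) = inj₁ refl
        go (no a≢u) with f , p , q ← map-just⁻ (S.parent (π (suc a))) e
          with p' ← subst (λ y → S.parent y ≡ just f) (π-other a≢u) p
          with adopted? F u θ a
        -- A kept child has the `zero` of `sprout` as its father, which the renaming turns into
        -- `suc u`.
        ... | yes k with refl ← trans (sym (sprout-up-adopted k)) p' with () ← q
        ... | no ¬k with f' , p'' , refl ← map-just⁻ (parent a) (trans (sym (sprout-up-other ¬k)) p') =
          inj₂ (a , refl , upa , ℕ.≰⇒> λ le → ¬k (upa , le))
          where
          upa : parent a ≡ just u
          upa = trans p'' (cong just (suc-injective (trans (sym (transpose-involutive zero (suc u) (suc f')))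
                                                          (cong π q))))

  module _ (a : Fin n) (i : Improper F a) where
    private
      u = father i
      θ : ℕ
      θ = suc (β a)
      G = cap F u θ
      module G = Forest G

      lowa : β (o a) < θ
      lowa = s≤s (ℕ.≤-reflexive (cong β (rep i)))

      s≢y : suc u ≢ G.σ (suc a)
      s≢y e = kid≢father (up≡ i) (sym (suc-injective (G.σ-injective {suc u} {suc a} (trans (cap-σ-u u θ) e))))

      up-y : G.parent (suc u) ≡ G.parent (G.σ (suc a))
      up-y = trans (cap-up-u u θ) (sym (trans (G.up-σ (suc a)) (cap-up-low u θ (up≡ i) lowa)))

      β-y : G.β (G.o (G.σ (suc a))) ≤ G.β (suc u)
      β-y = ℕ.≤-trans (ℕ.≤-reflexive (trans (cong G.β (G.o-σ (suc a))) (cap-βo-kid u θ (up≡ i))))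
              (ℕ.≤-trans (ℕ.<⇒≤ lowa) (cap-θ u θ (β< i)))

    -- As `merge` inserts before its target, the target is the successor of the representative. Thus
    -- u can be read off as the image of the representative (`join-σ`).
    join-forest : Forest (suc n) rk
    join-forest = merge G (suc u) (G.σ (suc a)) (cap-σ-u u θ) s≢y up-y β-y

    join-o-u : Forest.o join-forest (suc u) ≡ suc a
    join-o-u = trans (merge-o-s G (suc u) (G.σ (suc a)) (cap-σ-u u θ) s≢y up-y β-y)
                 (trans (G.o-σ (suc a)) (trans (cap-o-kid u θ (up≡ i)) (cong suc (rep i))))

    join-o-other : ∀ {x} → x ≢ suc u → Forest.o join-forest x ≡ G.o x
    join-o-other = merge-o-other G (suc u) (G.σ (suc a)) (cap-σ-u u θ) s≢y up-y β-y

    join-σ : Forest.σ join-forest (suc a) ≡ suc u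
    join-σ = transpose-snd (suc u) (G.σ (suc a))

  beside-forest : Fin n → Forest (suc n) rk
  beside-forest v = merge (addLeaf F (parent v)) zero (suc v) refl (λ ()) refl
                      (ℕ.≤-trans (β≤lab (o v)) (ℕ.<⇒≤ (rk<n (o v))))

  ins : Choice F → Forest (suc n) rk
  ins (solo p) = addLeaf F p
  ins (beside v) = beside-forest v
  ins (above u) = cap F u 0
  ins (lift a i) = cap F (father i) (suc (β a))
  ins (join a i) = join-forest a i

-- The insertion is injective

conjugate-cancel : {lab : Fin n → ℕ} (F F' : Forest n lab) (π : Fin n → Fin n) → (∀ x → π (π x) ≡ x) →
                   (∀ x → π (Forest.σ F (π x)) ≡ π (Forest.σ F' (π x))) →
                   (∀ x → Maybe.map π (Forest.parent F (π x)) ≡ Maybe.map π (Forest.parent F' (π x))) → F ≈ F'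
conjugate-cancel F F' π π² σ≈' up≈' = record
  { σ≈ = λ x → trans (cong F.σ (sym (π² x))) (trans (π-injective (σ≈' (π x))) (cong F'.σ (π² x)))
  ; up≈ = λ x → trans (cong F.parent (sym (π² x)))
                  (trans (map-injective π-injective (up≈' (π x))) (cong F'.parent (π² x)))
  }
  where
  module F = Forest F
  module F' = Forest F'
  π-injective : ∀ {x y} → π x ≡ π y → x ≡ y
  π-injective {x} {y} e = trans (sym (π² x)) (trans (cong π e) (π² y))

map-suc≢0 : (p : Maybe (Fin n)) → Maybe.map Fin.suc p ≢ just Fin.zero
map-suc≢0 (just _) ()

addLeaf-cancel : {F F' : Forest n rk} {p p' : Maybe (Fin n)} → addLeaf F p ≈ addLeaf F' p' → F ≈ F' × p ≡ p'
addLeaf-cancel e = record { σ≈ = λ x → suc-injective (σ≈ e (suc x))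
                          ; up≈ = λ x → map-injective suc-injective (up≈ e (suc x)) }
                 , map-injective suc-injective (up≈ e zero)

-- Being adopted is visible in the result as having father `zero`, and all adopted vertices had
-- father u, so the old fathers are recovered. Of θ only the set that it cuts out is recovered here;
-- `lift-≤` does the rest.
sprout-cancel : {F F' : Forest n rk} {u : Fin n} {θ θ' : ℕ} → sprout F u θ ≈ sprout F' u θ' →
                F ≈ F' × (∀ x → does (adopted? F u θ x) ≡ does (adopted? F' u θ' x))
sprout-cancel {F = F} {F'} {u} {θ} {θ'} e =
  record { σ≈ = λ x → suc-injective (σ≈ e (suc x)) ; up≈ = λ x → proj₁ (go x) } , λ x → proj₂ (go x)
  where
  module F = Forest F
  module F' = Forest F'
  go : ∀ x → F.parent x ≡ F'.parent x × does (adopted? F u θ x) ≡ does (adopted? F' u θ' x)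
  go x = split (adopted? F u θ x) (adopted? F' u θ' x)
    where
    split : Dec (F.parent x ≡ just u × θ ≤ F.β (F.o x)) → Dec (F'.parent x ≡ just u × θ' ≤ F'.β (F'.o x)) →
            F.parent x ≡ F'.parent x × does (adopted? F u θ x) ≡ does (adopted? F' u θ' x)
    split (yes p) (yes p') = trans (proj₁ p) (sym (proj₁ p')) ,
      trans (dec-true (adopted? F u θ x) p) (sym (dec-true (adopted? F' u θ' x) p'))
    split (yes p) (no ¬p') = ⊥-elim (map-suc≢0 (F'.parent x) (trans (sym (sprout-up-other F' u θ' ¬p'))
                               (trans (sym (up≈ e (suc x))) (sprout-up-adopted F u θ p))))
    split (no ¬p) (yes p') = ⊥-elim (map-suc≢0 (F.parent x) (trans (sym (sprout-up-other F u θ ¬p))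
                               (trans (up≈ e (suc x)) (sprout-up-adopted F' u θ' p'))))
    split (no ¬p) (no ¬p') = map-injective suc-injective (trans (sym (sprout-up-other F u θ ¬p))
                               (trans (up≈ e (suc x)) (sprout-up-other F' u θ' ¬p'))) ,
      trans (dec-false (adopted? F u θ x) ¬p) (sym (dec-false (adopted? F' u θ' x) ¬p'))

Leaf : Forest (suc n) rk → Set
Leaf G = ∀ x → Forest.parent G x ≢ just zero

-- The vertex M of the header; zero is ∗.
record MaxKid (G : Forest (suc n) rk) (M : Fin (suc n)) : Set where
  open Forest G
  field
    kid : parent M ≡ just zero
    rep : o M ≡ M
    max : ∀ x → parent x ≡ just zero → β (o x) ≤ β M

-- `above` and `lift` share a tag: in both, u is the greatest child and a fixed point. The adopted
-- sets tell them apart, since `lift` leaves its cycle C unadopted.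
data Tag : Set where single paired capped joined : Tag

Shape : Tag → Forest (suc n) rk → Set
Shape single G = Leaf G × Forest.σ G zero ≡ zero
Shape paired G = Leaf G × Forest.σ G zero ≢ zero
Shape capped G = ∃ λ M → MaxKid G M × Forest.σ G M ≡ M
Shape joined G = ∃ λ M → MaxKid G M × Forest.σ G M ≢ M

module _ {G G' : Forest (suc n) rk} (e : G ≈ G') where
  private
    module G = Forest G
    module G' = Forest G'

  MaxKid-≈ : ∀ {M} → MaxKid G M → MaxKid G' M
  MaxKid-≈ m = record
    { kid = trans (sym (up≈ e _)) (MaxKid.kid m)
    ; rep = trans (sym (o≈ rk-injective e _)) (MaxKid.rep m)
    ; max = λ x p → ≤-cong (trans (β≈ e (G.o x)) (cong G'.β (o≈ rk-injective e x))) (β≈ e _)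
                      (MaxKid.max m x (trans (up≈ e x) p))
    }
    where
    ≤-cong : ∀ {i i' j j'} → i ≡ i' → j ≡ j' → i ≤ j → i' ≤ j'
    ≤-cong refl refl le = le

MaxKid-unique : {G : Forest (suc n) rk} {M M' : Fin (suc n)} → MaxKid G M → MaxKid G M' → M ≡ M'
MaxKid-unique {G = G} m m' = siblings-distinct G rk-injective (trans (kid m) (sym (kid m')))
  (ℕ.≤-antisym (le m m') (le m' m))
  where
  open MaxKid
  open Forest G
  le : ∀ {M M'} → MaxKid G M → MaxKid G M' → β M ≤ β M'
  le {M} {M'} m m' = subst (λ y → β y ≤ β M') (rep m) (max m' M (kid m))

MaxKid-unique-≈ : {G G' : Forest (suc n) rk} {M M' : Fin (suc n)} → G ≈ G' → MaxKid G M → MaxKid G' M' → M ≡ M'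
MaxKid-unique-≈ e m m' = MaxKid-unique (MaxKid-≈ e m) m'

Shape-unique : ∀ t t' {G G' : Forest (suc n) rk} → G ≈ G' → Shape t G → Shape t' G' → t ≡ t'
Shape-unique single single e s s' = refl
Shape-unique single paired e (_ , s) (_ , s') = ⊥-elim (s' (trans (sym (σ≈ e zero)) s))
Shape-unique single capped e (l , _) (M , m , _) = ⊥-elim (l M (trans (up≈ e M) (MaxKid.kid m)))
Shape-unique single joined e (l , _) (M , m , _) = ⊥-elim (l M (trans (up≈ e M) (MaxKid.kid m)))
Shape-unique paired single e (_ , s) (_ , s') = ⊥-elim (s (trans (σ≈ e zero) s'))
Shape-unique paired paired e s s' = refl
Shape-unique paired capped e (l , _) (M , m , _) = ⊥-elim (l M (trans (up≈ e M) (MaxKid.kid m)))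
Shape-unique paired joined e (l , _) (M , m , _) = ⊥-elim (l M (trans (up≈ e M) (MaxKid.kid m)))
Shape-unique capped single e (M , m , _) (l , _) = ⊥-elim (l M (trans (sym (up≈ e M)) (MaxKid.kid m)))
Shape-unique capped paired e (M , m , _) (l , _) = ⊥-elim (l M (trans (sym (up≈ e M)) (MaxKid.kid m)))
Shape-unique capped capped e s s' = refl
Shape-unique capped joined e (M , m , s) (M' , m' , s') with refl ← MaxKid-unique-≈ e m m' =
  ⊥-elim (s' (trans (sym (σ≈ e M)) s))
Shape-unique joined single e (M , m , _) (l , _) = ⊥-elim (l M (trans (sym (up≈ e M)) (MaxKid.kid m)))
Shape-unique joined paired e (M , m , _) (l , _) = ⊥-elim (l M (trans (sym (up≈ e M)) (MaxKid.kid m)))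
Shape-unique joined capped e (M , m , s) (M' , m' , s') with refl ← MaxKid-unique-≈ e m m' =
  ⊥-elim (s (trans (σ≈ e M) s'))
Shape-unique joined joined e s s' = refl

tag : {F : Forest n rk} → Choice F → Tag
tag (solo _) = single
tag (beside _) = paired
tag (above _) = capped
tag (lift _ _) = capped
tag (join _ _) = joined

cap-MaxKid : (F : Forest n rk) (u : Fin n) (θ : ℕ) → θ ≤ rk u → MaxKid (cap F u θ) (suc u)
cap-MaxKid F u θ θ≤ = record { kid = cap-up-u F u θ ; rep = cap-o-u F u θ ; max = max }
  where
  module G = Forest (cap F u θ)
  max : ∀ x → G.parent x ≡ just zero → G.β (G.o x) ≤ G.β (suc u)
  max x e with cap-kids F u θ {x} e
  ... | inj₁ refl = ℕ.≤-reflexive (cong G.β (cap-o-u F u θ))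
  ... | inj₂ (a , refl , p , lt) = ℕ.≤-trans (ℕ.≤-reflexive (cap-βo-kid F u θ p))
                                      (ℕ.≤-trans (ℕ.<⇒≤ lt) (cap-θ F u θ θ≤))

-- On the joined cycle u is represented by a, and the other children of the new vertex lie below the
-- threshold `suc (β a)`, so none of them exceeds a.
join-MaxKid : (F : Forest n rk) (a : Fin n) (i : Improper F a) → MaxKid (join-forest F a i) (suc a)
join-MaxKid F a i = record
  { kid = cap-up-low F u θ (up≡ i) lowa
  ; rep = trans (join-o-other F a i (kid≢father F (up≡ i) ∘ suc-injective)) (trans (cap-o-kid F u θ (up≡ i)) (cong suc (rep i)))
  ; max = max
  }
  where
  module F = Forest F
  u = father i
  θ = suc (F.β a)
  module G = Forest (cap F u θ)
  module J = Forest (join-forest F a i)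
  lowa : F.β (F.o a) < θ
  lowa = s≤s (ℕ.≤-reflexive (cong F.β (rep i)))
  βa : G.β (suc a) ≡ F.β a
  βa = cap-β F u θ (kid≢father F (up≡ i))
  max : ∀ x → J.parent x ≡ just zero → G.β (J.o x) ≤ G.β (suc a)
  max x e = go (x ≟ suc u)
    where
    go : Dec (x ≡ suc u) → G.β (J.o x) ≤ G.β (suc a)
    go (yes refl) = ℕ.≤-reflexive (cong G.β (join-o-u F a i))
    go (no ne) with cap-kids F u θ {x} e
    ... | inj₁ x≡ = ⊥-elim (ne x≡)
    ... | inj₂ (a' , refl , p , s≤s le) = ℕ.≤-trans (ℕ.≤-reflexive (trans (cong G.β (join-o-other F a i ne)) (cap-βo-kid F u θ p)))
                                            (ℕ.≤-trans le (ℕ.≤-reflexive (sym βa)))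

ins-Shape : (F : Forest n rk) (c : Choice F) → Shape (tag c) (ins F c)
ins-Shape F (solo p) = (λ { zero e → map-suc≢0 p e ; (suc x) e → map-suc≢0 (Forest.parent F x) e }) , refl
ins-Shape F (beside v) = (λ { zero e → map-suc≢0 (Forest.parent F v) e ; (suc x) e → map-suc≢0 (Forest.parent F x) e }) , λ ()
ins-Shape F (above u) = suc u , cap-MaxKid F u 0 z≤n , cap-σ-u F u 0
ins-Shape F (lift a i) = suc (father i) , cap-MaxKid F _ _ (β< i) , cap-σ-u F _ _
ins-Shape F (join a i) = suc a , join-MaxKid F a i ,
  λ e → kid≢father F (up≡ i) (suc-injective (trans (sym e) (join-σ F a i)))

-- The two choices live over forests that are only related by `≈`, so their proofs of impropriety
-- have different types; only the vertices are compared.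
data _∼_ {F F' : Forest n rk} : Choice F → Choice F' → Set where
  solo : ∀ {p} → solo p ∼ solo p
  beside : ∀ {v} → beside v ∼ beside v
  above : ∀ {u} → above u ∼ above u
  lift : ∀ {a i i'} → lift a i ∼ lift a i'
  join : ∀ {a i i'} → join a i ∼ join a i'

module _ {F F' : Forest n rk} where
  private
    module F = Forest F
    module F' = Forest F'

  opaque
    unfolding cap

    cap-sprout-cancel : ∀ {u θ θ'} → cap F u θ ≈ cap F' u θ' → sprout F u θ ≈ sprout F' u θ'
    cap-sprout-cancel {u} {θ} {θ'} e = conjugate-cancel (sprout F u θ) (sprout F' u θ') (π-cap F u θ)
      (transpose-involutive zero (suc u)) (σ≈ e) (up≈ e)

  cap-cancel : ∀ {u u' θ θ'} → θ ≤ rk u → θ' ≤ rk u' → cap F u θ ≈ cap F' u' θ' →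
               u ≡ u' × F ≈ F' × (∀ x → does (adopted? F u θ x) ≡ does (adopted? F' u' θ' x))
  cap-cancel {u} {u'} {θ} {θ'} θ≤ θ'≤ e
    with refl ← suc-injective (MaxKid-unique-≈ e (cap-MaxKid F u θ θ≤) (cap-MaxKid F' u' θ' θ'≤)) =
    refl , sprout-cancel {F = F} {F'} (cap-sprout-cancel e)

  low-kid : ∀ {u θ θ' a} → F ≈ F' → (∀ x → does (adopted? F u θ x) ≡ does (adopted? F' u θ' x)) →
            F.parent a ≡ just u → F'.β (F'.o a) < θ' → F.β (F.o a) < θ
  low-kid {u} {θ} {θ'} {a} e k p lt = ℕ.≰⇒> λ le → ℕ.<⇒≱ lt
    (proj₂ (does⁻ (adopted? F' u θ' a) (trans (sym (k a)) (dec-true (adopted? F u θ a) (p , le)))))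

  -- A cycle is not adopted at its own threshold, hence, the adopted sets being equal, not at that
  -- of a'. Used in both directions this makes the two values of β equal, and siblings with equal β
  -- coincide.
  lift-≤ : ∀ {u a a'} → F ≈ F' →
           (∀ x → does (adopted? F u (suc (F.β a)) x) ≡ does (adopted? F' u (suc (F'.β a')) x)) →
           F.parent a ≡ just u → F.o a ≡ a → F.β a ≤ F'.β a'
  lift-≤ {u} {a} {a'} e k p r = subst (_≤ F'.β a') (sym (β≈ e a)) (subst (λ y → F'.β y ≤ F'.β a')
    (trans (sym (o≈ rk-injective e a)) r)
    (ℕ.≤-pred (low-kid' (trans (sym (up≈ e a)) p) (s≤s (ℕ.≤-reflexive (cong F.β r))))))
    where
    low-kid' : F'.parent a ≡ just u → F.β (F.o a) < suc (F.β a) → F'.β (F'.o a) < suc (F'.β a')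
    low-kid' p lt = ℕ.≰⇒> λ le → ℕ.<⇒≱ lt
      (proj₂ (does⁻ (adopted? F u (suc (F.β a)) a) (trans (k a) (dec-true (adopted? F' u (suc (F'.β a')) a) (p , le)))))

-- The place of insertion is the image of s. Once it is known, merging is composition with a known
-- transposition.
merge-cancel : {lab : Fin n → ℕ} {F F' : Forest n lab} {s y y' : Fin n}
               {fix : Forest.σ F s ≡ s} {fix' : Forest.σ F' s ≡ s} {ne : s ≢ y} {ne' : s ≢ y'}
               {e : Forest.parent F s ≡ Forest.parent F y} {e' : Forest.parent F' s ≡ Forest.parent F' y'}
               {le : Forest.β F (Forest.o F y) ≤ Forest.β F s} {le' : Forest.β F' (Forest.o F' y') ≤ Forest.β F' s} →
               merge F s y fix ne e le ≈ merge F' s y' fix' ne' e' le' → F ≈ F'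
merge-cancel {F = F} {F'} {s} {y} {y'} {fix} {fix'} eq
  with refl ← trans (sym (trans (cong (transpose s y) fix) (transpose-fst s y)))
                (trans (σ≈ eq s) (trans (cong (transpose s y') fix') (transpose-fst s y'))) =
  record { σ≈ = λ x → transpose-injective s y (σ≈ eq x) ; up≈ = up≈ eq }

ins-injective : (F F' : Forest n rk) (c : Choice F) (c' : Choice F') → ins F c ≈ ins F' c' → F ≈ F' × c ∼ c'
ins-injective {n = n} F F' c c' e = go c c' (Shape-unique (tag c) (tag c') e (ins-Shape F c) (ins-Shape F' c')) e
  where
  module F = Forest F
  module F' = Forest F'
  low : ∀ {a} (i : Improper F a) → F.β (F.o a) < suc (F.β a)
  low i = s≤s (ℕ.≤-reflexive (cong F.β (rep i)))
  low' : ∀ {a} (i : Improper F' a) → F'.β (F'.o a) < suc (F'.β a)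
  low' i = s≤s (ℕ.≤-reflexive (cong F'.β (rep i)))
  go : (c : Choice F) (c' : Choice F') → tag c ≡ tag c' → ins F c ≈ ins F' c' → F ≈ F' × c ∼ c'
  go (solo p) (solo p') _ e with E , refl ← addLeaf-cancel {F = F} {F'} e = E , solo
  go (beside v) (beside v') _ e with refl ← suc-injective (σ≈ e zero)
    with E , _ ← addLeaf-cancel {F = F} {F'} {F.parent v} {F'.parent v}
                   (record { σ≈ = λ x → transpose-injective zero (suc v) (σ≈ e x) ; up≈ = up≈ e }) = E , beside
  go (above u) (above u') _ e with refl , E , _ ← cap-cancel {F = F} {F'} z≤n z≤n e = E , above
  go (above u) (lift a i) _ e with refl , E , k ← cap-cancel {F = F} {F'} z≤n (β< i) e
    with () ← low-kid {F = F} {F'} {θ = 0} {suc (F'.β a)} E k (trans (up≈ E a) (up≡ i)) (low' i)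
  go (lift a i) (above u) _ e with refl , E , k ← cap-cancel {F = F} {F'} (β< i) z≤n e
    with () ← low-kid {F = F'} {F} {θ = 0} {suc (F.β a)} (≈-sym E) (sym ∘ k) (trans (sym (up≈ E a)) (up≡ i)) (low i)
  go (lift a (improper u p r lt)) (lift a' (improper u' p' r' lt')) _ e
    with refl , E , k ← cap-cancel {F = F} {F'} lt lt' e
    with refl ← siblings-distinct F rk-injective {a} {a'} (trans p (trans (sym p') (sym (up≈ E a'))))
           (ℕ.≤-antisym
             (subst (F.β a ≤_) (sym (β≈ E a')) (lift-≤ {F = F} {F'} E k p r))
             (subst (_≤ F.β a) (sym (β≈ E a')) (lift-≤ {F = F'} {F} (≈-sym E) (sym ∘ k) p' r'))) = E , lift
  go (join a i) (join a' i') _ e =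
    same-join i i' (suc-injective (MaxKid-unique-≈ e (join-MaxKid F a i) (join-MaxKid F' a' i'))) e
    where
    same-join : ∀ {a a'} (i : Improper F a) (i' : Improper F' a') → a ≡ a' →
                join-forest F a i ≈ join-forest F' a' i' → F ≈ F' × join a i ∼ join a' i'
    same-join {a} i@(improper u p r lt) i'@(improper u' p' r' lt') refl e
      with refl ← suc-injective (trans (sym (join-σ F a i)) (trans (σ≈ e (suc a)) (join-σ F' a i')))
      with _ , E , _ ← cap-cancel {F = F} {F'} lt lt' (merge-cancel
             {F = cap F u (suc (F.β a))} {cap F' u (suc (F'.β a))} e) = E , join

-- Compatibility of the insertion with `≈`

module _ {n : ℕ} {F F' : Forest n rk} (e : F ≈ F') where
  private
    module F = Forest F
    module F' = Forest F'

    βo≈ : ∀ x → F.β (F.o x) ≡ F'.β (F'.o x)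
    βo≈ x = trans (β≈ e (F.o x)) (cong F'.β (o≈ rk-injective e x))

  addLeaf-cong : ∀ {p p'} → p ≡ p' → addLeaf F p ≈ addLeaf F' p'
  addLeaf-cong p≡ = record
    { σ≈ = λ { zero → refl ; (suc x) → cong suc (σ≈ e x) }
    ; up≈ = λ { zero → cong (Maybe.map suc) p≡ ; (suc x) → cong (Maybe.map suc) (up≈ e x) } }

  sprout-cong : ∀ u θ → sprout F u θ ≈ sprout F' u θ
  sprout-cong u θ = record
    { σ≈ = λ { zero → refl ; (suc x) → cong suc (σ≈ e x) }
    ; up≈ = λ { zero → refl
              ; (suc x) → cong₂ (λ p b → if does ((p ≟ᴹ just u) ×-dec (θ ≤? b)) then just zero else Maybe.map suc p)
                            (up≈ e x) (βo≈ x) } }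

  opaque
    unfolding cap

    cap-cong : ∀ u {θ θ'} → θ ≡ θ' → cap F u θ ≈ cap F' u θ'
    cap-cong u {θ} refl = record
      { σ≈ = λ x → cong (transpose zero (suc u)) (σ≈ (sprout-cong u θ) (transpose zero (suc u) x))
      ; up≈ = λ x → cong (Maybe.map (transpose zero (suc u))) (up≈ (sprout-cong u θ) (transpose zero (suc u) x)) }

  Improper-cong : ∀ {a} → Improper F a → Improper F' a
  Improper-cong {a} (improper u p r lt) =
    improper u (trans (sym (up≈ e a)) p) (trans (sym (o≈ rk-injective e a)) r) (subst (_< rk u) (β≈ e a) lt)

  Choice-cong : Choice F → Choice F'
  Choice-cong (solo p) = solo p
  Choice-cong (beside v) = beside v
  Choice-cong (above u) = above u
  Choice-cong (lift a i) = lift a (Improper-cong i)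
  Choice-cong (join a i) = join a (Improper-cong i)

  -- A history reproduces a forest only up to `≈`, so in `build-surjective` the last choice has to
  -- be carried to the forest actually built.
  ins-cong : ∀ c → ins F c ≈ ins F' (Choice-cong c)
  ins-cong (solo p) = addLeaf-cong refl
  ins-cong (beside v) = record { σ≈ = λ x → cong (transpose zero (suc v)) (σ≈ leaf x) ; up≈ = up≈ leaf }
    where leaf = addLeaf-cong (up≈ e v)
  ins-cong (above u) = cap-cong u refl
  ins-cong (lift a i) = cap-cong (father i) (cong suc (β≈ e a))
  ins-cong (join a i) = record { σ≈ = λ x → cong₂ (transpose (suc (father i))) (σ≈ capped≈ (suc a)) (σ≈ capped≈ x)
                               ; up≈ = up≈ capped≈ }
    where capped≈ = cap-cong (father i) (cong suc (β≈ e a))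

-- The insertion is surjective

map-suc-predFin : (p : Maybe (Fin (suc n))) → p ≢ just zero → Maybe.map Fin.suc (p >>= predFin) ≡ p
map-suc-predFin nothing ne = refl
map-suc-predFin (just zero) ne = ⊥-elim (ne refl)
map-suc-predFin (just (suc x)) ne = refl

map-suc-contract : {lab : Fin (suc n) → ℕ} (G : Forest (suc n) lab) (p : Maybe (Fin (suc n))) → p ≢ just zero →
                   Maybe.map Fin.suc (contract G p) ≡ p
map-suc-contract G nothing ne = refl
map-suc-contract G (just zero) ne = ⊥-elim (ne refl)
map-suc-contract G (just (suc x)) ne = refl

module _ {n : ℕ} (G : Forest (suc n) rk) where
  open Forest G

  leaf-β : Leaf G → β zero ≡ n
  leaf-β leaf with β-attained zero
  ... | inj₁ e = e
  ... | inj₂ (x , e , _) = ⊥-elim (leaf x e)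

  β-suc<n : ∀ x → β (suc x) < n
  β-suc<n x = ℕ.≤-<-trans (β≤lab (suc x)) (rk<n x)

  removeLeaf : Leaf G → σ zero ≡ zero → ∃ λ (F : Forest n rk) → ∃ λ p → addLeaf F p ≈ G
  removeLeaf leaf fix = F , grandfather G , record
    { σ≈ = λ { zero → sym fix ; (suc x) → sym (shrink-σ G rk fix β≤ attained x) }
    ; up≈ = λ { zero → map-suc-predFin (parent zero) (leaf zero) ; (suc x) → map-suc-contract G (parent (suc x)) (leaf (suc x)) }
    }
    where
    β≤ : ∀ x → β (suc x) ≤ rk x
    β≤ x = β≤lab (suc x)
    attained : ∀ w → β (suc w) ≡ rk w ⊎ ∃ λ x → contract G (parent (suc x)) ≡ just w × β (suc w) ≡ β (suc x)
    attained w with β-attained (suc w)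
    ... | inj₁ e = inj₁ e
    -- The β of the leaf is its own label n, too large to be the β of an old vertex.
    ... | inj₂ (zero , _ , e) = ⊥-elim (ℕ.<-irrefl (trans e (leaf-β leaf)) (β-suc<n w))
    ... | inj₂ (suc x , e , e') = inj₂ (x , cong (contract G) e , e')
    F : Forest n rk
    F = shrink G rk fix β≤ attained

module _ {n : ℕ} (G : Forest (suc n) rk) (u : Fin n) (m : MaxKid G (suc u)) (fix : Forest.σ G (suc u) ≡ suc u) where
  open Forest G
  private
    π : Fin (suc n) → Fin (suc n)
    π = transpose zero (suc u)

    π² : ∀ x → π (π x) ≡ x
    π² = transpose-involutive zero (suc u)

    π-u : π (suc u) ≡ zero
    π-u = transpose-snd zero (suc u)

    π-other : ∀ {x} → x ≢ u → π (suc x) ≡ suc x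
    π-other x≢u = transpose-other {a = zero} (λ ()) (x≢u ∘ suc-injective)

    π≢0 : ∀ {x} → x ≢ suc u → π x ≢ zero
    π≢0 x≢ e = x≢ (trans (sym (π² _)) (cong π e))

    -- Names are exchanged as in `cap`: `zero` is now the vertex u and `suc u` is ∗. Deleting `zero`
    -- hands the children of u to ∗, and the vertex that remains is called u.
    G₀ : Forest (suc n) (rk ∘ π)
    G₀ = relabel G π π² (rk ∘ π) (λ _ → refl)
    module G₀ = Forest G₀

    fix₀ : G₀.σ zero ≡ zero
    fix₀ = trans (cong π fix) π-u

    up₀-zero : G₀.parent zero ≡ just (suc u)
    up₀-zero = cong (Maybe.map π) (MaxKid.kid m)

    grandfather₀ : grandfather G₀ ≡ just u
    grandfather₀ = cong (_>>= predFin) up₀-zero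

    βzero< : β zero < n
    βzero< = ℕ.≤-<-trans (β≤kid (MaxKid.kid m)) (β-suc<n G u)

    β≤ : ∀ x → β (π (suc x)) ≤ rk x
    β≤ x = go (x ≟ u)
      where
      go : Dec (x ≡ u) → β (π (suc x)) ≤ rk x
      go (yes refl) = subst (λ y → β y ≤ rk u) (sym π-u) (ℕ.≤-trans (β≤kid (MaxKid.kid m)) (β≤lab (suc u)))
      go (no x≢u) = subst (λ y → β y ≤ rk x) (sym (π-other x≢u)) (β≤lab (suc x))

    Attained : Fin n → Set
    Attained w = β (π (suc w)) ≡ rk w ⊎ ∃ λ x → contract G₀ (G₀.parent (suc x)) ≡ just w × β (π (suc w)) ≡ β (π (suc x))

    attained-by : ∀ {w y} → y ≢ suc u → contract G₀ (Maybe.map π (parent y)) ≡ just w → β (π (suc w)) ≡ β y → Attained w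
    attained-by {w} {y} ne e e' = inj₂ (x , trans (cong (λ z → contract G₀ (Maybe.map π (parent z))) πx) e
                                          , trans e' (cong β (sym πx)))
      where
      x = predFrom u (π y)
      πx : π (suc x) ≡ y
      πx = trans (cong π (sym (suc-predFrom u (π y) (π≢0 ne)))) (π² y)

    attained : ∀ w → Attained w
    attained w with β-attained (π (suc w))
    ... | inj₁ e = inj₁ (trans e (go (w ≟ u)))
      where
      go : Dec (w ≡ u) → rk (π (suc w)) ≡ rk w
      -- Here w names ∗, which has a child with a smaller label, so its own label cannot be its β.
      go (yes refl) = ⊥-elim (ℕ.<-irrefl (trans (cong β (sym π-u)) (trans e (cong rk π-u))) βzero<)
      go (no w≢u) = cong rk (π-other w≢u)
    ... | inj₂ (y , e , e') = go (y ≟ suc u)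
      where
      go : Dec (y ≡ suc u) → Attained w
      go (no ne) = attained-by ne (cong (contract G₀) (trans (cong (Maybe.map π) e) (cong just (π² (suc w))))) e'
      -- The value was attained at the vertex being deleted, so w is the father of that vertex and
      -- inherits what attains the value there: its label or one of its children.
      go (yes refl) with refl ← suc-injective (trans (sym (π² (suc w)))
                                  (cong π (just-injective (trans (sym e) (MaxKid.kid m))))) with β-attained (suc u)
      ... | inj₁ e'' = inj₁ (trans e' e'')
      ... | inj₂ (z , f , f') = attained-by (λ { refl → rooted-irreflexive (rooted (suc u)) f })
              (trans (cong (contract G₀) (trans (cong (Maybe.map π) f) (cong just π-u))) grandfather₀) (trans e' f')

  uncap : Forest n rk
  uncap = shrink G₀ rk fix₀ β≤ attained

  private module F = Forest uncap

  module _ {x : Fin n} (x≢u : x ≢ u) where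
    uncap-β : F.β x ≡ β (suc x)
    uncap-β = cong β (π-other x≢u)

    module _ (kid : parent (suc x) ≡ just zero) where
      uncap-up : F.parent x ≡ just u
      uncap-up = trans (cong (λ y → contract G₀ (Maybe.map π (parent y))) (π-other x≢u))
                   (cong (contract G₀ ∘ Maybe.map π) kid)

      private
        o≢0 : o (suc x) ≢ zero
        o≢0 e = rooted-irreflexive (rooted zero) (trans (cong parent (sym e)) (trans (up-o (suc x)) kid))

        o≢u : o (suc x) ≢ suc u
        o≢u e = x≢u (suc-injective (fixed-unreachable σ-injective fix
                  (subst (λ t → Reach σ t (suc x)) e (reach (suc x)))))

      uncap-o : o (suc x) ≡ suc (F.o x)
      uncap-o = trans (sym (transpose-other o≢0 o≢u))
                  (trans (cong (π ∘ o) (sym (π-other x≢u))) (shrink-o G₀ rk fix₀ β≤ attained x))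

      uncap-βo : F.β (F.o x) ≡ β (o (suc x))
      uncap-βo = cong β (trans (π-other (λ e → o≢u (trans uncap-o (cong suc e)))) (sym uncap-o))

  module _ (θ : ℕ) (θ≤ : θ ≤ β (suc u))
           (low : ∀ {x} → x ≢ u → parent (suc x) ≡ just zero → F.β (F.o x) < θ) where
    private
      module S = Forest (sprout uncap u θ)

      up₀-u : ∀ x → G₀.parent (suc x) ≡ just (suc u) → x ≢ u × parent (suc x) ≡ just zero
      up₀-u x e with z , p , q ← map-just⁻ (parent (π (suc x))) e
        with refl ← trans (sym (π² z)) (trans (cong π q) π-u) = go (x ≟ u)
        where
        go : Dec (x ≡ u) → x ≢ u × parent (suc x) ≡ just zero
        go (yes refl) = ⊥-elim (rooted-irreflexive (rooted zero) (trans (cong parent (sym π-u)) p))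
        go (no x≢u) = x≢u , trans (cong parent (sym (π-other x≢u))) p

      up-suc : ∀ x p → G₀.parent (suc x) ≡ p → S.parent (suc x) ≡ p
      up-suc x nothing e = trans (sprout-up-other uncap u θ (λ k → ⊥-elim (nothing≢just (trans (sym e') (proj₁ k)))))
                             (cong (Maybe.map suc) e')
        where
        e' : F.parent x ≡ nothing
        e' = cong (contract G₀) e
        nothing≢just : ∀ {x : Fin n} → nothing ≢ just x
        nothing≢just ()
      up-suc x (just zero) e = sprout-up-adopted uncap u θ
        (trans (cong (contract G₀) e) grandfather₀ ,
         ℕ.≤-trans θ≤ (subst (λ y → β (suc u) ≤ G₀.β y) (shrink-o G₀ rk fix₀ β≤ attained x)
           (G₀.β≤kid {G₀.o (suc x)} {zero} (trans (G₀.up-o (suc x)) e))))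
      up-suc x (just (suc f)) e = trans (sprout-up-other uncap u θ not-adopted) (cong (Maybe.map suc) e')
        where
        e' : F.parent x ≡ just f
        e' = cong (contract G₀) e
        not-adopted : ¬ (F.parent x ≡ just u × θ ≤ F.β (F.o x))
        not-adopted (p , le) with refl ← just-injective (trans (sym e') p) with x≢u , k ← up₀-u x e =
          ℕ.<⇒≱ (low x≢u k) le

    -- The deletion threw the children of u and those of ∗ together. The threshold separates them:
    -- children of u have β at least that of u, hence at least θ, and the other cycles below ∗ lie
    -- under θ by `low`.
    sprout-uncap : sprout uncap u θ ≈ G₀
    sprout-uncap = record
      { σ≈ = λ { zero → sym fix₀ ; (suc x) → sym (shrink-σ G₀ rk fix₀ β≤ attained x) }
      ; up≈ = λ { zero → sym up₀-zero ; (suc x) → up-suc x (G₀.parent (suc x)) refl }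
      }

    opaque
      unfolding cap

      cap-uncap : cap uncap u θ ≈ G
      cap-uncap = record
        { σ≈ = λ x → trans (cong π (σ≈ sprout-uncap (π x))) (trans (π² _) (cong σ (π² x)))
        ; up≈ = λ x → trans (cong (Maybe.map π) (up≈ sprout-uncap (π x)))
                        (trans (map-π² (parent (π (π x)))) (cong parent (π² x)))
        }
        where
        map-π² : ∀ p → Maybe.map π (Maybe.map π p) ≡ p
        map-π² nothing = refl
        map-π² (just x) = cong just (π² x)

kid-of-zero : {lab : Fin (suc n) → ℕ} (G : Forest (suc n) lab) {M : Fin (suc n)} →
              Forest.parent G M ≡ just zero → ∃ λ u → M ≡ suc u
kid-of-zero G {zero} e = ⊥-elim (rooted-irreflexive (Forest.rooted G zero) e)
kid-of-zero G {suc u} e = u , refl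

module _ {n : ℕ} (G : Forest (suc n) rk) where
  open Forest G

  leaf-or-MaxKid : Leaf G ⊎ ∃ (MaxKid G)
  leaf-or-MaxKid with maximum (λ x → (parent x ≟ᴹ just zero) ×-dec (o x ≟ x)) β
  ... | inj₁ none = inj₁ λ x e → none (o x) (trans (up-o x) e , o-o x)
  ... | inj₂ (M , (e , r) , max) = inj₂ (M , record
          { kid = e ; rep = r ; max = λ x e' → max (o x) (trans (up-o x) e' , o-o x) })

  β<MaxKid : ∀ {M x} → MaxKid G M → parent x ≡ just zero → o x ≡ x → x ≢ M → β x < β M
  β<MaxKid {M} {x} m e r ne = ℕ.≤∧≢⇒< (subst (λ y → β y ≤ β M) r (MaxKid.max m x e))
    λ βe → ne (siblings-distinct G rk-injective (trans e (sym (MaxKid.kid m))) βe)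

Preimage : Forest (suc n) rk → Set
Preimage {n} G = ∃ λ (F : Forest n rk) → ∃ λ (c : Choice F) → ins F c ≈ G

module _ {n : ℕ} (G : Forest (suc n) rk) where
  open Forest G

  leaf-preimage : Leaf G → Preimage G
  leaf-preimage leaf with σ zero in e
  ... | zero with F , p , eq ← removeLeaf G leaf e = F , solo p , eq
  ... | suc v = F , beside v , record { σ≈ = σ-eq ; up≈ = λ { zero → up-zero ; (suc x) → up≈ eq (suc x) } }
    where
    nonrep : o zero ≢ zero
    -- A representative has β at most that of its successor, but the β of the new leaf is n.
    nonrep o0 = ℕ.<-irrefl refl (ℕ.≤-<-trans (subst (_≤ β (suc v)) (trans (cong β
      (trans (cong o (sym e)) (trans (o-σ zero) o0))) (leaf-β G leaf)) (o-min (suc v))) (β-suc<n G v))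
    removed : ∃ λ (F : Forest n rk) → ∃ λ p → addLeaf F p ≈ unmerge G zero nonrep
    removed = removeLeaf (unmerge G zero nonrep) leaf (unmerge-σ-s G zero nonrep)
    F = proj₁ removed
    eq = proj₂ (proj₂ removed)
    up-zero : Maybe.map suc (Forest.parent F v) ≡ parent zero
    up-zero = trans (up≈ eq (suc v)) (trans (cong parent (sym e)) (up-σ zero))
    σ-eq : ∀ x → transpose zero (suc v) (Forest.σ (addLeaf F (Forest.parent F v)) x) ≡ σ x
    σ-eq x = trans (cong (transpose zero (suc v)) (σ-same x)) (transpose-involutive zero (suc v) (σ x))
      where
      σ-same : ∀ x → Forest.σ (addLeaf F (Forest.parent F v)) x ≡ transpose zero (suc v) (σ x)
      σ-same zero = trans (σ≈ eq zero) (cong (λ y → transpose zero y (σ zero)) e)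
      σ-same (suc x) = trans (σ≈ eq (suc x)) (cong (λ y → transpose zero y (σ (suc x))) e)

  -- Among the children of ∗ other than u, the cycle of greatest β was the last one of the segment
  -- moved to ∗, so its representative a restores the threshold. Without such a child the segment
  -- was empty.
  cap-preimage : (u : Fin n) → MaxKid G (suc u) → σ (suc u) ≡ suc u → Preimage G
  cap-preimage u m fix with maximum (λ x → (parent (suc x) ≟ᴹ just zero) ×-dec (o (suc x) ≟ suc x) ×-dec ≢? x) (β ∘ suc)
    where
    ≢? : ∀ x → Dec (x ≢ u)
    ≢? x with x ≟ u
    ... | yes e = no λ ne → ne e
    ... | no ne = yes ne
  ... | inj₁ none = F , above u , cap-uncap G u m fix 0 z≤n λ {x} x≢u e →
          let eo = uncap-o G u m fix x≢u e in
          ⊥-elim (none (F.o x) (trans (cong parent (sym eo)) (trans (up-o (suc x)) e) ,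
            trans (cong o (sym eo)) (trans (o-o (suc x)) eo) ,
            λ o≡u → kid≢father F (trans (F.up-o x) (uncap-up G u m fix x≢u e)) o≡u))
    where
    F = uncap G u m fix
    module F = Forest F
  ... | inj₂ (a , (e , r , a≢u) , max) = F , lift a a-improper , cap-uncap G u m fix (suc (F.β a))
          (subst (λ b → suc b ≤ β (suc u)) (sym βa) lt)
          λ {x} x≢u e' → s≤s (subst₂ _≤_ (sym (uncap-βo G u m fix x≢u e')) (sym βa) (low x≢u e'))
    where
    F = uncap G u m fix
    module F = Forest F
    βa : F.β a ≡ β (suc a)
    βa = uncap-β G u m fix a≢u
    lt : β (suc a) < β (suc u)
    lt = β<MaxKid G m e r (a≢u ∘ suc-injective)
    -- The β of a is less than that of u, which is at most the label of u.
    a-improper : Improper F a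
    a-improper = improper u (uncap-up G u m fix a≢u e) (suc-injective (trans (sym (uncap-o G u m fix a≢u e)) r))
            (ℕ.<-≤-trans (subst (_< β (suc u)) (sym βa) lt) (β≤lab (suc u)))
    low : ∀ {x} → x ≢ u → parent (suc x) ≡ just zero → β (o (suc x)) ≤ β (suc a)
    low {x} x≢u e' = subst (λ y → β y ≤ β (suc a)) (sym eo)
      (max (F.o x) (trans (cong parent (sym eo)) (trans (up-o (suc x)) e') ,
            trans (cong o (sym eo)) (trans (o-o (suc x)) eo) ,
            λ o≡u → kid≢father F (trans (F.up-o x) (uncap-up G u m fix x≢u e')) o≡u))
      where eo = uncap-o G u m fix x≢u e'

  -- Split off its cycle, u becomes a fixed point whose β is at least that of the former maximum a.
  -- It is then the greatest child of ∗, and `uncap` applies.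
  join-preimage : (a u : Fin n) → MaxKid G (suc a) → σ (suc a) ≡ suc u → u ≢ a → Preimage G
  join-preimage a u m e u≢a = F , join a a-improper , record { σ≈ = σ-eq ; up≈ = up≈ recapped }
    where
    s = suc u
    os : o s ≡ suc a
    os = trans (cong o (sym e)) (trans (o-σ (suc a)) (MaxKid.rep m))
    nonrep : o s ≢ s
    nonrep p = u≢a (suc-injective (trans (sym p) os))
    G₁ = unmerge G s nonrep
    module G₁ = Forest G₁
    up-s : parent s ≡ just zero
    up-s = trans (cong parent (sym e)) (trans (up-σ (suc a)) (MaxKid.kid m))
    β≤s : β (suc a) ≤ β s
    β≤s = subst (λ y → β y ≤ β s) os (o-min s)
    m₁ : MaxKid G₁ s
    m₁ = record { kid = up-s ; rep = unmerge-o-s G s nonrep ; max = max }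
      where
      max : ∀ x → parent x ≡ just zero → β (G₁.o x) ≤ β s
      max x p = go (x ≟ s)
        where
        go : Dec (x ≡ s) → β (G₁.o x) ≤ β s
        go (yes refl) = ℕ.≤-reflexive (cong β (unmerge-o-s G s nonrep))
        go (no ne) = ℕ.≤-trans (ℕ.≤-reflexive (cong β (unmerge-o-other G s nonrep ne)))
                       (ℕ.≤-trans (MaxKid.max m x p) β≤s)
    fix = unmerge-σ-s G s nonrep
    F = uncap G₁ u m₁ fix
    module F = Forest F
    a≢u : a ≢ u
    a≢u p = u≢a (sym p)
    βa : F.β a ≡ β (suc a)
    βa = uncap-β G₁ u m₁ fix a≢u
    oa : G₁.o (suc a) ≡ suc a
    oa = trans (unmerge-o-other G s nonrep (a≢u ∘ suc-injective)) (MaxKid.rep m)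
    lt : β (suc a) < β s
    lt = β<MaxKid G₁ m₁ (MaxKid.kid m) oa (a≢u ∘ suc-injective)
    a-improper : Improper F a
    a-improper = improper u (uncap-up G₁ u m₁ fix a≢u (MaxKid.kid m))
            (suc-injective (trans (sym (uncap-o G₁ u m₁ fix a≢u (MaxKid.kid m))) oa))
            (ℕ.<-≤-trans (subst (_< β s) (sym βa) lt) (β≤lab s))
    recapped : cap F u (suc (F.β a)) ≈ G₁
    recapped = cap-uncap G₁ u m₁ fix (suc (F.β a)) (subst (λ b → suc b ≤ β s) (sym βa) lt)
      λ {x} x≢u p → s≤s (subst₂ _≤_
        (trans (cong β (sym (unmerge-o-other G s nonrep (x≢u ∘ suc-injective)))) (sym (uncap-βo G₁ u m₁ fix x≢u p)))
        (sym βa) (MaxKid.max m (suc x) p))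
    σ₁a : G₁.σ (suc a) ≡ σ s
    σ₁a = trans (cong (transpose s (σ s)) e) (transpose-fst s (σ s))
    σ-eq : ∀ x → transpose s (Forest.σ (cap F u (suc (F.β a))) (suc a)) (Forest.σ (cap F u (suc (F.β a))) x) ≡ σ x
    σ-eq x = trans (cong₂ (transpose s) (trans (σ≈ recapped (suc a)) σ₁a) (σ≈ recapped x))
               (transpose-involutive s (σ s) (σ x))

  ins-surjective : Preimage G
  ins-surjective with leaf-or-MaxKid G
  ... | inj₁ leaf = leaf-preimage leaf
  ... | inj₂ (M , m) with kid-of-zero G {M} (MaxKid.kid m)
  ...   | a , refl with kid-of-zero G {σ (suc a)} (trans (up-σ (suc a)) (MaxKid.kid m))
  ...     | u , e with u ≟ a
  ...       | yes refl = cap-preimage u m e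
  ...       | no u≢a = join-preimage a u m e u≢a

-- Effect of the insertion on the statistics

-- rootK, improperK and extraK are the vertices counted by tree, imp and bdeg, respectively.
data Kind : Set where
  rootK properK improperK extraK : Kind

kindOf : Bool → Maybe ℕ → ℕ → Kind
kindOf false _ _ = extraK
kindOf true nothing _ = rootK
kindOf true (just f) b = if b <ᵇ f then improperK else properK

hit : Kind → Kind → ℕ
hit rootK rootK = 1
hit properK properK = 1
hit improperK improperK = 1
hit extraK extraK = 1
hit _ _ = 0

sumFin : (Fin n → ℕ) → ℕ
sumFin {zero} f = 0
sumFin {suc n} f = f zero + sumFin (f ∘ suc)

sumFin-cong : {f g : Fin n → ℕ} → (∀ x → f x ≡ g x) → sumFin f ≡ sumFin g
sumFin-cong {zero} e = refl
sumFin-cong {suc n} e = cong₂ _+_ (e zero) (sumFin-cong (e ∘ suc))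

sumFin-change : (s : Fin n) {f g : Fin n → ℕ} → (∀ {x} → x ≢ s → f x ≡ g x) → sumFin f + g s ≡ sumFin g + f s
sumFin-change zero {f} {g} e = begin
  f zero + sumFin (f ∘ suc) + g zero ≡⟨ cong (λ k → f zero + k + g zero) (sumFin-cong (λ x → e {suc x} (λ ()))) ⟩
  f zero + sumFin (g ∘ suc) + g zero ≡⟨ ℕ.+-comm (f zero + sumFin (g ∘ suc)) (g zero) ⟩
  g zero + (f zero + sumFin (g ∘ suc)) ≡⟨ cong (g zero +_) (ℕ.+-comm (f zero) _) ⟩
  g zero + (sumFin (g ∘ suc) + f zero) ≡⟨ ℕ.+-assoc (g zero) _ _ ⟨
  g zero + sumFin (g ∘ suc) + f zero ∎
  where open ≡-Reasoning
sumFin-change (suc s) {f} {g} e = begin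
  f zero + sumFin (f ∘ suc) + g (suc s) ≡⟨ ℕ.+-assoc (f zero) _ _ ⟩
  f zero + (sumFin (f ∘ suc) + g (suc s)) ≡⟨ cong₂ _+_ (e {zero} (λ ())) (sumFin-change s (λ {x} ne → e {suc x} (ne ∘ suc-injective))) ⟩
  g zero + (sumFin (g ∘ suc) + f (suc s)) ≡⟨ ℕ.+-assoc (g zero) _ _ ⟨
  g zero + sumFin (g ∘ suc) + f (suc s) ∎
  where open ≡-Reasoning

Fin-sumFin : {n : ℕ} (f : Fin n → ℕ) → Fin (sumFin f) ↔ Σ (Fin n) (Fin ∘ f)
Fin-sumFin {zero} f = mk↔ₛ′ (λ ()) (λ ()) (λ ()) (λ ())
Fin-sumFin {suc n} f = ↔-trans +↔⊎ (↔-trans (↔-refl ⊎-↔ Fin-sumFin (f ∘ suc)) (mk↔ₛ′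
  (λ { (inj₁ i) → zero , i ; (inj₂ (x , i)) → suc x , i }) (λ { (zero , i) → inj₁ i ; (suc x , i) → inj₂ (x , i) })
  (λ { (zero , i) → refl ; (suc x , i) → refl }) (λ { (inj₁ i) → refl ; (inj₂ (x , i)) → refl })))

-- By counting: the sums are the sizes of disjoint unions whose summands π permutes.
sumFin-involution : (π : Fin n → Fin n) → (∀ x → π (π x) ≡ x) → (f : Fin n → ℕ) → sumFin (f ∘ π) ≡ sumFin f
sumFin-involution π π² f = ↔⇒≡ (↔-trans (Fin-sumFin (f ∘ π))
  (↔-trans (Σ-cong (mk↔ₛ′ π π π² π²) ↔-refl) (↔-sym (Fin-sumFin f))))

module _ {n : ℕ} {lab : Fin n → ℕ} (F : Forest n lab) where
  open Forest F

  kind : Fin n → Kind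
  kind x = kindOf (does (o x ≟ x)) (Maybe.map lab (parent x)) (β x)

  num : Kind → ℕ
  num k = sumFin (hit k ∘ kind)

module _ {lab lab' : Fin n → ℕ} (F : Forest n lab) (π : Fin n → Fin n) (π² : ∀ x → π (π x) ≡ x)
         (lab'≡ : ∀ x → lab' x ≡ lab (π x)) where
  open Forest F

  kind-relabel : ∀ x → kind (relabel F π π² lab' lab'≡) x ≡ kind F (π x)
  kind-relabel x = cong₂ (λ b q → kindOf b q (β (π x))) (does-≟ (o (π x)))
    (trans (sym (map-∘ (parent (π x)))) (map-cong (λ y → trans (lab'≡ (π y)) (cong lab (π² y))) (parent (π x))))
    where
    does-≟ : ∀ y → does (π y ≟ x) ≡ does (y ≟ π x)
    does-≟ y with y ≟ π x
    ... | yes e = dec-true (π y ≟ x) (trans (cong π e) (π² x))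
    ... | no ne = dec-false (π y ≟ x) (λ e → ne (trans (sym (π² y)) (cong π e)))

  num-relabel : ∀ k → num (relabel F π π² lab' lab'≡) k ≡ num F k
  num-relabel k = trans (sumFin-cong (λ x → cong (hit k) (kind-relabel x))) (sumFin-involution π π² (hit k ∘ kind F))

<ᵇ-true : ∀ {m n} → m < n → (m <ᵇ n) ≡ true
<ᵇ-true {m} {n} lt with m <ᵇ n in e
... | true = refl
... | false = ⊥-elim (subst T e (ℕ.<⇒<ᵇ lt))

<ᵇ-false : ∀ {m n} → n ≤ m → (m <ᵇ n) ≡ false
<ᵇ-false {m} {n} le with m <ᵇ n in e
... | false = refl
... | true = ⊥-elim (ℕ.<⇒≱ (ℕ.<ᵇ⇒< m n (subst T (sym e) tt)) le)

module _ {n : ℕ} (F : Forest n rk) where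
  open Forest F

  kind-addLeaf : ∀ p x → kind (addLeaf F p) (suc x) ≡ kind F x
  kind-addLeaf p x = cong (λ q → kindOf (does (o x ≟ x)) q (β x)) (sym (map-∘ (parent x)))

  num-addLeaf : ∀ p k → num (addLeaf F p) k ≡ hit k (kind (addLeaf F p) zero) + num F k
  num-addLeaf p k = cong (hit k (kind (addLeaf F p) zero) +_) (sumFin-cong (λ x → cong (hit k) (kind-addLeaf p x)))

  kind-addLeaf-just : ∀ v → kind (addLeaf F (just v)) zero ≡ properK
  kind-addLeaf-just v = cong (λ b → if b then improperK else properK) (<ᵇ-false (ℕ.<⇒≤ (rk<n v)))

-- This is the effect of `merge`: s ceases to be a representative and all other kinds stay. The
-- former kind of s is added on the left to avoid truncated subtraction.
num-demote : {lab : Fin n → ℕ} (F G : Forest n lab) (s : Fin n) →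
             (∀ x → Forest.parent G x ≡ Forest.parent F x) → (∀ x → Forest.β G x ≡ Forest.β F x) →
             (∀ {x} → x ≢ s → Forest.o G x ≡ Forest.o F x) → Forest.o G s ≢ s →
             ∀ k → num G k + hit k (kind F s) ≡ hit k extraK + num F k
num-demote {lab = lab} F G s up= β= o= nonrep k = trans (sumFin-change s unchanged)
  (trans (ℕ.+-comm (num F k) _) (cong (λ b → hit k (kindOf b (Maybe.map lab (G.parent s)) (G.β s)) + num F k)
    (dec-false (G.o s ≟ s) nonrep)))
  where
  module F = Forest F
  module G = Forest G
  unchanged : ∀ {x} → x ≢ s → hit k (kind G x) ≡ hit k (kind F x)
  unchanged {x} ne = cong (hit k) (trans (cong₂ (λ y q → kindOf (does (y ≟ x)) (Maybe.map lab q) (G.β x)) (o= ne) (up= x))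
    (cong (kindOf (does (F.o x ≟ x)) (Maybe.map lab (F.parent x))) (β= x)))

module _ {n : ℕ} (F : Forest n rk) where
  open Forest F

  module _ (u : Fin n) (θ : ℕ) (θ≤ : θ ≤ rk u) where
    private
      lab' : Fin (suc n) → ℕ
      lab' = rk ∘ π-cap F u θ
      S = sprout F u θ
      module S = Forest S

      lab'-u : lab' (suc u) ≡ n
      lab'-u = cong rk (transpose-snd zero (suc u))

    -- Only a child of u could change its kind. A kept one still has a father with the label of u.
    -- One that moves gets a father with a larger label, but its cycle lies under θ, which is at
    -- most the label of u, so a representative is improper before and after.
    kind-sprout : ∀ x → kind S (suc x) ≡ kind F x
    kind-sprout x = go (adopted? F u θ x)
      where
      K : Maybe ℕ → Kind
      K q = kindOf (does (o x ≟ x)) q (β x)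
      low : ¬ θ ≤ β (o x) → ∀ {f} → rk u ≤ f → K (just f) ≡ K (just (rk u))
      low nle {f} le with o x ≟ x
      ... | no _ = refl
      ... | yes e = cong (λ b → if b then improperK else properK)
                      (trans (<ᵇ-true (ℕ.<-≤-trans lt le)) (sym (<ᵇ-true lt)))
        where
        lt : β x < rk u
        lt = ℕ.<-≤-trans (subst (λ y → β y < θ) e (ℕ.≰⇒> nle)) θ≤
      other : ¬ (parent x ≡ just u × θ ≤ β (o x)) → ∀ p → parent x ≡ p → K (Maybe.map lab' (Maybe.map suc p)) ≡ K (Maybe.map rk p)
      other ¬k nothing e = refl
      other ¬k (just f) e with f ≟ u
      ... | no ne = refl
      ... | yes refl = low (λ le → ¬k (e , le)) (ℕ.<⇒≤ (rk<n u))
      go : Dec (parent x ≡ just u × θ ≤ β (o x)) → kind S (suc x) ≡ kind F x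
      go (yes k) = cong K (trans (cong (Maybe.map lab') (sprout-up-adopted F u θ k)) (cong (Maybe.map rk) (sym (proj₁ k))))
      go (no ¬k) = trans (cong (K ∘ Maybe.map lab') (sprout-up-other F u θ ¬k)) (other ¬k (parent x) refl)

    kind-sprout-zero : kind S zero ≡ improperK
    kind-sprout-zero = cong (λ b → if b then improperK else properK)
      (<ᵇ-true (subst (S.β zero <_) (sym lab'-u) (ℕ.≤-<-trans (proj₁ (proj₂ (lowest F u θ))) (rk<n u))))

    num-sprout : ∀ k → num S k ≡ hit k improperK + num F k
    num-sprout k = cong₂ _+_ (cong (hit k) kind-sprout-zero) (sumFin-cong (λ x → cong (hit k) (kind-sprout x)))

    opaque
      unfolding cap

      kind-cap : ∀ x → kind (cap F u θ) x ≡ kind S (transpose zero (suc u) x)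
      kind-cap x = kind-relabel {lab' = rk} S (transpose zero (suc u)) (transpose-involutive zero (suc u))
                     (λ y → cong rk (sym (transpose-involutive zero (suc u) y))) x

    num-cap : ∀ k → num (cap F u θ) k ≡ hit k improperK + num F k
    num-cap k = trans (sumFin-cong (λ x → cong (hit k) (kind-cap x)))
                  (trans (sumFin-involution (transpose zero (suc u)) (transpose-involutive zero (suc u)) (hit k ∘ kind S)) (num-sprout k))

    kind-cap-u : kind (cap F u θ) (suc u) ≡ improperK
    kind-cap-u = trans (kind-cap (suc u)) (trans (cong (kind S) (transpose-snd zero (suc u))) kind-sprout-zero)

  added : Choice F → Kind
  added (solo nothing) = rootK
  added (solo (just _)) = properK
  added (beside _) = extraK
  added (above _) = improperK
  added (lift _ _) = improperK
  added (join _ _) = extraK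

  num-ins : ∀ c k → num (ins F c) k ≡ hit k (added c) + num F k
  num-ins (solo nothing) k = num-addLeaf F nothing k
  num-ins (solo (just v)) k = trans (num-addLeaf F (just v) k) (cong (λ κ → hit k κ + num F k) (kind-addLeaf-just F v))
  num-ins (beside v) k = ℕ.+-cancelʳ-≡ h _ _ (trans (num-demote (addLeaf F (parent v)) (beside-forest F v) zero (λ _ → refl) (λ _ → refl) other (λ ()) k)
    (trans (cong (hit k extraK +_) (trans (num-addLeaf F (parent v) k) (ℕ.+-comm h (num F k))))
      (sym (ℕ.+-assoc (hit k extraK) (num F k) h))))
    where
    h = hit k (kind (addLeaf F (parent v)) zero)
    other : ∀ {x} → x ≢ zero → Forest.o (beside-forest F v) x ≡ Forest.o (addLeaf F (parent v)) x
    other {zero} ne = ⊥-elim (ne refl)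
    other {suc x} ne = refl
  num-ins (above u) k = num-cap u 0 z≤n k
  num-ins (lift a i) k = num-cap (father i) (suc (β a)) (β< i) k
  -- Through `cap`, u enters as a new improper vertex, and the merge demotes it to an extra one, so
  -- the improper count returns to its old value.
  num-ins (join a i) k = ℕ.+-cancelʳ-≡ (hit k improperK) _ _
    (trans (cong (num (join-forest F a i) k +_) (cong (hit k) (sym (kind-cap-u (father i) (suc (β a)) (β< i)))))
      (trans (num-demote (cap F (father i) (suc (β a))) (join-forest F a i) (suc (father i)) (λ _ → refl) (λ _ → refl)
               (join-o-other F a i) nonrep k)
        (trans (cong (hit k extraK +_) (trans (num-cap (father i) (suc (β a)) (β< i) k) (ℕ.+-comm (hit k improperK) _)))
          (sym (ℕ.+-assoc (hit k extraK) _ _)))))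
    where
    nonrep : Forest.o (join-forest F a i) (suc (father i)) ≢ suc (father i)
    nonrep e = kid≢father F (up≡ i) (suc-injective (trans (sym (join-o-u F a i)) e))

-- Insertion histories and the terms of Q n

-- Insertion histories; they are in bijection with the forests and with the terms of Q n.
data Code : ℕ → Set
build : ∀ {n} → Code n → Forest n rk

data Code where
  [] : Code 0
  _▹_ : ∀ {n} (c : Code n) → Choice (build c) → Code (suc n)

build [] = record
  { σ = λ () ; parent = λ () ; β = λ () ; o = λ () ; σ-injective = λ { {()} } ; up-σ = λ () ; o-σ = λ () ; o-min = λ ()
  ; reach = λ () ; β≤lab = λ () ; β≤kid = λ { {()} } ; β-attained = λ () ; rooted = λ () }
build (c ▹ ch) = ins (build c) ch

≡⇒↔ : {A B : Set} → A ≡ B → A ↔ B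
≡⇒↔ refl = ↔-refl

Fin-suc-× : {m : ℕ} {A : Set} → (A ⊎ (Fin m × A)) ↔ (Fin (suc m) × A)
Fin-suc-× = mk↔ₛ′ (λ { (inj₁ a) → zero , a ; (inj₂ (i , a)) → suc i , a })
                  (λ { (zero , a) → inj₁ a ; (suc i , a) → inj₂ (i , a) })
                  (λ { (zero , a) → refl ; (suc i , a) → refl })
                  (λ { (inj₁ a) → refl ; (inj₂ (i , a)) → refl })

module _ {A : Set} where
  Any-∷ : {P : A → Set} {x : A} {xs : List A} → (P x ⊎ Any P xs) ↔ Any P (x ∷ xs)
  Any-∷ = mk↔ₛ′ (λ { (inj₁ p) → here p ; (inj₂ p) → there p }) (λ { (here p) → inj₁ p ; (there p) → inj₂ p })
                (λ { (here p) → refl ; (there p) → refl }) (λ { (inj₁ p) → refl ; (inj₂ p) → refl })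

  Any-replicate : {P : A → Set} (m : ℕ) {x : A} → Any P (replicate m x) ↔ (Fin m × P x)
  Any-replicate zero = mk↔ₛ′ (λ ()) (λ ()) (λ ()) (λ ())
  Any-replicate (suc m) = ↔-trans (↔-sym Any-∷) (↔-trans (↔-refl ⊎-↔ Any-replicate m) Fin-suc-×)

  Any-cong↔ : {P R : A → Set} → (∀ x → P x ↔ R x) → ∀ {xs} → Any P xs ↔ Any R xs
  Any-cong↔ e {[]} = mk↔ₛ′ (λ ()) (λ ()) (λ ()) (λ ())
  Any-cong↔ e {x ∷ xs} = ↔-trans (↔-sym Any-∷) (↔-trans (e x ⊎-↔ Any-cong↔ e) Any-∷)

  Any-× : {P : A → Set} {B : Set} {xs : List A} → (B × Any P xs) ↔ Any (λ x → B × P x) xs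
  Any-× {xs = []} = mk↔ₛ′ (λ ()) (λ ()) (λ ()) (λ ())
  Any-× {xs = x ∷ xs} = ↔-trans (↔-refl ×-↔ ↔-sym Any-∷) (↔-trans distrib
                          (↔-trans (↔-refl ⊎-↔ Any-×) Any-∷))
    where
    distrib : {B C D : Set} → (B × (C ⊎ D)) ↔ ((B × C) ⊎ (B × D))
    distrib = mk↔ₛ′ (λ { (b , inj₁ c) → inj₁ (b , c) ; (b , inj₂ d) → inj₂ (b , d) })
                    (λ { (inj₁ (b , c)) → b , inj₁ c ; (inj₂ (b , d)) → b , inj₂ d })
                    (λ { (inj₁ _) → refl ; (inj₂ _) → refl })
                    (λ { (_ , inj₁ _) → refl ; (_ , inj₂ _) → refl })

  Any-filter : (p : A → Bool) (xs : List A) → Fin (length (filterᵇ p xs)) ↔ Any (T ∘ p) xs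
  Any-filter p [] = mk↔ₛ′ (λ ()) (λ ()) (λ ()) (λ ())
  Any-filter p (x ∷ xs) with p x in e
  ... | true = ↔-trans Fin-suc (↔-trans (≡⇒↔ (cong T (sym e)) ⊎-↔ Any-filter p xs) Any-∷)
    where
    Fin-suc : ∀ {m} → Fin (suc m) ↔ (⊤ ⊎ Fin m)
    Fin-suc = mk↔ₛ′ (λ { zero → inj₁ tt ; (suc i) → inj₂ i }) (λ { (inj₁ _) → zero ; (inj₂ i) → suc i })
                    (λ { (inj₁ _) → refl ; (inj₂ i) → refl }) (λ { zero → refl ; (suc i) → refl })
  ... | false = ↔-trans (Any-filter p xs) (↔-trans (mk↔ₛ′ inj₂
                  (λ { (inj₁ t) → ⊥-elim (subst T e t) ; (inj₂ q) → q })
                  (λ { (inj₁ t) → ⊥-elim (subst T e t) ; (inj₂ q) → refl }) (λ _ → refl)) Any-∷)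

on-mono : (ℕ → ℕ → ℕ → Set) → Mono → Set
on-mono P (a , b , c , d) = P a b d

-- The terms of op m applied to the monomial x^a y^b t^d (with z = 1) that satisfy P.
Next : ℕ → (ℕ → ℕ → ℕ → Set) → ℕ → ℕ → ℕ → Set
Next m P a b d = P (suc a) b d ⊎ ((Fin m × P a b d)
               ⊎ (((Fin m × P a (suc b) d) ⊎ (Fin b × P a (suc b) d))
               ⊎ ((Fin m × P a b (suc d)) ⊎ (Fin b × P a b (suc d)))))

Any-scale : (P : Mono → Set) (m : ℕ) (L : Poly) → Any P (scale m L) ↔ Any (λ μ → Fin m × P μ) L
Any-scale P m L = ↔-trans (↔-sym concat↔) (↔-trans (Any-replicate m) Any-×)

Any-yDy : (P : Mono → Set) (L : Poly) → Any P (yDy L) ↔ Any (λ μ → Fin (proj₁ (proj₂ μ)) × P μ) L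
Any-yDy P L = ↔-trans (↔-sym concat↔) (↔-trans (↔-sym map↔) (Any-cong↔ (λ μ → Any-replicate (proj₁ (proj₂ μ)))))

Any-++ : {P : Mono → Set} {L L' : Poly} → Any P (L ++ L') ↔ (Any P L ⊎ Any P L')
Any-++ = ↔-sym ++↔

-- A term is a position in the list. The predicate is pulled back along `op`, which leaves it
-- arbitrary in the induction over n.
Any-op : (P : ℕ → ℕ → ℕ → Set) (m : ℕ) (L : Poly) → Any (on-mono P) (op m L) ↔ Any (on-mono (Next m P)) L
Any-op P m L =
  ↔-trans Any-++ (↔-trans (↔-sym map↔ ⊎-↔ ↔-trans Any-++ (↔-trans (↔-trans (Any-scale (on-mono P) m (mulZ L)) (↔-sym map↔) ⊎-↔
    ↔-trans Any-++ (↔-trans (↔-trans (↔-sym map↔) split ⊎-↔ ↔-trans (↔-sym map↔) split) ⊎↔)) ⊎↔)) ⊎↔)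
  where
  split : {P : Mono → Set} → Any P (scale m L ++ yDy L) ↔ Any (λ μ → (Fin m × P μ) ⊎ (Fin (proj₁ (proj₂ μ)) × P μ)) L
  split {P} = ↔-trans Any-++ (↔-trans (Any-scale P m L ⊎-↔ Any-yDy P L) ⊎↔)

T-∧↔ : (b c : Bool) → T (b ∧ c) ↔ (T b × T c)
T-∧↔ true c = mk↔ₛ′ (λ t → tt , t) proj₂ (λ _ → refl) (λ _ → refl)
T-∧↔ false c = mk↔ₛ′ (λ ()) proj₁ (λ { (() , _) }) (λ ())

T-≡ᵇ↔ : (m n : ℕ) → T (m ≡ᵇ n) ↔ (m ≡ n)
T-≡ᵇ↔ m n = mk↔ₛ′ (ℕ.≡ᵇ⇒≡ m n) (ℕ.≡⇒≡ᵇ m n) (λ _ → uip _ _) (λ _ → T-irrelevant _ _)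

coeffZ1↔ : (L : Poly) (i k j : ℕ) →
           Fin (coeffZ1 L i k j) ↔ Any (on-mono (λ a b d → (a ≡ i) × ((b ≡ k) × (d ≡ j)))) L
coeffZ1↔ L i k j = ↔-trans (Any-filter _ L) (Any-cong↔ λ { (a , b , c , d) →
  ↔-trans (T-∧↔ (a ≡ᵇ i) _) (T-≡ᵇ↔ a i ×-↔ ↔-trans (T-∧↔ (b ≡ᵇ k) _) (T-≡ᵇ↔ b k ×-↔ T-≡ᵇ↔ d j)) })

hit↔ : (κ : Kind) → Fin (hit improperK κ) ↔ (κ ≡ improperK)
hit↔ rootK = mk↔ₛ′ (λ ()) (λ ()) (λ ()) (λ ())
hit↔ properK = mk↔ₛ′ (λ ()) (λ ()) (λ ()) (λ ())
hit↔ improperK = mk↔ₛ′ (λ _ → refl) (λ _ → zero) (λ { refl → refl }) (λ { zero → refl })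
hit↔ extraK = mk↔ₛ′ (λ ()) (λ ()) (λ ()) (λ ())

module _ {n : ℕ} (F : Forest n rk) where
  open Forest F

  Improper-irrelevant : ∀ {a} (i i' : Improper F a) → i ≡ i'
  Improper-irrelevant (improper u p r lt) (improper u' p' r' lt') with refl ← just-injective (trans (sym p) p')
    with refl ← uip p p' | refl ← uip r r' | refl ← ℕ.≤-irrelevant lt lt' = refl

  Improper⇒kind : ∀ {a} → Improper F a → kind F a ≡ improperK
  Improper⇒kind {a} (improper u p r lt) =
    trans (cong₂ (λ b q → kindOf b (Maybe.map rk q) (β a)) (dec-true (o a ≟ a) r) p)
      (cong (λ b → if b then improperK else properK) (<ᵇ-true lt))

  kind⇒Improper : ∀ a → kind F a ≡ improperK → Improper F a
  kind⇒Improper a e = go (o a ≟ a) (parent a) refl e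
    where
    go : (d : Dec (o a ≡ a)) (p : Maybe (Fin n)) → parent a ≡ p → kindOf (does d) (Maybe.map rk p) (β a) ≡ improperK → Improper F a
    go (yes r) (just u) p e with β a <ᵇ rk u in lt
    ... | true = improper u p r (ℕ.<ᵇ⇒< _ _ (subst T (sym lt) tt))

  Fin-improper : Fin (num F improperK) ↔ ∃ (Improper F)
  Fin-improper = ↔-trans (Fin-sumFin _) (Σ-cong ↔-refl λ {a} → ↔-trans (hit↔ (kind F a))
    (mk↔ₛ′ (kind⇒Improper a) Improper⇒kind (λ _ → Improper-irrelevant _ _) (λ _ → uip _ _)))

  -- The summands follow the order of those in `Next`: the factors 1 for x, then n, then y and t,
  -- each of the last two with its vertices and its improper cycles.
  Choice↔ : (W : Choice F → Set) → Σ (Choice F) W ↔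
    (W (solo nothing) ⊎ (Σ (Fin n) (λ v → W (solo (just v)))
      ⊎ ((Σ (Fin n) (W ∘ above) ⊎ Σ (∃ (Improper F)) (λ (a , i) → W (lift a i)))
      ⊎ (Σ (Fin n) (W ∘ beside) ⊎ Σ (∃ (Improper F)) (λ (a , i) → W (join a i))))))
  Choice↔ W = mk↔ₛ′
    (λ { (solo nothing , w) → inj₁ w ; (solo (just v) , w) → inj₂ (inj₁ (v , w))
       ; (above u , w) → inj₂ (inj₂ (inj₁ (inj₁ (u , w)))) ; (lift a i , w) → inj₂ (inj₂ (inj₁ (inj₂ ((a , i) , w))))
       ; (beside v , w) → inj₂ (inj₂ (inj₂ (inj₁ (v , w)))) ; (join a i , w) → inj₂ (inj₂ (inj₂ (inj₂ ((a , i) , w)))) })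
    (λ { (inj₁ w) → solo nothing , w ; (inj₂ (inj₁ (v , w))) → solo (just v) , w
       ; (inj₂ (inj₂ (inj₁ (inj₁ (u , w))))) → above u , w ; (inj₂ (inj₂ (inj₁ (inj₂ ((a , i) , w))))) → lift a i , w
       ; (inj₂ (inj₂ (inj₂ (inj₁ (v , w))))) → beside v , w ; (inj₂ (inj₂ (inj₂ (inj₂ ((a , i) , w))))) → join a i , w })
    (λ { (inj₁ w) → refl ; (inj₂ (inj₁ (v , w))) → refl
       ; (inj₂ (inj₂ (inj₁ (inj₁ (u , w))))) → refl ; (inj₂ (inj₂ (inj₁ (inj₂ ((a , i) , w))))) → refl
       ; (inj₂ (inj₂ (inj₂ (inj₁ (v , w))))) → refl ; (inj₂ (inj₂ (inj₂ (inj₂ ((a , i) , w))))) → refl })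
    (λ { (solo nothing , w) → refl ; (solo (just v) , w) → refl
       ; (above u , w) → refl ; (lift a i , w) → refl
       ; (beside v , w) → refl ; (join a i , w) → refl })

Stat : {lab : Fin n → ℕ} → (ℕ → ℕ → ℕ → Set) → Forest n lab → Set
Stat P F = P (num F rootK ∸ 1) (num F improperK) (num F extraK)

module _ {n : ℕ} (F : Forest n rk) (P : ℕ → ℕ → ℕ → Set) where
  private
    r = num F rootK
    i = num F improperK
    e = num F extraK

    After : Kind → Set
    After κ = P (hit rootK κ + r ∸ 1) (hit improperK κ + i) (hit extraK κ + e)

    after : ∀ c → Stat P (ins F c) ↔ After (added F c)
    after c rewrite num-ins F c rootK | num-ins F c improperK | num-ins F c extraK = ↔-refl

    const↔ : {A B : Set} {X : Set} {W : A → Set} → B ↔ A → (∀ a → W a ↔ X) → Σ A W ↔ (B × X)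
    const↔ b e = ↔-sym (Σ-cong b (↔-sym (e _)))

  -- The exponent of x is r ∸ 1, and a new root raises it by one only if r is positive.
  Next↔ : 1 ≤ r → Next n P (r ∸ 1) i e ↔ Σ (Choice F) (λ c → Stat P (ins F c))
  Next↔ 1≤r = ↔-sym (↔-trans (Choice↔ F (λ c → Stat P (ins F c)))
    (↔-trans (after (solo nothing)) (≡⇒↔ (cong (λ k → P k i e) (sym (ℕ.m+[n∸m]≡n 1≤r))))
     ⊎-↔ (const↔ ↔-refl (λ v → after (solo (just v)))
     ⊎-↔ ((const↔ ↔-refl (λ u → after (above u)) ⊎-↔ const↔ (Fin-improper F) (λ (a , i) → after (lift a i)))
     ⊎-↔ (const↔ ↔-refl (λ v → after (beside v)) ⊎-↔ const↔ (Fin-improper F) (λ (a , i) → after (join a i)))))))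

Code-suc↔ : {V : Code (suc n) → Set} → Σ (Code n) (λ c → Σ (Choice (build c)) (λ ch → V (c ▹ ch))) ↔ Σ (Code (suc n)) V
Code-suc↔ = mk↔ₛ′ (λ (c , ch , v) → c ▹ ch , v) (λ { (c ▹ ch , v) → c , ch , v }) (λ { (c ▹ ch , v) → refl }) (λ (c , ch , v) → refl)

1≤roots : (c : Code (suc n)) → 1 ≤ num (build c) rootK
1≤roots {zero} ([] ▹ solo nothing) = ℕ.≤-refl
1≤roots {suc n} (c ▹ ch) = subst (1 ≤_) (sym (num-ins (build c) ch rootK)) (ℕ.m≤n⇒m≤o+n (hit rootK (added (build c) ch)) (1≤roots c))

Q↔Code : (n : ℕ) (P : ℕ → ℕ → ℕ → Set) → Any (on-mono P) (Q (suc n)) ↔ Σ (Code (suc n)) (Stat P ∘ build)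
-- All choices but `solo nothing` need an old vertex, so there is one history of length 1.
Q↔Code zero P = mk↔ₛ′ (λ { (here p) → [] ▹ solo nothing , p })
                      (λ { ([] ▹ solo nothing , p) → here p })
                      (λ { ([] ▹ solo nothing , p) → refl }) (λ { (here p) → refl })
Q↔Code (suc n) P = ↔-trans (Any-op P (suc n) (Q (suc n))) (↔-trans (Q↔Code n (Next (suc n) P))
  (↔-trans (Σ-cong ↔-refl λ {c} → Next↔ (build c) P (1≤roots c)) Code-suc↔))

-- Iteration of maps on a finite set

iterate-+ : {A : Set} (f : A → A) (x : A) (k l : ℕ) → iterate f x (k + l) ≡ iterate f (iterate f x k) l
iterate-+ f x zero l = refl
iterate-+ f x (suc k) l = iterate-+ f (f x) k l

iterate⇒Reach : {A : Set} {f : A → A} {x t : A} (k : ℕ) → iterate f x k ≡ t → Reach f t x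
iterate⇒Reach zero refl = here
iterate⇒Reach (suc k) e = step (iterate⇒Reach k e)

Reach⇒iterate : {A : Set} {f : A → A} {x t : A} → Reach f t x → ∃ λ k → iterate f x k ≡ t
Reach⇒iterate here = 0 , refl
Reach⇒iterate (step r) with k , e ← Reach⇒iterate r = suc k , e

Reach-trans : {A : Set} {f : A → A} {x y z : A} → Reach f y x → Reach f z y → Reach f z x
Reach-trans here s = s
Reach-trans (step r) s = step (Reach-trans r s)

module _ {f : Fin n → Fin n} where
  iterate-repeats : ∀ x → ∃ λ i → ∃ λ j → i < j × j ≤ n × iterate f x i ≡ iterate f x j
  iterate-repeats x with i , j , i<j , e ← pigeonhole ℕ.≤-refl (λ (i : Fin (suc n)) → iterate f x (toℕ i)) =
    toℕ i , toℕ j , i<j , ℕ.≤-pred (toℕ<n j) , e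

  -- `wf` tries at most n steps of `cyc`, so paths have to be shortened: among the first n + 1
  -- iterates two agree, and the stretch between them is cut out.
  iterate-short : ∀ {x t} k → iterate f x k ≡ t → ∃ λ l → l ≤ n × iterate f x l ≡ t
  iterate-short {x} {t} k e = go k (<-wellFounded k) e
    where
    go : ∀ k → Acc _<_ k → iterate f x k ≡ t → ∃ λ l → l ≤ n × iterate f x l ≡ t
    go k (acc rec) e with k ≤? n
    ... | yes k≤n = k , k≤n , e
    ... | no k≰n with i , j , i<j , j≤n , e' ← iterate-repeats x = go (i + (k ∸ j)) (rec shorter)
          (trans (iterate-+ f x i (k ∸ j)) (trans (cong (λ y → iterate f y (k ∸ j)) e')
            (trans (sym (iterate-+ f x j (k ∸ j))) (trans (cong (iterate f x) j+) e))))
      where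
      j+ : j + (k ∸ j) ≡ k
      j+ = ℕ.m+[n∸m]≡n (ℕ.≤-trans j≤n (ℕ.<⇒≤ (ℕ.≰⇒> k≰n)))
      shorter : i + (k ∸ j) < k
      shorter = subst (i + (k ∸ j) <_) j+ (ℕ.+-monoˡ-< (k ∸ j) i<j)

  module _ (f-inj : ∀ {x y} → f x ≡ f y → x ≡ y) where
    iterate-injective : ∀ k {x y} → iterate f x k ≡ iterate f y k → x ≡ y
    iterate-injective zero e = e
    iterate-injective (suc k) e = f-inj (iterate-injective k e)

    -- Injectivity cancels the first i steps of a repetition. This leaves a return to x in j - i
    -- steps, the first of which leads to f x.
    Reach-back : ∀ x → Reach f x (f x)
    Reach-back x with i , j , i<j , _ , e ← iterate-repeats x = iterate⇒Reach (j ∸ suc i)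
      (sym (iterate-injective i (trans e (trans (cong (iterate f x) (sym (trans (cong (_+ i) (ℕ.+-comm 1 (j ∸ suc i)))
        (trans (ℕ.+-assoc (j ∸ suc i) 1 i) (ℕ.m∸n+n≡m i<j))))) (iterate-+ f x (suc (j ∸ suc i)) i)))))

    Reach-sym : ∀ {x t} → Reach f t x → Reach f x t
    Reach-sym here = here
    Reach-sym (step r) = Reach-trans (Reach-sym r) (Reach-back _)

-- The Boolean test `wf` as a proposition

T-not-∨⁻ : (b : Bool) {c : Bool} → T (not b ∨ c) → T b → T c
T-not-∨⁻ true t _ = t

T-not-∨⁺ : (b : Bool) {c : Bool} → (T b → T c) → T (not b ∨ c)
T-not-∨⁺ true h = h tt
T-not-∨⁺ false h = tt

T-∧⁻ : (b : Bool) {c : Bool} → T (b ∧ c) → T b × T c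
T-∧⁻ true t = tt , t

T-∧⁺ : (b : Bool) {c : Bool} → T b → T c → T (b ∧ c)
T-∧⁺ true _ t = t

T-not⁻ : (b : Bool) → T (not b) → ¬ T b
T-not⁻ false _ ()

T-not⁺ : (b : Bool) → ¬ T b → T (not b)
T-not⁺ true h = ⊥-elim (h tt)
T-not⁺ false h = tt

T-∨⁻ : (b : Bool) {c : Bool} → T (b ∨ c) → ¬ T b → T c
T-∨⁻ true _ h = ⊥-elim (h tt)
T-∨⁻ false t _ = t

T-∨⁺ : (b : Bool) {c : Bool} → (¬ T b → T c) → T (b ∨ c)
T-∨⁺ true h = tt
T-∨⁺ false h = h (λ ())

T-≡ : {b c : Bool} → (T b → T c) → (T c → T b) → b ≡ c
T-≡ {false} {false} f g = refl
T-≡ {false} {true} f g = ⊥-elim (g tt)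
T-≡ {true} {false} f g = ⊥-elim (f tt)
T-≡ {true} {true} f g = refl

==⇒≡ : (a b : Fin n) → T (a == b) → a ≡ b
==⇒≡ a b t = toℕ-injective (ℕ.≡ᵇ⇒≡ _ _ t)

≡⇒== : {a b : Fin n} → a ≡ b → T (a == b)
≡⇒== {a = a} refl = ℕ.≡⇒≡ᵇ (toℕ a) _ refl

allF⁻ : (p : Fin n → Bool) → T (allF p) → ∀ x → T (p x)
allF⁻ p t x = All.lookup (all⁺ p _ t) (∈-allFin x)

allF⁺ : (p : Fin n → Bool) → (∀ x → T (p x)) → T (allF p)
allF⁺ p h = all⁻ p (All.tabulate {xs = allFin _} (λ {x} _ → h x))

isNothing⁻ : {p : Maybe (Fin n)} → T (isNothing p) → p ≡ nothing
isNothing⁻ {p = nothing} _ = refl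

isNothing⁺ : {p : Maybe (Fin n)} → p ≡ nothing → T (isNothing p)
isNothing⁺ refl = tt

module _ (F : HF n) where
  childOf⁻ : ∀ {w m} → T (childOf F w m) → lookup (par F) w ≡ bpar m
  childOf⁻ {w} {m} t with lookup (par F) w
  ... | bpar m' = cong bpar (==⇒≡ m' m t)

  childOf⁺ : ∀ {w m} → lookup (par F) w ≡ bpar m → T (childOf F w m)
  childOf⁺ {w} {m} e with lookup (par F) w
  childOf⁺ {w} {m} refl | bpar m = ≡⇒== {a = m} refl

  underBlack⁻ : ∀ {w} → T (underBlack F w) → ∃ λ m → lookup (par F) w ≡ bpar m
  underBlack⁻ {w} t with lookup (par F) w
  ... | bpar m = m , refl

  underBlack⁺ : ∀ {w m} → lookup (par F) w ≡ bpar m → T (underBlack F w)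
  underBlack⁺ {w} e with lookup (par F) w
  underBlack⁺ {w} refl | bpar m = tt

  iterCyc≡iterate : ∀ k w → iterCyc F k w ≡ iterate (lookup (cyc F)) w k
  iterCyc≡iterate zero w = refl
  iterCyc≡iterate (suc k) w = iterCyc≡iterate k _

  record WellFormed : Set where
    private
      pr = lookup (par F)
      cy = lookup (cyc F)
    field
      key : ∀ {w m} → pr w ≡ bpar m → pr m ≡ bpar m × toℕ m ≤ toℕ w
      no-key : ∀ m → pr m ≢ bpar m → lookup (bq F) m ≡ nothing
      cyc-fixed : ∀ w → (∀ m → pr w ≢ bpar m) → cy w ≡ w
      cyc-par : ∀ {w m} → pr w ≡ bpar m → pr (cy w) ≡ bpar m
      cyc-injective : ∀ {u v} → cy u ≡ cy v → u ≡ v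
      key-moved : ∀ {m} → pr m ≡ bpar m → cy m ≢ m
      key-reach : ∀ {w m} → pr w ≡ bpar m → ∃ λ k → k ≤ n × iterate cy m k ≡ w
      acyclic : ∀ w → iterUp F n (just w) ≡ nothing

  private
    c1 c2 c3 c4 c5 c6 c7 c8 : Bool
    c1 = allF (λ w → allF (λ m → not (childOf F w m) ∨ (isKey F m ∧ (toℕ m ≤ᵇ toℕ w))))
    c2 = allF (λ m → isKey F m ∨ isNothing (lookup (bq F) m))
    c3 = allF (λ w → underBlack F w ∨ (lookup (cyc F) w == w))
    c4 = allF (λ w → allF (λ m → not (childOf F w m) ∨ childOf F (lookup (cyc F) w) m))
    c5 = allF (λ u → allF (λ v → not (lookup (cyc F) u == lookup (cyc F) v) ∨ (u == v)))
    c6 = allF (λ m → not (isKey F m) ∨ not (lookup (cyc F) m == m))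
    c7 = allF (λ w → allF (λ m → not (childOf F w m) ∨ any (λ k → iterCyc F k m == w) (upTo (suc n))))
    c8 = allF (λ w → isNothing (iterUp F n (just w)))

  wf⁻ : T (wf F) → WellFormed
  wf⁻ t = record
    { key = λ {w} {m} e → let (k , le) = T-∧⁻ (isKey F m) (T-not-∨⁻ (childOf F w m) (allF⁻ _ (allF⁻ _ t1 w) m) (childOf⁺ e))
                          in childOf⁻ k , ℕ.≤ᵇ⇒≤ _ _ le
    ; no-key = λ m ne → isNothing⁻ (T-∨⁻ (isKey F m) (allF⁻ _ t2 m) (λ k → ne (childOf⁻ k)))
    ; cyc-fixed = λ w ne → ==⇒≡ _ _ (T-∨⁻ (underBlack F w) (allF⁻ _ t3 w) (λ b → ne _ (proj₂ (underBlack⁻ b))))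
    ; cyc-par = λ {w} {m} e → childOf⁻ (T-not-∨⁻ (childOf F w m) (allF⁻ _ (allF⁻ _ t4 w) m) (childOf⁺ e))
    ; cyc-injective = λ {u} {v} e → ==⇒≡ u v (T-not-∨⁻ (lookup (cyc F) u == lookup (cyc F) v)
                                       (allF⁻ _ (allF⁻ _ t5 u) v) (≡⇒== e))
    ; key-moved = λ {m} e c → T-not⁻ (lookup (cyc F) m == m) (T-not-∨⁻ (isKey F m) (allF⁻ _ t6 m) (childOf⁺ e)) (≡⇒== c)
    ; key-reach = λ {w} {m} e → let (k , k∈ , q) = find (any⁻ _ _ (T-not-∨⁻ (childOf F w m) (allF⁻ _ (allF⁻ _ t7 w) m) (childOf⁺ e)))
                          in k , ℕ.≤-pred (∈-upTo⁻ k∈) , trans (sym (iterCyc≡iterate k m)) (==⇒≡ _ _ q)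
    ; acyclic = λ w → isNothing⁻ (allF⁻ _ t8 w)
    }
    where
    s1 = T-∧⁻ c1 t
    t1 = proj₁ s1
    s2 = T-∧⁻ c2 (proj₂ s1)
    t2 = proj₁ s2
    s3 = T-∧⁻ c3 (proj₂ s2)
    t3 = proj₁ s3
    s4 = T-∧⁻ c4 (proj₂ s3)
    t4 = proj₁ s4
    s5 = T-∧⁻ c5 (proj₂ s4)
    t5 = proj₁ s5
    s6 = T-∧⁻ c6 (proj₂ s5)
    t6 = proj₁ s6
    s7 = T-∧⁻ c7 (proj₂ s6)
    t7 = proj₁ s7
    t8 = proj₂ s7

  wf⁺ : WellFormed → T (wf F)
  wf⁺ W =
    T-∧⁺ c1 (allF⁺ _ λ w → allF⁺ _ λ m → T-not-∨⁺ (childOf F w m) λ c → let (k , le) = key (childOf⁻ c) in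
      T-∧⁺ (isKey F m) (childOf⁺ k) (ℕ.≤⇒≤ᵇ le))
    (T-∧⁺ c2 (allF⁺ _ λ m → T-∨⁺ (isKey F m) λ nk → isNothing⁺ (no-key m (λ e → nk (childOf⁺ e))))
    (T-∧⁺ c3 (allF⁺ _ λ w → T-∨⁺ (underBlack F w) λ nb → ≡⇒== (cyc-fixed w (λ m e → nb (underBlack⁺ e))))
    (T-∧⁺ c4 (allF⁺ _ λ w → allF⁺ _ λ m → T-not-∨⁺ (childOf F w m) λ c → childOf⁺ (cyc-par (childOf⁻ c)))
    (T-∧⁺ c5 (allF⁺ _ λ u → allF⁺ _ λ v → T-not-∨⁺ (lookup (cyc F) u == lookup (cyc F) v) λ e →
      ≡⇒== (cyc-injective (==⇒≡ _ _ e)))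
    (T-∧⁺ c6 (allF⁺ _ λ m → T-not-∨⁺ (isKey F m) λ k → T-not⁺ (lookup (cyc F) m == m) λ c →
      key-moved (childOf⁻ k) (==⇒≡ _ _ c))
    (T-∧⁺ c7 (allF⁺ _ λ w → allF⁺ _ λ m → T-not-∨⁺ (childOf F w m) λ c →
      let (k , k≤ , e) = key-reach (childOf⁻ c) in
      any⁺ _ (lose (∈-upTo⁺ (s≤s k≤)) (≡⇒== (trans (iterCyc≡iterate k m) e))))
    (allF⁺ _ λ w → isNothing⁺ (acyclic w))))))))
    where open WellFormed W

-- Decoding of a well-formed `HF`

==M⁻ : {p : Maybe (Fin n)} {a : Fin n} → T (p ==M just a) → p ≡ just a
==M⁻ {p = just b} {a} t = cong just (==⇒≡ b a t)

==M⁺ : {p : Maybe (Fin n)} {a : Fin n} → p ≡ just a → T (p ==M just a)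
==M⁺ {a = a} refl = ≡⇒== {a = a} refl

module _ (p : Fin n → Bool) (d : ℕ) where
  private
    least : List (Fin n) → ℕ
    least = foldr (λ u acc → if p u then toℕ u ⊓ acc else acc) d

  least≤default : ∀ xs → least xs ≤ d
  least≤default [] = ℕ.≤-refl
  least≤default (x ∷ xs) with p x
  ... | true = ℕ.≤-trans (ℕ.m⊓n≤n (toℕ x) (least xs)) (least≤default xs)
  ... | false = least≤default xs

  least≤ : ∀ {u xs} → u ∈ xs → T (p u) → least xs ≤ toℕ u
  least≤ {u} {.u ∷ xs} (here refl) t with p u
  ... | true = ℕ.m⊓n≤m (toℕ u) (least xs)
  least≤ {u} {x ∷ xs} (there u∈) t with p x
  ... | true = ℕ.≤-trans (ℕ.m⊓n≤n (toℕ x) (least xs)) (least≤ u∈ t)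
  ... | false = least≤ u∈ t

  least-attained : ∀ xs → least xs ≡ d ⊎ ∃ λ u → T (p u) × least xs ≡ toℕ u
  least-attained [] = inj₁ refl
  least-attained (x ∷ xs) with p x in e
  ... | false = least-attained xs
  ... | true with ℕ.⊓-sel (toℕ x) (least xs)
  ...   | inj₁ e' = inj₂ (x , subst T (sym e) tt , e')
  ...   | inj₂ e' = Sum.map (trans e') (λ (u , t , e'') → u , t , trans e' e'') (least-attained xs)

module _ (F : HF n) where
  up-bpar : ∀ {w m} → lookup (par F) w ≡ bpar m → up F w ≡ lookup (bq F) m
  up-bpar {w} e with lookup (par F) w
  up-bpar {w} refl | bpar m = refl

  iterUp-nothing : ∀ k → iterUp F k nothing ≡ nothing
  iterUp-nothing zero = refl
  iterUp-nothing (suc k) = refl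

  iterUp-+ : ∀ k l p → iterUp F (k + l) p ≡ iterUp F l (iterUp F k p)
  iterUp-+ zero l p = refl
  iterUp-+ (suc k) l nothing = sym (iterUp-nothing l)
  iterUp-+ (suc k) l (just w) = iterUp-+ k l (up F w)

  iterUp-suc : ∀ {k p x} → iterUp F k p ≡ just x → iterUp F (suc k) p ≡ up F x
  iterUp-suc {k} {p} e = trans (cong (λ j → iterUp F j p) (ℕ.+-comm 1 k)) (trans (iterUp-+ k 1 p) (cong (iterUp F 1) e))

  iterUp⇒Rooted : ∀ k {w} → iterUp F k (just w) ≡ nothing → Rooted (up F) w
  iterUp⇒Rooted (suc k) {w} e with up F w in u
  ... | nothing = top u
  ... | just v = below u (iterUp⇒Rooted k e)

  anc⁻ : ∀ {a u} → T (anc F a u) → ∃ λ k → iterUp F k (just u) ≡ just a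
  anc⁻ t with k , _ , q ← find (any⁻ _ (upTo (suc n)) t) = k , ==M⁻ q

module Decode (F : HF n) (W : WellFormed F) where
  open WellFormed W
  pr = lookup (par F)
  cy = lookup (cyc F)

  iterUp-late : ∀ {k u} → n ≤ k → iterUp F k (just u) ≡ nothing
  iterUp-late {k} {u} n≤k = trans (cong (λ j → iterUp F j (just u)) (sym (ℕ.m+[n∸m]≡n n≤k)))
    (trans (iterUp-+ F n (k ∸ n) (just u)) (trans (cong (iterUp F (k ∸ n)) (acyclic u)) (iterUp-nothing F (k ∸ n))))

  -- `anc` climbs at most n steps, and a longer walk has ended in `nothing` by acyclicity.
  anc⁺ : ∀ k {a u} → iterUp F k (just u) ≡ just a → T (anc F a u)
  anc⁺ k {a} {u} e with n ≤? k
  ... | yes n≤k with () ← trans (sym e) (iterUp-late n≤k)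
  ... | no n≰k = any⁺ _ (lose (∈-upTo⁺ (ℕ.m≤n⇒m≤1+n (ℕ.≰⇒> n≰k))) (==M⁺ e))

  βW-anc : ∀ k {w u} → iterUp F k (just u) ≡ just w → βW F w ≤ toℕ u
  βW-anc k {w} {u} e = least≤ (anc F w) (toℕ w) (∈-allFin u) (anc⁺ k e)

  βW-source : ∀ w → ∃ λ k → ∃ λ u → iterUp F k (just u) ≡ just w × βW F w ≡ toℕ u
  βW-source w with least-attained (anc F w) (toℕ w) (allFin n)
  ... | inj₁ e = 0 , w , refl , e
  ... | inj₂ (u , t , e) with k , p ← anc⁻ F t = k , u , p , e

  βW-kid : ∀ {x w} → up F x ≡ just w → βW F w ≤ βW F x
  βW-kid {x} {w} e with k , u , p , q ← βW-source x =
    ℕ.≤-trans (βW-anc (suc k) (trans (iterUp-suc F {k} p) e)) (ℕ.≤-reflexive (sym q))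

  -- On the walk from a least descendant up to w, the last vertex before w is a child with the same
  -- β.
  βW-attained : ∀ w → βW F w ≡ toℕ w ⊎ ∃ λ x → up F x ≡ just w × βW F w ≡ βW F x
  βW-attained w with βW-source w
  ... | zero , u , refl , q = inj₁ q
  ... | suc k , u , p , q with iterUp F k (just u) in e
  ...   | nothing with () ← trans (sym p) (trans (cong (λ j → iterUp F j (just u)) (ℕ.+-comm 1 k))
                              (trans (iterUp-+ F k 1 (just u)) (cong (iterUp F 1) e)))
  ...   | just x = inj₂ (x , up-x , ℕ.≤-antisym (βW-kid up-x) (ℕ.≤-trans (βW-anc k e) (ℕ.≤-reflexive (sym q))))
    where
    up-x : up F x ≡ just w
    up-x = trans (sym (iterUp-suc F {k} e)) p

  private
    leader' : ∀ m → ∃ λ x → (pr m ≡ bpar m → pr x ≡ bpar m) × (∀ {y} → pr y ≡ bpar m → βW F x ≤ βW F y)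
    leader' m with minimum (λ x → T? (childOf F x m)) (βW F) (βW F m)
    ... | b , _ , min , inj₁ e = m , id , λ {y} c → subst (_≤ βW F y) e (min y (childOf⁺ F c))
    ... | b , _ , min , inj₂ (x , c , e) = x , (λ _ → childOf⁻ F c) , λ {y} c → subst (_≤ βW F y) e (min y (childOf⁺ F c))

  -- For a key m this is the rightmost child of the black vertex, which becomes the representative
  -- of the cycle. The search starts from the β of the key, itself a child.
  leader : Fin n → Fin n
  leader m = proj₁ (leader' m)

  leader-child : ∀ {w m} → pr w ≡ bpar m → pr (leader m) ≡ bpar m
  leader-child {m = m} e = proj₁ (proj₂ (leader' m)) (proj₁ (key e))

  leader-min : ∀ {y m} → pr y ≡ bpar m → βW F (leader m) ≤ βW F y
  leader-min {m = m} = proj₂ (proj₂ (leader' m))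

  repOf : Fin n → Par n → Fin n
  repOf w root = w
  repOf w (wpar _) = w
  repOf w (bpar m) = leader m

  black-or-fixed : ∀ x → (∃ λ m → pr x ≡ bpar m) ⊎ (cy x ≡ x × repOf x (pr x) ≡ x)
  black-or-fixed x with pr x in e
  ... | bpar m = inj₁ (m , refl)
  ... | root = inj₂ (cyc-fixed x (λ m q → case-root (trans (sym e) q)) , refl)
    where
    case-root : ∀ {m} → root {n} ≢ bpar m
    case-root ()
  ... | wpar u = inj₂ (cyc-fixed x (λ m q → case-wpar (trans (sym e) q)) , refl)
    where
    case-wpar : ∀ {m} → wpar {n} u ≢ bpar m
    case-wpar ()

  cyc-up : ∀ x → up F (cy x) ≡ up F x
  cyc-up x with black-or-fixed x
  ... | inj₁ (m , e) = trans (up-bpar F (cyc-par e)) (sym (up-bpar F e))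
  ... | inj₂ (e , _) = cong (up F) e

  rep-black : ∀ {x m} → pr x ≡ bpar m → repOf x (pr x) ≡ leader m
  rep-black {x} e = cong (repOf x) e

  key-Reach : ∀ {w m} → pr w ≡ bpar m → Reach cy w m
  key-Reach e with k , _ , q ← key-reach e = iterate⇒Reach k q

  black-Reach : ∀ {w x m} → pr w ≡ bpar m → pr x ≡ bpar m → Reach cy w x
  black-Reach e e' = Reach-trans (Reach-sym cyc-injective (key-Reach e')) (key-Reach e)

  decode : Forest n toℕ
  decode = record
    { σ = cy ; parent = up F ; β = βW F ; o = λ x → repOf x (pr x)
    ; σ-injective = cyc-injective
    ; up-σ = cyc-up
    ; o-σ = o-cyc
    ; o-min = omin
    ; reach = reach'
    ; β≤lab = λ x → least≤default (anc F x) (toℕ x) (allFin n)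
    ; β≤kid = βW-kid
    ; β-attained = βW-attained
    ; rooted = λ x → iterUp⇒Rooted F n (acyclic x)
    }
    where
    o-cyc : ∀ x → repOf (cy x) (pr (cy x)) ≡ repOf x (pr x)
    o-cyc x with black-or-fixed x
    ... | inj₁ (m , e) = trans (rep-black (cyc-par e)) (sym (rep-black e))
    ... | inj₂ (e , _) = cong (λ y → repOf y (pr y)) e
    omin : ∀ x → βW F (repOf x (pr x)) ≤ βW F x
    omin x with black-or-fixed x
    ... | inj₁ (m , e) = subst (λ y → βW F y ≤ βW F x) (sym (rep-black e)) (leader-min e)
    ... | inj₂ (_ , e) = ℕ.≤-reflexive (cong (βW F) e)
    reach' : ∀ x → Reach cy (repOf x (pr x)) x
    reach' x with black-or-fixed x
    ... | inj₁ (m , e) = subst (λ y → Reach cy y x) (sym (rep-black e)) (black-Reach (leader-child e) e)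
    ... | inj₂ (_ , e) = subst (λ y → Reach cy y x) (sym e) here

-- A well-formed `HF` is determined by its cycles and fathers

lookup-ext : {A : Set} {xs ys : Vec A n} → (∀ i → lookup xs i ≡ lookup ys i) → xs ≡ ys
lookup-ext {xs = xs} {ys} e = trans (sym (tabulate∘lookup xs)) (trans (tabulate-cong e) (tabulate∘lookup ys))

whitePar : Maybe (Fin n) → Par n
whitePar nothing = root
whitePar (just u) = wpar u

whitePar≢bpar : (p : Maybe (Fin n)) {m : Fin n} → whitePar p ≢ bpar m
whitePar≢bpar nothing ()
whitePar≢bpar (just u) ()

bpar-injective : {a b : Fin n} → bpar a ≡ bpar b → a ≡ b
bpar-injective refl = refl

white-or-black : (F : HF n) (w : Fin n) → lookup (par F) w ≡ whitePar (up F w) ⊎ ∃ λ m → lookup (par F) w ≡ bpar m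
white-or-black F w with lookup (par F) w
... | root = inj₁ refl
... | wpar u = inj₁ refl
... | bpar m = inj₂ (m , refl)

module _ (F : HF n) (W : WellFormed F) where
  open WellFormed W
  open Decode F W using (pr; cy; key-Reach)

  black-moved : ∀ {w m} → pr w ≡ bpar m → cy w ≢ w
  black-moved e c with refl ← fixed-unreachable cyc-injective c (key-Reach e) = key-moved e c

  moved-black : ∀ {w} → cy w ≢ w → ∃ λ m → pr w ≡ bpar m
  moved-black {w} c with white-or-black F w
  ... | inj₁ e = ⊥-elim (c (cyc-fixed w λ m e' → whitePar≢bpar (up F w) (trans (sym e) e')))
  ... | inj₂ b = b

module _ (F F' : HF n) (W : WellFormed F) (W' : WellFormed F')
         (cyc≡ : ∀ x → lookup (cyc F) x ≡ lookup (cyc F') x) where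
  private
    module D = Decode F W
    module D' = Decode F' W'

  -- The key m lies on the cycle of w, all of whose vertices are children of m' in the other forest,
  -- and a key is a lower bound for the children.
  key-≤ : ∀ {w m m'} → D.pr w ≡ bpar m → D'.pr w ≡ bpar m' → toℕ m' ≤ toℕ m
  key-≤ {w} {m} {m'} e e' = proj₂ (WellFormed.key W' (along
      (Reach-≈ cyc≡ (Reach-sym (WellFormed.cyc-injective W) (D.key-Reach e))) e'))
    where
    along : ∀ {x t} → Reach D'.cy t x → D'.pr x ≡ bpar m' → D'.pr t ≡ bpar m'
    along here q = q
    along (step r) q = along r (WellFormed.cyc-par W' q)

module _ (F F' : HF n) (W : WellFormed F) (W' : WellFormed F')
         (cyc≡ : ∀ x → lookup (cyc F) x ≡ lookup (cyc F') x) (up≡ : ∀ x → up F x ≡ up F' x) where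
  private
    module D = Decode F W
    module D' = Decode F' W'

    par≡ : ∀ w → D.pr w ≡ D'.pr w
    par≡ w with white-or-black F w | white-or-black F' w
    ... | inj₁ e | inj₁ e' = trans e (trans (cong whitePar (up≡ w)) (sym e'))
    ... | inj₂ (m , e) | inj₂ (m' , e') = trans e (trans (cong bpar (toℕ-injective
          (ℕ.≤-antisym (key-≤ F' F W' W (sym ∘ cyc≡) e' e) (key-≤ F F' W W' cyc≡ e e')))) (sym e'))
    ... | inj₁ e | inj₂ (m' , e') with _ , b ← moved-black F W {w} (λ c → black-moved F' W' e' (trans (sym (cyc≡ w)) c)) =
      ⊥-elim (whitePar≢bpar (up F w) (trans (sym e) b))
    ... | inj₂ (m , e) | inj₁ e' with _ , b ← moved-black F' W' {w} (λ c → black-moved F W e (trans (cyc≡ w) c)) =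
      ⊥-elim (whitePar≢bpar (up F' w) (trans (sym e') b))

    bq≡ : ∀ m → lookup (bq F) m ≡ lookup (bq F') m
    bq≡ m with T? (isKey F m)
    ... | yes k = trans (sym (up-bpar F (childOf⁻ F k))) (trans (up≡ m)
                    (up-bpar F' (trans (sym (par≡ m)) (childOf⁻ F k))))
    ... | no nk = trans (WellFormed.no-key W m (λ e → nk (childOf⁺ F e)))
                    (sym (WellFormed.no-key W' m (λ e → nk (childOf⁺ F (trans (par≡ m) e)))))

  -- The keys can be recovered from σ, as minima of cycles.
  HF-ext : F ≡ F'
  HF-ext = hf-cong (lookup-ext par≡) (lookup-ext bq≡) (lookup-ext cyc≡)
    where
    hf-cong : ∀ {p p' q q' c c'} → p ≡ p' → q ≡ q' → c ≡ c' → hf p q c ≡ hf p' q' c'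
    hf-cong refl refl refl = refl

-- Encoding of a forest

module Encode (D : Forest n toℕ) where
  open Forest D

  private
    least-in-class : ∀ t → ∃ λ x → (o t ≡ t → o x ≡ t) × (∀ y → o y ≡ t → toℕ x ≤ toℕ y)
    least-in-class t with minimum (λ x → o x ≟ t) toℕ (toℕ t)
    ... | b , _ , min , inj₁ e = t , id , λ y p → subst (_≤ toℕ y) e (min y p)
    ... | b , _ , min , inj₂ (x , p , e) = x , (λ _ → p) , λ y p → subst (_≤ toℕ y) e (min y p)

  -- The key has the least label on the cycle, whereas the representative has the least β; they may
  -- differ. As it is computed from `o w` alone, vertices of one cycle get the same key by
  -- congruence.
  keyOf : Fin n → Fin n
  keyOf w = proj₁ (least-in-class (o w))

  o-keyOf : ∀ w → o (keyOf w) ≡ o w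
  o-keyOf w = proj₁ (proj₂ (least-in-class (o w))) (o-o w)

  keyOf-≤ : ∀ w → toℕ (keyOf w) ≤ toℕ w
  keyOf-≤ w = proj₂ (proj₂ (least-in-class (o w))) w refl

  keyOf-keyOf : ∀ w → keyOf (keyOf w) ≡ keyOf w
  keyOf-keyOf w = cong (λ t → proj₁ (least-in-class t)) (o-keyOf w)

  class-Reach : ∀ {x y} → o x ≡ o y → Reach σ y x
  class-Reach {x} {y} e = Reach-trans (subst (λ t → Reach σ t x) e (reach x)) (Reach-sym σ-injective (reach y))

  keyOf-moved : ∀ {w} → σ w ≢ w → σ (keyOf w) ≢ keyOf w
  keyOf-moved {w} ne fix =
    ne (subst (λ y → σ y ≡ y) (sym (fixed-unreachable σ-injective fix (class-Reach {w} (sym (o-keyOf w))))) fix)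

  parentOf : Fin n → Par n
  parentOf w = if does (σ w ≟ w) then whitePar (parent w) else bpar (keyOf w)

  fatherOf : Fin n → Maybe (Fin n)
  fatherOf m = if does (σ m ≟ m) then nothing else if does (keyOf m ≟ m) then parent m else nothing

  encode : HF n
  encode = hf (tabulate parentOf) (tabulate fatherOf) (tabulate σ)

  private
    pr = lookup (par encode)
    cy = lookup (cyc encode)

  cyc-encode : ∀ w → cy w ≡ σ w
  cyc-encode = lookup∘tabulate σ

  par-fixed : ∀ {w} → σ w ≡ w → pr w ≡ whitePar (parent w)
  par-fixed {w} e = trans (lookup∘tabulate parentOf w)
    (cong (λ b → if b then whitePar (parent w) else bpar (keyOf w)) (dec-true (σ w ≟ w) e))

  par-moved : ∀ {w} → σ w ≢ w → pr w ≡ bpar (keyOf w)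
  par-moved {w} e = trans (lookup∘tabulate parentOf w)
    (cong (λ b → if b then whitePar (parent w) else bpar (keyOf w)) (dec-false (σ w ≟ w) e))

  par-bpar : ∀ {w m} → pr w ≡ bpar m → σ w ≢ w × keyOf w ≡ m
  par-bpar {w} {m} e = go (σ w ≟ w)
    where
    go : Dec (σ w ≡ w) → σ w ≢ w × keyOf w ≡ m
    go (yes f) = ⊥-elim (whitePar≢bpar (parent w) (trans (sym (par-fixed f)) e))
    go (no nf) = nf , bpar-injective (trans (sym (par-moved nf)) e)

  bq-key : ∀ {m} → σ m ≢ m → keyOf m ≡ m → lookup (bq encode) m ≡ parent m
  bq-key {m} ne k = trans (lookup∘tabulate fatherOf m)
    (cong₂ (λ b c → if b then nothing else if c then parent m else nothing)
      (dec-false (σ m ≟ m) ne) (dec-true (keyOf m ≟ m) k))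

  bq-other : ∀ m → ¬ (σ m ≢ m × keyOf m ≡ m) → lookup (bq encode) m ≡ nothing
  bq-other m ne = trans (lookup∘tabulate fatherOf m) (go (σ m ≟ m) (keyOf m ≟ m))
    where
    go : (d : Dec (σ m ≡ m)) (d' : Dec (keyOf m ≡ m)) →
         (if does d then nothing else if does d' then parent m else nothing) ≡ nothing
    go (yes _) _ = refl
    go (no a) (yes b) = ⊥-elim (ne (a , b))
    go (no _) (no _) = refl

  up-encode : ∀ w → up encode w ≡ parent w
  up-encode w = go (σ w ≟ w)
    where
    white : ∀ p → pr w ≡ whitePar p → up encode w ≡ p
    white p e with pr w
    white nothing refl | root = refl
    white (just u) refl | wpar u = refl
    go : Dec (σ w ≡ w) → up encode w ≡ parent w
    go (yes f) = white (parent w) (par-fixed f)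
    go (no nf) = trans (up-bpar encode (par-moved nf)) (trans (bq-key (keyOf-moved nf) (keyOf-keyOf w))
      (trans (sym (up-o (keyOf w))) (trans (cong parent (o-keyOf w)) (up-o w))))

  iterate-cong : ∀ k x → iterate cy x k ≡ iterate σ x k
  iterate-cong zero x = refl
  iterate-cong (suc k) x = trans (iterate-cong k (cy x)) (cong (λ y → iterate σ y k) (cyc-encode x))

  iterUp-Rooted : ∀ k {w} (r : Rooted parent w) → height r < k → iterUp encode k (just w) ≡ nothing
  iterUp-Rooted (suc k) {w} (top e) lt = trans (cong (iterUp encode k) (trans (up-encode w) e)) (iterUp-nothing encode k)
  iterUp-Rooted (suc k) {w} (below e r) (s≤s lt) = trans (cong (iterUp encode k) (trans (up-encode w) e)) (iterUp-Rooted k r lt)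

  encode-wf : WellFormed encode
  encode-wf = record
    { key = λ {w} e → let (ne , k) = par-bpar e in subst (λ m → pr m ≡ bpar m × toℕ m ≤ toℕ w) k
        (trans (par-moved (keyOf-moved ne)) (cong bpar (keyOf-keyOf w)) , keyOf-≤ w)
    ; no-key = λ m ne → bq-other m (λ (a , b) → ne (trans (par-moved a) (cong bpar b)))
    ; cyc-fixed = λ w nb → trans (cyc-encode w) (fixed w nb (σ w ≟ w))
    ; cyc-par = λ {w} {m} e → let (ne , k) = par-bpar e in
        trans (cong pr (cyc-encode w)) (trans (par-moved (ne ∘ σ-injective))
          (cong bpar (trans (cong (λ t → proj₁ (least-in-class t)) (o-σ w)) k)))
    ; cyc-injective = λ {u} {v} e → σ-injective (trans (sym (cyc-encode u)) (trans e (cyc-encode v)))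
    ; key-moved = λ {m} e c → proj₁ (par-bpar e) (trans (sym (cyc-encode m)) c)
    ; key-reach = λ {w} {m} e → let (ne , k) = par-bpar e
                                    (l , q) = Reach⇒iterate (class-Reach (trans (cong o (sym k)) (o-keyOf w)))
                                    (l' , l'≤ , q') = iterate-short l q
                                in l' , l'≤ , trans (iterate-cong l' m) q'
    ; acyclic = λ w → iterUp-Rooted n (rooted w) (depth<n D w)
    }
    where
    fixed : ∀ w → (∀ m → pr w ≢ bpar m) → Dec (σ w ≡ w) → σ w ≡ w
    fixed w nb (yes f) = f
    fixed w nb (no nf) = ⊥-elim (nb _ (par-moved nf))

-- The statistics of an `HF` and of its decoding

b2n : Bool → ℕ
b2n true = 1
b2n false = 0

sumFin-0 : sumFin {n} (λ _ → 0) ≡ 0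
sumFin-0 {zero} = refl
sumFin-0 {suc n} = sumFin-0 {n}

sumFin-+ : (f g : Fin n → ℕ) → sumFin (λ x → f x + g x) ≡ sumFin f + sumFin g
sumFin-+ {zero} f g = refl
sumFin-+ {suc n} f g = trans (cong (f zero + g zero +_) (sumFin-+ (f ∘ suc) (g ∘ suc)))
                         (interchange ℕ.+-commutativeSemigroup (f zero) (g zero) _ _)

sumFin-swap : {m : ℕ} (f : Fin m → Fin n → ℕ) →
              sumFin (λ x → sumFin (λ y → f x y)) ≡ sumFin (λ y → sumFin (λ x → f x y))
sumFin-swap {n} {zero} f = sym (sumFin-0 {n})
sumFin-swap {n} {suc m} f = trans (cong (sumFin (f zero) +_) (sumFin-swap (f ∘ suc)))
                              (sym (sumFin-+ (f zero) (λ y → sumFin (λ x → f (suc x) y))))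

sumFin-zero : {f : Fin n → ℕ} → (∀ x → f x ≡ 0) → sumFin f ≡ 0
sumFin-zero {n} e = trans (sumFin-cong e) (sumFin-0 {n})

sumFin-single : (s : Fin n) {f : Fin n → ℕ} → (∀ {x} → x ≢ s → f x ≡ 0) → sumFin f ≡ f s
sumFin-single {n} s {f} e = trans (sym (ℕ.+-identityʳ _)) (trans (sumFin-change s {f} {λ _ → 0} (λ {x} → e {x}))
                          (cong (_+ f s) (sumFin-0 {n})))

sum-allFin : (f : Fin n → ℕ) → sum (List.map f (allFin n)) ≡ sumFin f
sum-allFin f = go id
  where
  go : ∀ {m} (g : Fin m → _) → sum (List.map f (List.tabulate g)) ≡ sumFin (f ∘ g)
  go {zero} g = refl
  go {suc m} g = cong (f (g zero) +_) (go (g ∘ suc))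

countF≡sumFin : (p : Fin n → Bool) → countF p ≡ sumFin (b2n ∘ p)
countF≡sumFin p = go id
  where
  go : ∀ {m} (g : Fin m → _) → List.length (List.filterᵇ p (List.tabulate g)) ≡ sumFin (b2n ∘ p ∘ g)
  go {zero} g = refl
  go {suc m} g with p (g zero)
  ... | true = cong suc (go (g ∘ suc))
  ... | false = go (g ∘ suc)

b2n-false : {b : Bool} → ¬ T b → b2n b ≡ 0
b2n-false {false} _ = refl
b2n-false {true} h = ⊥-elim (h tt)

b2n-true∧ : {b c : Bool} → T b → b2n (b ∧ c) ≡ b2n c
b2n-true∧ {true} _ = refl

hit-improper : (b : Bool) → hit improperK (if b then improperK else properK) ≡ b2n b
hit-improper true = refl
hit-improper false = refl

hit-if : (k : Kind) → hit k improperK ≡ 0 → hit k properK ≡ 0 → (b : Bool) → hit k (if b then improperK else properK) ≡ 0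
hit-if k e e' true = e
hit-if k e e' false = e'

-- The tests of the definitions as functions of the entry in `par`, so that sums can be evaluated by
-- cases on this entry.
childPar : Fin n → Par n → Bool
childPar m (bpar m') = m' == m
childPar m _ = false

whitePar-edge : Fin n → Par n → Bool
whitePar-edge u (wpar u') = u' == u
whitePar-edge u _ = false

rootPar : Par n → Bool
rootPar root = true
rootPar _ = false

module Statistics (F : HF n) (W : WellFormed F) where
  open WellFormed W
  open Decode F W

  upPar : Par n → Maybe (Fin n)
  upPar root = nothing
  upPar (wpar u) = just u
  upPar (bpar m) = lookup (bq F) m

  up-par : ∀ x → up F x ≡ upPar (pr x)
  up-par x with pr x
  ... | root = refl
  ... | wpar u = refl
  ... | bpar m = refl

  isRoot-par : ∀ x → isRoot F x ≡ rootPar (pr x)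
  isRoot-par x with pr x
  ... | root = refl
  ... | wpar u = refl
  ... | bpar m = refl

  childOf-par : ∀ x m → childOf F x m ≡ childPar m (pr x)
  childOf-par x m with pr x
  ... | root = refl
  ... | wpar u = refl
  ... | bpar m = refl

  whiteEdge-par : ∀ u x → whiteEdge F u x ≡ whitePar-edge u (pr x)
  whiteEdge-par u x with pr x
  ... | root = refl
  ... | wpar u = refl
  ... | bpar m = refl

  repB : Fin n → Par n → Bool
  repB x p = does (repOf x p ≟ x)

  kindPar : Fin n → Par n → Kind
  kindPar x p = kindOf (repB x p) (Maybe.map toℕ (upPar p)) (βW F x)

  kindPar-white : ∀ x p → repOf x p ≡ x → kindPar x p ≡ kindOf true (Maybe.map toℕ (upPar p)) (βW F x)
  kindPar-white x p e = cong (λ b → kindOf b (Maybe.map toℕ (upPar p)) (βW F x)) (dec-true (repOf x p ≟ x) e)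

  kind-par : ∀ x → kind decode x ≡ kindPar x (pr x)
  kind-par x = cong (λ q → kindOf (repB x (pr x)) (Maybe.map toℕ q) (βW F x)) (up-par x)

  sum-childPar : ∀ m (e : Fin n → Bool) → sumFin (λ m' → b2n (childPar m' (bpar m) ∧ e m')) ≡ b2n (e m)
  sum-childPar m e = trans (sumFin-single m (λ {x} ne → b2n-false (λ t → ne (sym (==⇒≡ m x (proj₁ (T-∧⁻ (m == x) t)))))))
                       (b2n-true∧ (≡⇒== {a = m} refl))

  sum-whitePar : ∀ u (e : Fin n → Bool) → sumFin (λ u' → b2n (whitePar-edge u' (wpar u) ∧ e u')) ≡ b2n (e u)
  sum-whitePar u e = trans (sumFin-single u (λ {x} ne → b2n-false (λ t → ne (sym (==⇒≡ u x (proj₁ (T-∧⁻ (u == x) t)))))))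
                       (b2n-true∧ (≡⇒== {a = u} refl))

  leader-only : ∀ {x m} → pr x ≡ bpar m → T (repB x (pr x)) → x ≡ leader m
  leader-only {x} e t = trans (sym (does⁻ (repOf x (pr x) ≟ x) (T⇒true t))) (rep-black e)
    where
    T⇒true : ∀ {b} → T b → b ≡ true
    T⇒true {true} _ = refl

  leader-rep : ∀ {w m} → pr w ≡ bpar m → T (repB (leader m) (pr (leader m)))
  leader-rep {m = m} e = subst T (sym (dec-true (repOf (leader m) (pr (leader m)) ≟ leader m) (rep-black (leader-child e)))) tt

  -- A black vertex is counted at its unique leader, which turns a sum over keys into a sum over
  -- white vertices.
  sum-leaders : ∀ m (c : Bool) → sumFin (λ x → b2n (childOf F x m ∧ (repB x (pr x) ∧ c))) ≡ b2n (isKey F m ∧ c)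
  sum-leaders m c with T? (isKey F m)
  ... | yes k = trans (sumFin-single (leader m) {λ x → b2n (childOf F x m ∧ (repB x (pr x) ∧ c))}
                  (λ {x} ne → b2n-false (λ t → let (ch , t') = T-∧⁻ (childOf F x m) t in
                    ne (leader-only (childOf⁻ F ch) (proj₁ (T-∧⁻ (repB x (pr x)) t'))))))
                (trans (b2n-true∧ (childOf⁺ F (leader-child (childOf⁻ F k))))
                  (trans (b2n-true∧ (leader-rep (childOf⁻ F k))) (sym (b2n-true∧ k))))
  ... | no nk = trans (sumFin-zero (λ x → b2n-false (λ t → nk (childOf⁺ F (proj₁ (key (childOf⁻ F (proj₁ (T-∧⁻ (childOf F x m) t)))))))))
                  (sym (b2n-false (λ t → nk (proj₁ (T-∧⁻ (isKey F m) t)))))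

  sum-by-child : (e : Fin n → Fin n → Par n → Bool) →
    sumFin (λ m → sumFin (λ x → b2n (childOf F x m ∧ e m x (pr x)))) ≡ sumFin (λ x → sumFin (λ m → b2n (childPar m (pr x) ∧ e m x (pr x))))
  sum-by-child e = trans (sumFin-swap (λ m x → b2n (childOf F x m ∧ e m x (pr x))))
    (sumFin-cong (λ x → sumFin-cong (λ m → cong (λ b → b2n (b ∧ e m x (pr x))) (childOf-par x m))))

  tree≡ : tree F ≡ num decode rootK
  tree≡ = trans (cong₂ _+_ (trans (countF≡sumFin (isRoot F)) (sumFin-cong (λ x → cong b2n (isRoot-par x))))
            (trans (countF≡sumFin (λ m → isKey F m ∧ isNothing (lookup (bq F) m)))
              (trans (sumFin-cong (λ m → sym (sum-leaders m (isNothing (lookup (bq F) m)))))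
                (sum-by-child (λ m x p → repB x p ∧ isNothing (lookup (bq F) m))))))
          (trans (sym (sumFin-+ (λ x → b2n (rootPar (pr x))) _))
            (sumFin-cong (λ x → trans (sym (split x (pr x))) (cong (hit rootK) (sym (kind-par x))))))
    where
    split : ∀ x p → hit rootK (kindPar x p) ≡
            b2n (rootPar p) + sumFin (λ m → b2n (childPar m p ∧ (repB x p ∧ isNothing (lookup (bq F) m))))
    split x root = trans (cong (hit rootK) (kindPar-white x root refl)) (cong suc (sym (sumFin-0 {n})))
    split x (wpar u) = trans (cong (hit rootK) (kindPar-white x (wpar u) refl)) (trans (hit-if rootK refl refl (βW F x <ᵇ toℕ u)) (sym (sumFin-0 {n})))
    split x (bpar m) = trans (go (repB x (bpar m)) (lookup (bq F) m))
                         (sym (sum-childPar m (λ m' → repB x (bpar m) ∧ isNothing (lookup (bq F) m'))))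
      where
      go : ∀ b q → hit rootK (kindOf b (Maybe.map toℕ q) (βW F x)) ≡ b2n (b ∧ isNothing q)
      go false q = refl
      go true nothing = refl
      go true (just f) = hit-if rootK refl refl (βW F x <ᵇ toℕ f)

  -- `rightmost` asks only for a least β among the children of m. These are siblings, so by
  -- `siblings-distinct` the minimum is attained by the leader alone.
  rightmost-rep : ∀ m v → isKey F m ∧ (rightmost F m v ∧ blackFatherGreater F m (βW F v)) ≡
                          childOf F v m ∧ (repB v (pr v) ∧ blackFatherGreater F m (βW F v))
  rightmost-rep m v = T-≡
    (λ t → let (k , t') = T-∧⁻ (isKey F m) t
               (r , g) = T-∧⁻ (rightmost F m v) t'
               (c , al) = T-∧⁻ (childOf F v m) r
           in T-∧⁺ (childOf F v m) c (T-∧⁺ (repB v (pr v)) (subst (λ y → T (repB y (pr y))) (sym (is-leader c al))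
                (leader-rep (childOf⁻ F c))) g))
    (λ t → let (c , t') = T-∧⁻ (childOf F v m) t
               (r , g) = T-∧⁻ (repB v (pr v)) t'
           in T-∧⁺ (isKey F m) (childOf⁺ F (proj₁ (key (childOf⁻ F c)))) (T-∧⁺ (rightmost F m v)
                (T-∧⁺ (childOf F v m) c (allF⁺ _ λ x → T-not-∨⁺ (childOf F x m) λ c' → ℕ.≤⇒≤ᵇ
                  (subst (λ y → βW F y ≤ βW F x) (sym (leader-only (childOf⁻ F c) r)) (leader-min (childOf⁻ F c'))))) g))
    where
    is-leader : T (childOf F v m) → T (allF (λ x → not (childOf F x m) ∨ (βW F v ≤ᵇ βW F x))) → v ≡ leader m
    is-leader c al = siblings-distinct decode toℕ-injective
      (trans (up-bpar F (childOf⁻ F c)) (sym (up-bpar F (leader-child (childOf⁻ F c)))))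
      (ℕ.≤-antisym (ℕ.≤ᵇ⇒≤ _ _ (T-not-∨⁻ (childOf F (leader m) m) (allF⁻ _ al (leader m))
                     (childOf⁺ F (leader-child (childOf⁻ F c)))))
        (leader-min (childOf⁻ F c)))

  imp≡ : imp F ≡ num decode improperK
  imp≡ = trans (cong₂ _+_
      (trans (sum-allFin {n} _) (trans (sumFin-cong {n} (λ u → countF≡sumFin {n} _))
        (trans (sumFin-swap (λ u v → b2n (whiteEdge F u v ∧ (βW F v <ᵇ toℕ u))))
          (sumFin-cong (λ v → sumFin-cong (λ u → cong (λ b → b2n (b ∧ (βW F v <ᵇ toℕ u))) (whiteEdge-par u v)))))))
      (trans (sum-allFin {n} _) (trans (sumFin-cong (λ m → trans (countF≡sumFin {n} _) (sumFin-cong (λ v → cong b2n (rightmost-rep m v)))))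
        (sum-by-child (λ m v p → repB v p ∧ blackFatherGreater F m (βW F v))))))
    (trans (sym (sumFin-+ {n} _ _)) (sumFin-cong (λ x → trans (sym (split x (pr x))) (cong (hit improperK) (sym (kind-par x))))))
    where
    split : ∀ x p → hit improperK (kindPar x p) ≡
            sumFin (λ u → b2n (whitePar-edge u p ∧ (βW F x <ᵇ toℕ u)))
            + sumFin (λ m → b2n (childPar m p ∧ (repB x p ∧ blackFatherGreater F m (βW F x))))
    split x root = trans (cong (hit improperK) (kindPar-white x root refl)) (sym (cong₂ _+_ (sumFin-0 {n}) (sumFin-0 {n})))
    split x (wpar u) = trans (cong (hit improperK) (kindPar-white x (wpar u) refl)) (trans (hit-improper (βW F x <ᵇ toℕ u)) (trans (sym (ℕ.+-identityʳ _))
      (cong₂ _+_ (sym (sum-whitePar u (λ u' → βW F x <ᵇ toℕ u'))) (sym (sumFin-0 {n})))))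
    split x (bpar m) = trans black (cong₂ _+_ (sym (sumFin-0 {n}))
        (sym (sum-childPar m (λ m' → repB x (bpar m) ∧ blackFatherGreater F m' (βW F x)))))
      where
      black : hit improperK (kindPar x (bpar m)) ≡ b2n (repB x (bpar m) ∧ blackFatherGreater F m (βW F x))
      black with repB x (bpar m)
      ... | false = refl
      ... | true with lookup (bq F) m
      ...   | nothing = refl
      ...   | just f = hit-improper (βW F x <ᵇ toℕ f)

  -- Subtracting 1 from the degree of a black vertex discards its leader, and the children that
  -- remain are the non-representatives.
  bdeg≡ : bdeg F ≡ num decode extraK
  bdeg≡ = trans (sum-allFin {n} _) (trans (sumFin-cong degree)
    (trans (sum-by-child (λ m x p → not (repB x p)))
      (sumFin-cong (λ x → trans (sym (split x (pr x))) (cong (hit extraK) (sym (kind-par x)))))))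
    where
    extra : Fin n → ℕ
    extra m = sumFin (λ x → b2n (childOf F x m ∧ not (repB x (pr x))))
    either : ∀ a b → b2n a ≡ b2n (a ∧ (b ∧ true)) + b2n (a ∧ not b)
    either false b = refl
    either true true = refl
    either true false = refl
    count : ∀ m → countF (λ w → childOf F w m) ≡ b2n (isKey F m ∧ true) + extra m
    count m = trans (countF≡sumFin {n} _) (trans (sumFin-cong (λ x → either (childOf F x m) (repB x (pr x))))
      (trans (sumFin-+ (λ x → b2n (childOf F x m ∧ (repB x (pr x) ∧ true))) _) (cong (_+ extra m) (sum-leaders m true))))
    degree : ∀ m → (if isKey F m then countF (λ w → childOf F w m) ∸ 1 else 0) ≡ extra m
    degree m with T? (isKey F m)
    ... | yes k = trans (cong (λ b → if b then countF (λ w → childOf F w m) ∸ 1 else 0) (T-≡ {isKey F m} {true} _ (λ _ → k)))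
                    (trans (cong (_∸ 1) (count m)) (cong (λ i → i + extra m ∸ 1) (b2n-true∧ {isKey F m} {true} k)))
    ... | no nk = trans (cong (λ b → if b then countF (λ w → childOf F w m) ∸ 1 else 0) (T-≡ {isKey F m} {false} nk (λ ())))
                    (sym (sumFin-zero (λ x → b2n-false (λ t → nk (childOf⁺ F (proj₁ (key (childOf⁻ F (proj₁ (T-∧⁻ (childOf F x m) t))))))))))
    split : ∀ x p → hit extraK (kindPar x p) ≡ sumFin (λ m → b2n (childPar m p ∧ not (repB x p)))
    split x root = trans (cong (hit extraK) (kindPar-white x root refl)) (sym (sumFin-0 {n}))
    split x (wpar u) = trans (cong (hit extraK) (kindPar-white x (wpar u) refl)) (trans (hit-if extraK refl refl (βW F x <ᵇ toℕ u)) (sym (sumFin-0 {n})))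
    split x (bpar m) = trans (go (repB x (bpar m)) (lookup (bq F) m)) (sym (sum-childPar m (λ _ → not (repB x (bpar m)))))
      where
      go : ∀ b q → hit extraK (kindOf b (Maybe.map toℕ q) (βW F x)) ≡ b2n (not b)
      go false q = refl
      go true nothing = refl
      go true (just f) = hit-if extraK refl refl (βW F x <ᵇ toℕ f)

-- The bijection between histories and well-formed `HF`

num-≈ : {lab : Fin n → ℕ} → (∀ {x y} → lab x ≡ lab y → x ≡ y) → {F G : Forest n lab} → F ≈ G → ∀ k → num F k ≡ num G k
num-≈ {lab = lab} lab-inj {F} {G} e k = sumFin-cong λ x → cong (hit k)
  (trans (cong₂ (λ y q → kindOf (does (y ≟ x)) (Maybe.map lab q) (Forest.β F x)) (o≈ lab-inj e x) (up≈ e x))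
    (cong (kindOf (does (Forest.o G x ≟ x)) (Maybe.map lab (Forest.parent G x))) (β≈ e x)))

module _ {lab lab' : Fin n → ℕ} (π : Fin n → Fin n) (π² : ∀ x → π (π x) ≡ x)
         (e : ∀ x → lab' x ≡ lab (π x)) (e' : ∀ x → lab x ≡ lab' (π x)) where
  relabel-cong : {F G : Forest n lab} → F ≈ G → relabel F π π² lab' e ≈ relabel G π π² lab' e
  relabel-cong E = record { σ≈ = λ x → cong π (σ≈ E (π x)) ; up≈ = λ x → cong (Maybe.map π) (up≈ E (π x)) }

  relabel² : (F : Forest n lab) → relabel (relabel F π π² lab' e) π π² lab e' ≈ F
  relabel² F = record
    { σ≈ = λ x → trans (π² _) (cong (Forest.σ F) (π² x))
    ; up≈ = λ x → trans (sym (map-∘ (Forest.parent F (π (π x))))) (trans (map-cong π² (Forest.parent F (π (π x))))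
                    (trans (map-id (Forest.parent F (π (π x)))) (cong (Forest.parent F) (π² x)))) }

rk≡toℕ-opposite : (x : Fin n) → rk x ≡ toℕ (opposite x)
rk≡toℕ-opposite x = trans (go x) (sym (opposite-prop x))
  where
  go : ∀ {n} (x : Fin n) → rk x ≡ n ∸ suc (toℕ x)
  go zero = refl
  go (suc x) = go x

toℕ≡rk-opposite : (x : Fin n) → toℕ x ≡ rk (opposite x)
toℕ≡rk-opposite x = sym (trans (rk≡toℕ-opposite (opposite x)) (cong toℕ (opposite-involutive x)))

-- In `HF` labels increase along `Fin n`, while the insertion wants the largest label at `zero`;
-- `opposite` mediates.
increasing : Forest n rk → Forest n toℕ
increasing F = relabel F opposite opposite-involutive toℕ toℕ≡rk-opposite

decreasing : Forest n toℕ → Forest n rk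
decreasing D = relabel D opposite opposite-involutive rk rk≡toℕ-opposite

build-surjective : (G : Forest n rk) → ∃ λ c → build c ≈ G
build-surjective {zero} G = [] , record { σ≈ = λ () ; up≈ = λ () }
build-surjective {suc n} G with F , ch , e ← ins-surjective G with c , e' ← build-surjective F =
  c ▹ Choice-cong (≈-sym e') ch , ≈-trans (≈-sym (ins-cong (≈-sym e') ch)) e

∼⇒≡ : {F : Forest n rk} {c c' : Choice F} → c ∼ c' → c ≡ c'
∼⇒≡ solo = refl
∼⇒≡ beside = refl
∼⇒≡ above = refl
∼⇒≡ {F = F} (lift {a} {i} {i'}) = cong (lift a) (Improper-irrelevant F i i')
∼⇒≡ {F = F} (join {a} {i} {i'}) = cong (join a) (Improper-irrelevant F i i')

build-injective : (c c' : Code n) → build c ≈ build c' → c ≡ c'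
build-injective [] [] _ = refl
build-injective (c ▹ ch) (c' ▹ ch') e with E , s ← ins-injective (build c) (build c') ch ch' e
  with refl ← build-injective c c' E = cong (c ▹_) (∼⇒≡ s)

decode-encode : (D : Forest n toℕ) → Decode.decode (Encode.encode D) (Encode.encode-wf D) ≈ D
decode-encode D = record { σ≈ = Encode.cyc-encode D ; up≈ = Encode.up-encode D }

opaque
  toHF : Code n → HF n
  toHF c = Encode.encode (increasing (build c))

  toHF-wf : (c : Code n) → WellFormed (toHF c)
  toHF-wf c = Encode.encode-wf (increasing (build c))

  decode-toHF : (c : Code n) → ∀ k → num (Decode.decode (toHF c) (toHF-wf c)) k ≡ num (build c) k
  decode-toHF c k = trans (num-≈ toℕ-injective (decode-encode (increasing (build c))) k)
                      (num-relabel (build c) opposite opposite-involutive toℕ≡rk-opposite k)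

  toHF-injective : (c c' : Code n) → toHF c ≡ toHF c' → c ≡ c'
  toHF-injective c c' e = build-injective c c' (≈-trans (≈-sym (relabel² opposite opposite-involutive toℕ≡rk-opposite rk≡toℕ-opposite (build c)))
    (≈-trans (relabel-cong opposite opposite-involutive rk≡toℕ-opposite toℕ≡rk-opposite E)
      (relabel² opposite opposite-involutive toℕ≡rk-opposite rk≡toℕ-opposite (build c'))))
    where
    E : increasing (build c) ≈ increasing (build c')
    E = record
      { σ≈ = λ x → trans (sym (Encode.cyc-encode (increasing (build c)) x))
               (trans (cong (λ F → lookup (cyc F) x) e) (Encode.cyc-encode (increasing (build c')) x))
      ; up≈ = λ x → trans (sym (Encode.up-encode (increasing (build c)) x))
                (trans (cong (λ F → up F x) e) (Encode.up-encode (increasing (build c')) x)) }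

  toHF-surjective : (F : HF n) → WellFormed F → ∃ λ c → toHF c ≡ F
  toHF-surjective F W with c , e ← build-surjective (decreasing (Decode.decode F W)) =
    c , HF-ext (toHF c) F (toHF-wf c) W
          (λ x → trans (Encode.cyc-encode (increasing (build c)) x) (σ≈ E x))
          (λ x → trans (Encode.up-encode (increasing (build c)) x) (up≈ E x))
    where
    E : increasing (build c) ≈ Decode.decode F W
    E = ≈-trans (relabel-cong opposite opposite-involutive toℕ≡rk-opposite rk≡toℕ-opposite e)
          (relabel² opposite opposite-involutive rk≡toℕ-opposite toℕ≡rk-opposite (Decode.decode F W))

Σ-≡ : {A : Set} {B : A → Set} → (∀ a (p q : B a) → p ≡ q) → {s t : Σ A B} → proj₁ s ≡ proj₁ t → s ≡ t
Σ-≡ irr {a , p} {a , q} refl = cong (a ,_) (irr a p q)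

module _ (i k j : ℕ) where
  private
    P : ℕ → ℕ → ℕ → Set
    P a b d = (a ≡ i) × ((b ≡ k) × (d ≡ j))

    P-irrelevant : ∀ {a b d} (p q : P a b d) → p ≡ q
    P-irrelevant (refl , refl , refl) (refl , refl , refl) = refl

  Code↔HF : Σ (Code n) (Stat P ∘ build) ↔
            Σ (HF n) (λ F → T (wf F) × P (tree F ∸ 1) (imp F) (bdeg F))
  -- One round trip comes from surjectivity of `toHF`. The other then follows from its injectivity,
  -- as the remaining components are irrelevant proofs.
  Code↔HF {n} = mk↔ₛ′ to from (λ y → Σ-≡ irr (to-from y)) (λ x → Σ-≡ (λ _ → P-irrelevant) (toHF-injective _ _ (to-from (to x))))
    where
    roots : (c : Code n) → tree (toHF c) ≡ num (build c) rootK
    roots c = trans (Statistics.tree≡ (toHF c) (toHF-wf c)) (decode-toHF c rootK)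
    impropers : (c : Code n) → imp (toHF c) ≡ num (build c) improperK
    impropers c = trans (Statistics.imp≡ (toHF c) (toHF-wf c)) (decode-toHF c improperK)
    extras : (c : Code n) → bdeg (toHF c) ≡ num (build c) extraK
    extras c = trans (Statistics.bdeg≡ (toHF c) (toHF-wf c)) (decode-toHF c extraK)
    to : Σ (Code n) (Stat P ∘ build) → Σ (HF n) (λ F → T (wf F) × P (tree F ∸ 1) (imp F) (bdeg F))
    to (c , p , q , r) = toHF c , wf⁺ (toHF c) (toHF-wf c) ,
      trans (cong (_∸ 1) (roots c)) p , trans (impropers c) q , trans (extras c) r
    code : (F : HF n) → T (wf F) → ∃ λ c → toHF c ≡ F
    code F w = toHF-surjective F (wf⁻ F w)
    from : Σ (HF n) (λ F → T (wf F) × P (tree F ∸ 1) (imp F) (bdeg F)) → Σ (Code n) (Stat P ∘ build)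
    from (F , w , p , q , r) with c , e ← code F w = c ,
      trans (cong (_∸ 1) (trans (sym (roots c)) (cong tree e))) p ,
      trans (trans (sym (impropers c)) (cong imp e)) q , trans (trans (sym (extras c)) (cong bdeg e)) r
    to-from : ∀ y → toHF (proj₁ (from y)) ≡ proj₁ y
    to-from (F , w , p) = proj₂ (code F w)
    irr : ∀ F (p q : T (wf F) × P (tree F ∸ 1) (imp F) (bdeg F)) → p ≡ q
    irr F (w , p) (w' , p') = cong₂ _,_ (T-irrelevant w w') (P-irrelevant p p')

theorem3p4 : (n : ℕ) → 1 ≤ n → (i k j : ℕ) →
    Fin (coeffZ1 (Q n) i k j) ↔
    Σ (HF n) (λ F → T (wf F) × ((tree F ∸ 1 ≡ i) × ((imp F ≡ k) × (bdeg F ≡ j))))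
theorem3p4 (suc n) _ i k j =
  ↔-trans (coeffZ1↔ (Q (suc n)) i k j) (↔-trans (Q↔Code n _) (Code↔HF i k j))
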